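{- There is an absolute constant $c$ such that for every connected graph $G$, capacity function $L$ and integer $k$ for which LP1 is feasible, one can find (in polynomial time, given a feasible solution of LP1) a $c$-feasible assignment $(x,y)$ in which every $y_u$ is an integer.
   Context: $G=(V,E)$ undirected unweighted, $\mathrm{dist}_G$ shortest-path distance, $L:V\to\mathbb{N}$, $k$ a positive integer. LP1 for $(G,L,k)$: variables $x_{u,v},y_u$ with (1) $\sum_u y_u=k$; (2) $x_{u,v}\le y_u$; (3) $\sum_v x_{u,v}\le L(u)y_u$; (4) $\sum_u x_{u,v}=1$; (5) $0\le y_u\le1$; (6) $x_{u,v}=0$ whenever $\mathrm{dist}_G(u,v)>1$; (7) $x_{u,v}\ge0$. An assignment $(x,y)$ with $x:V\times V\to\mathbb{R}_{\ge0}$, $y:V\to\mathbb{R}_{\ge0}$ is $\delta$-feasible if it satisfies (1)–(5), (7) and (6) with "$>1$" replaced by "$>\delta$".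
   Formalization: The given feasible solution (x, y) of LP1 is taken with rational rather than real values, and the resulting c-feasible assignment is rational; since LP1 has integer data, it is feasible over the reals exactly when it is feasible over the rationals. -}

module Defs where

open import Data.Bool.Base using (Bool; true; false; if_then_else_)
open import Data.Fin.Base using (Fin)
open import Data.Integer.Base as ℤ using (ℤ; +_)
open import Data.List.Base as List using (List; []; _∷_; foldr; tabulate)
open import Data.List.Membership.Propositional using (_∈_)
open import Data.List.Relation.Unary.All as All using (All; []; _∷_)
open import Data.Nat.Base as ℕ using (ℕ; zero; suc; _+_; _^_)
open import Data.Nat.Logarithm using (⌊log₂_⌋)
open import Data.Product.Base using (∃; ∃-syntax; _×_; _,_; proj₁; proj₂)
open import Data.Rational.Base as ℚ using (ℚ; 0ℚ; 1ℚ; ↥_; ↧ₙ_)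
import Data.Rational.Properties as ℚ
open import Algebra.Properties.CommutativeMonoid.Sum ℚ.+-0-commutativeMonoid
  using (sum)
open import Relation.Binary.PropositionalEquality.Core using (_≡_)
open import Relation.Nullary.Decidable.Core using (yes; no)

------------------------------------------------------------------------
-- Graphs

record Graph (n : ℕ) : Set where
  field
    adj       : Fin n → Fin n → Bool
    symmetric : ∀ u v → adj u v ≡ adj v u
    loopless  : ∀ v → adj v v ≡ false

open Graph public using (adj)

data Walk {n} (G : Graph n) : Fin n → Fin n → ℕ → Set where
  stop : ∀ {u} → Walk G u u 0
  step : ∀ {u v w ℓ} → adj G u v ≡ true → Walk G v w ℓ → Walk G u w (suc ℓ)

Connected : ∀ {n} → Graph n → Set
Connected G = ∀ u v → ∃[ ℓ ] Walk G u v ℓ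

-- dist_G(u,v) > δ, where dist_G(u,v) is the infimum of the lengths of the
-- walks from u to v (∞ if there are none).
DistanceExceeds : ∀ {n} → Graph n → ℕ → Fin n → Fin n → Set
DistanceExceeds G δ u v = ∀ {ℓ} → Walk G u v ℓ → δ ℕ.< ℓ

------------------------------------------------------------------------
-- The linear program

fromℕ : ℕ → ℚ
fromℕ m = (+ m) ℚ./ 1

IsInteger : ℚ → Set
IsInteger q = ∃[ z ] q ≡ z ℚ./ 1

-- x u v is the amount of the demand of v served by u.
record Feasible {n} (δ : ℕ) (G : Graph n) (L : Fin n → ℕ) (k : ℕ)
                (x : Fin n → Fin n → ℚ) (y : Fin n → ℚ) : Set where
  field
    opened      : sum y ≡ fromℕ k
    served≤open : ∀ u v → x u v ℚ.≤ y u
    capacity    : ∀ u → sum (λ v → x u v) ℚ.≤ fromℕ (L u) ℚ.* y u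
    covered     : ∀ v → sum (λ u → x u v) ≡ 1ℚ
    y-bounds    : ∀ u → 0ℚ ℚ.≤ y u × y u ℚ.≤ 1ℚ
    local       : ∀ u v → DistanceExceeds G δ u v → x u v ≡ 0ℚ
    x-nonneg    : ∀ u v → 0ℚ ℚ.≤ x u v

LP1 : ∀ {n} → Graph n → (Fin n → ℕ) → ℕ →
      (Fin n → Fin n → ℚ) → (Fin n → ℚ) → Set
LP1 = Feasible 1

------------------------------------------------------------------------
-- A model of computation for polynomial time
--
-- Algorithms are closed syntactic objects: terms of a first-order language
-- whose only loop is iteration over a list.  Evaluation is charged with the
-- logarithmic cost criterion (see `cost`), so the functions computed by terms
-- of polynomially bounded cost are exactly those computable in polynomial
-- time on a Turing machine: each step is a polynomial-time operation on
-- operands whose bit sizes have already been charged, and, conversely, a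
-- Turing machine with a polynomial clock can be simulated by iterating over a
-- list of polynomial length.

data Ty : Set where
  bool nat rat : Ty
  _⊗_          : Ty → Ty → Ty
  list         : Ty → Ty

infixr 5 _⊗_

Ctx : Set
Ctx = List Ty

data Op : Ty → Ty → Ty → Set where
  add monus mul        : Op nat nat nat
  leq                  : Op nat nat bool
  radd rsub rmul rdiv  : Op rat rat rat
  rleq                 : Op rat rat bool

data Term (Γ : Ctx) : Ty → Set where
  var        : ∀ {A} → A ∈ Γ → Term Γ A
  let′       : ∀ {A B} → Term Γ A → Term (A ∷ Γ) B → Term Γ B
  op         : ∀ {A B C} → Op A B C → Term Γ A → Term Γ B → Term Γ C
  boolean    : Bool → Term Γ bool
  numeral    : ℕ → Term Γ nat
  toRat      : Term Γ nat → Term Γ rat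
  cond       : ∀ {A} → Term Γ bool → Term Γ A → Term Γ A → Term Γ A
  pair       : ∀ {A B} → Term Γ A → Term Γ B → Term Γ (A ⊗ B)
  fst        : ∀ {A B} → Term Γ (A ⊗ B) → Term Γ A
  snd        : ∀ {A B} → Term Γ (A ⊗ B) → Term Γ B
  nil        : ∀ {A} → Term Γ (list A)
  cons       : ∀ {A} → Term Γ A → Term Γ (list A) → Term Γ (list A)
  caseList   : ∀ {A B} → Term Γ (list A) → Term Γ B →
               Term (A ∷ list A ∷ Γ) B → Term Γ B
  fold       : ∀ {A B} → Term Γ (list A) → Term Γ B →
               Term (A ∷ B ∷ Γ) B → Term Γ B

Program : Ty → Ty → Set
Program A B = Term (A ∷ []) B

Value : Ty → Set
Value bool     = Bool
Value nat      = ℕ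
Value rat      = ℚ
Value (A ⊗ B)  = Value A × Value B
Value (list A) = List (Value A)

Env : Ctx → Set
Env = All Value

-- Division by zero yields zero.
divide : ℚ → ℚ → ℚ
divide p q with q ℚ.≟ 0ℚ
... | yes _   = 0ℚ
... | no  q≢0 = ℚ._÷_ p q ⦃ ℚ.≢-nonZero q≢0 ⦄

applyOp : ∀ {A B C} → Op A B C → Value A → Value B → Value C
applyOp add   = ℕ._+_
applyOp monus = ℕ._∸_
applyOp mul   = ℕ._*_
applyOp leq   = ℕ._≤ᵇ_
applyOp radd  = ℚ._+_
applyOp rsub  = ℚ._-_
applyOp rmul  = ℚ._*_
applyOp rdiv  = divide
applyOp rleq  = ℚ._≤ᵇ_

elimList : ∀ {A B : Set} → B → (A → List A → B) → List A → B
elimList b f []       = b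
elimList b f (a ∷ as) = f a as

eval : ∀ {Γ A} → Term Γ A → Env Γ → Value A
eval (var i)          ρ = All.lookup ρ i
eval (let′ t s)       ρ = eval s (eval t ρ ∷ ρ)
eval (op o t s)       ρ = applyOp o (eval t ρ) (eval s ρ)
eval (boolean b)      ρ = b
eval (numeral m)      ρ = m
eval (toRat t)        ρ = fromℕ (eval t ρ)
eval (cond b t s)     ρ = if eval b ρ then eval t ρ else eval s ρ
eval (pair t s)       ρ = eval t ρ , eval s ρ
eval (fst t)          ρ = proj₁ (eval t ρ)
eval (snd t)          ρ = proj₂ (eval t ρ)
eval nil              ρ = []
eval (cons t s)       ρ = eval t ρ ∷ eval s ρ
eval (caseList t z s) ρ =
  elimList (eval z ρ) (λ a as → eval s (a ∷ as ∷ ρ)) (eval t ρ)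
eval (fold t z s)     ρ =
  foldr (λ a b → eval s (a ∷ b ∷ ρ)) (eval z ρ) (eval t ρ)

run : ∀ {A B} → Program A B → Value A → Value B
run p a = eval p (a ∷ [])

bits : ℕ → ℕ
bits m = suc ⌊log₂ m ⌋

mutual
  size : ∀ A → Value A → ℕ
  size bool     _       = 1
  size nat      m       = bits m
  size rat      q       = bits ℤ.∣ ↥ q ∣ + bits (↧ₙ q)
  size (A ⊗ B)  (a , b) = suc (size A a + size B b)
  size (list A) as      = sizeList A as

  sizeList : ∀ A → List (Value A) → ℕ
  sizeList A []       = 1
  sizeList A (a ∷ as) = suc (size A a + sizeList A as)

-- The total cost of the calls to f made by  foldr f b as, when a single call
-- f a b costs c a b.
foldCost : ∀ {A B : Set} → (A → B → B) → (A → B → ℕ) → B → List A → ℕ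
foldCost f c b []       = 0
foldCost f c b (a ∷ as) = c a (foldr f b as) + foldCost f c b as

mutual
  -- Every evaluation step costs one unit plus the size of the value it
  -- produces; in particular reading a variable is charged as a copy.
  cost : ∀ {Γ A} → Term Γ A → Env Γ → ℕ
  cost {A = A} t ρ = suc (size A (eval t ρ)) + subcost t ρ

  subcost : ∀ {Γ A} → Term Γ A → Env Γ → ℕ
  subcost (var i)          ρ = 0
  subcost (let′ t s)       ρ = cost t ρ + cost s (eval t ρ ∷ ρ)
  subcost (op o t s)       ρ = cost t ρ + cost s ρ
  subcost (boolean b)      ρ = 0
  subcost (numeral m)      ρ = 0
  subcost (toRat t)        ρ = cost t ρ
  subcost (cond b t s)     ρ =
    cost b ρ + (if eval b ρ then cost t ρ else cost s ρ)
  subcost (pair t s)       ρ = cost t ρ + cost s ρ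
  subcost (fst t)          ρ = cost t ρ
  subcost (snd t)          ρ = cost t ρ
  subcost nil              ρ = 0
  subcost (cons t s)       ρ = cost t ρ + cost s ρ
  subcost (caseList t z s) ρ =
    cost t ρ
    + elimList (cost z ρ) (λ a as → cost s (a ∷ as ∷ ρ)) (eval t ρ)
  subcost (fold t z s)     ρ =
    cost t ρ + (cost z ρ
    + foldCost (λ a b → eval s (a ∷ b ∷ ρ)) (λ a b → cost s (a ∷ b ∷ ρ))
               (eval z ρ) (eval t ρ))

time : ∀ {A B} → Program A B → Value A → ℕ
time p a = cost p (a ∷ [])

-- The running time is polynomial in the input size on the inputs satisfying
-- the promise P.  Every polynomial over ℕ is bounded by some a · (s + 1) ^ d.
PolynomialTimeOn : ∀ {A B} → (Value A → Set) → Program A B → Set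
PolynomialTimeOn {A} P p =
  ∃[ a ] ∃[ d ] (∀ i → P i → time p i ℕ.≤ a ℕ.* suc (size A i) ^ d)

------------------------------------------------------------------------
-- Encodings of the input and the output

AssignmentTy : Ty
AssignmentTy = list (list rat) ⊗ list rat

-- adjacency matrix, capacities, k, and a solution (x , y)
InstanceTy : Ty
InstanceTy = list (list bool) ⊗ list nat ⊗ nat ⊗ AssignmentTy

matrix : ∀ {A : Set} {n} → (Fin n → Fin n → A) → List (List A)
matrix f = tabulate (λ u → tabulate (f u))

encodeAssignment : ∀ {n} → (Fin n → Fin n → ℚ) → (Fin n → ℚ) →
                   Value AssignmentTy
encodeAssignment x y = matrix x , tabulate y

encodeInstance : ∀ {n} → Graph n → (Fin n → ℕ) → ℕ →
                 (Fin n → Fin n → ℚ) → (Fin n → ℚ) → Value InstanceTy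
encodeInstance G L k x y =
  matrix (adj G) , tabulate L , k , encodeAssignment x y

data ValidInput : Value InstanceTy → Set where
  valid : ∀ {n} (G : Graph n) (L : Fin n → ℕ) (k : ℕ)
          (x : Fin n → Fin n → ℚ) (y : Fin n → ℚ) →
          Connected G → 1 ℕ.≤ k → LP1 G L k x y →
          ValidInput (encodeInstance G L k x y)

{-# OPTIONS --safe #-}

-- Group the vertices in clusters around midpoints of pairwise distance at least
-- 3, so that a cluster contains the closed neighbourhood of its midpoint and
-- hence y-mass at least 1.  As the cube of a tree is Hamiltonian, the midpoints
-- can be put on a line with bounded gaps, which orders all vertices cluster by
-- cluster.  Scan this order carrying one fractionally open vertex, the bag: the
-- bag and the next vertex are merged by shifting opening to the one of larger
-- capacity, which is opened when full, while the other one stays in the bag.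
-- The phase of a vertex is the number of vertices opened so far.
--
-- Cut the total load twice: at the partial sums of the loads of the vertices,
-- and at the partial sums of the capacities of the opened vertices, truncated
-- so that they run ahead of the former by at most one phase.  Load moves
-- according to the overlaps of these intervals.  By an invariant of the scan the
-- second sums do not lag behind by more than a phase either, so load only moves
-- between vertices of neighbouring phases; as every cluster raises the phase,
-- these are close to each other.
--
-- For the running time, all accumulators of folds grow by amounts independent
-- of the accumulator, if rationals are measured by the larger of the bit sizes
-- of numerator and denominator.

module Submission where

open import Defs
open import Data.Nat.Base
open import Data.Nat.Properties
open import Data.Nat.Logarithm
open import Data.Integer.Base as ℤ using (+_; ℤ)
import Data.Integer.Properties as ℤ
open import Data.Rational.Base as ℚ using (0ℚ; 1ℚ; mkℚ; ℚ; ↥_; ↧_; ↧ₙ_)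
import Data.Rational.Properties as ℚ
open import Data.Bool.Base using (Bool; T; false; if_then_else_; true)
open import Data.List.Base using (List; []; _∷_; downFrom; foldr; length; tabulate)
open import Data.List.Relation.Unary.All as All using (All; []; _∷_)
open import Data.List.Relation.Unary.Any using (here; there)
open import Data.List.Membership.Propositional using (_∈_)
open import Data.Product.Base using (_,_; _×_; proj₁; proj₂; Σ-syntax; ∃-syntax)
open import Relation.Binary.PropositionalEquality
open import Relation.Nullary using (contradiction; no; yes; ¬_)
open import Function.Base using (_$_; _∘_; case_of_)
open import Data.Nat.Tactic.RingSolver using (solve-∀)
import Tactic.RingSolver as Ring
open import Tactic.RingSolver.Core.AlmostCommutativeRing using (AlmostCommutativeRing; fromCommutativeRing)
open import Relation.Nullary.Decidable.Core using (dec⇒maybe)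
open import Data.Unit.Base using (tt; ⊤)
open import Data.Sum.Base using (_⊎_; inj₁; inj₂)
open import Data.Nat.Coprimality using (1-coprimeTo) renaming (sym to coprime-sym)
open import Level using (0ℓ)
open import Data.List.Relation.Unary.AllPairs using (AllPairs; []; _∷_)
open import Data.List.Membership.Propositional.Properties using (∈-downFrom⁺; ∈-downFrom⁻)
open import Data.List.Relation.Unary.Unique.Propositional.Properties using (downFrom⁺)
open import Data.Fin.Base using (Fin; suc; zero)
open import Data.List.Properties using (length-tabulate; tabulate-cong)
open import Algebra.Properties.CommutativeMonoid.Sum ℚ.+-0-commutativeMonoid using (sum)

-- As `load u` is at most `L u` times `Y u`, moving opening to a vertex of at least the same
-- capacity loses nothing: the opened vertices and the fractional share of the bag together have
-- room for all load scanned so far. The obstacle is locality. A vertex may stay in the bag for many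
-- phases while others are opened, and when it is opened at last, its capacity enters the sums at
-- its early place in the order, where it would attract load from far away; hence the truncation.
-- Truncation spoils the count of capacities, but only once the sum has reached its limit. The limit
-- at phase `p` includes the load of phase `p + 1`, so a sum that has reached it holds everything up
-- to and including the next opening. Therefore the main invariant is an alternative: the limit is
-- reached, or the count is right. Since the bag is decided late but placed early, it is proved for
-- both outcomes. Distance 3 between midpoints makes their closed neighbourhoods disjoint, while
-- every vertex can still be kept within distance 2 of a midpoint. The constant is 23: vertices of
-- neighbouring phases are within 22, and one more edge leads to the served vertex.

≤-slack : ∀ {m n} k → m + k ≡ n → m ≤ n
≤-slack {m} k eq = ≤-trans (m≤m+n m k) (≤-reflexive eq)

-- Bit lengths, and heights of rationals

bits-mono : ∀ {m n} → m ≤ n → bits m ≤ bits n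
bits-mono m≤n = s≤s (⌊log₂⌋-mono-≤ m≤n)

n<2^bits : ∀ n → n < 2 ^ bits n
n<2^bits n = ≰⇒> λ le → <⇒≱ ≤-refl
  (subst (_≤ ⌊log₂ n ⌋) (⌊log₂[2^n]⌋≡n (bits n)) (⌊log₂⌋-mono-≤ le))

log₂-upper : ∀ {n} k → n < 2 ^ suc k → ⌊log₂ n ⌋ ≤ k
log₂-upper {zero}        zero    _  = z≤n
log₂-upper {suc zero}    zero    _  = z≤n
log₂-upper {suc (suc n)} zero    (s≤s (s≤s ()))
log₂-upper {n}           (suc k) n< = ≤-trans (m≤n+m∸n ⌊log₂ n ⌋ 1)
  (s≤s (subst (_≤ k) (⌊log₂⌊n/2⌋⌋≡⌊log₂n⌋∸1 n) (log₂-upper k half<)))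
  where
  half< : ⌊ n /2⌋ < 2 ^ suc k
  half< = ≰⇒> λ le → <⇒≱ n< (≤-trans
    (+-mono-≤ le (≤-trans (≤-reflexive (+-identityʳ _)) le))
    (≤-trans (+-monoʳ-≤ ⌊ n /2⌋ (⌊n/2⌋≤⌈n/2⌉ n)) (≤-reflexive (⌊n/2⌋+⌈n/2⌉≡n n))))

bits-upper : ∀ {n} k → n < 2 ^ suc k → bits n ≤ suc k
bits-upper k n< = s≤s (log₂-upper k n<)

1≤bits : ∀ n → 1 ≤ bits n
1≤bits n = s≤s z≤n

bits-+ : ∀ a b → bits (a + b) ≤ bits a + bits b
bits-+ a b = ≤-trans (bits-upper {a + b} _ (<-≤-trans (+-mono-< (n<2^bits a) (n<2^bits b))
    (≤-trans (+-mono-≤ (^-monoʳ-≤ 2 (m≤m+n (bits a) ⌊log₂ b ⌋)) (^-monoʳ-≤ 2 (b≤ )))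
      (≤-reflexive (cong (λ z → 2 ^ (bits a + ⌊log₂ b ⌋) + z) (sym (+-identityʳ _)))))))
  (≤-reflexive (sym (+-suc (bits a) _)))
  where
  b≤ : bits b ≤ bits a + ⌊log₂ b ⌋
  b≤ = +-monoˡ-≤ ⌊log₂ b ⌋ (1≤bits a)

*-<-2^ : ∀ {a b} j k → a < 2 ^ j → b < 2 ^ k → a * b < 2 ^ (j + k)
*-<-2^ {a} {b} j k a< b< = <-≤-trans
  (≤-<-trans (*-monoʳ-≤ a (<⇒≤ b<)) (*-monoˡ-< (2 ^ k) ⦃ m^n≢0 2 k ⦄ a<))
  (≤-reflexive (sym (^-distribˡ-+-* 2 j k)))

bits≤self : ∀ n → bits n ≤ suc n
bits≤self n = s≤s (log₂-upper n (n<2^1+n n))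
  where
  n<2^1+n : ∀ n → n < 2 ^ suc n
  n<2^1+n zero    = s≤s z≤n
  n<2^1+n (suc n) = ≤-trans (s≤s (n<2^1+n n))
    (≤-trans (+-monoˡ-≤ (2 ^ suc n) (m^n>0 2 (suc n)))
      (+-monoʳ-≤ (2 ^ suc n) (m≤m+n _ _)))

-- The maximum of the bit sizes of numerator and denominator is subadditive up
-- to 1; `size` itself may double under addition, which is useless for sums
-- of many rationals.
height : ℚ → ℕ
height q = bits ℤ.∣ ↥ q ∣ ⊔ bits (↧ₙ q)

height≤ : ∀ q j → ℤ.∣ ↥ q ∣ < 2 ^ suc j → ↧ₙ q < 2 ^ suc j → height q ≤ suc j
height≤ q j a b = ⊔-lub (bits-upper j a) (bits-upper j b)

-- The second equation excludes g ≡ 0.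
abs-cancel : ∀ (i d : ℤ) {g j e} → i ℤ.* g ≡ j → d ℤ.* g ≡ e → 0 < ℤ.∣ e ∣ →
             ℤ.∣ i ∣ ≤ ℤ.∣ j ∣
abs-cancel i d {g} eq eq′ 0<e = subst (ℤ.∣ i ∣ ≤_)
  (trans (sym (ℤ.abs-* i g)) (cong ℤ.∣_∣ eq))
  (m≤m*n ℤ.∣ i ∣ ℤ.∣ g ∣ ⦃ >-nonZero 0<g ⦄)
  where
  0<g : 0 < ℤ.∣ g ∣
  0<g = n≢0⇒n>0 λ g≡0 → <-irrefl
    (trans (sym (*-zeroʳ ℤ.∣ d ∣)) (trans (cong (ℤ.∣ d ∣ *_) (sym g≡0))
      (trans (sym (ℤ.abs-* d g)) (cong ℤ.∣_∣ eq′)))) 0<e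

module _ (p q : ℚ) where
  private
    np<  = <-≤-trans (n<2^bits ℤ.∣ ↥ p ∣) (^-monoʳ-≤ 2 (m≤m⊔n (bits ℤ.∣ ↥ p ∣) (bits (↧ₙ p))))
    dp<  = <-≤-trans (n<2^bits (↧ₙ p)) (^-monoʳ-≤ 2 (m≤n⊔m (bits ℤ.∣ ↥ p ∣) (bits (↧ₙ p))))
    nq<  = <-≤-trans (n<2^bits ℤ.∣ ↥ q ∣) (^-monoʳ-≤ 2 (m≤m⊔n (bits ℤ.∣ ↥ q ∣) (bits (↧ₙ q))))
    dq<  = <-≤-trans (n<2^bits (↧ₙ q)) (^-monoʳ-≤ 2 (m≤n⊔m (bits ℤ.∣ ↥ q ∣) (bits (↧ₙ q))))
    H    = height p + height q
    0<den : 0 < ℤ.∣ ℚ.↧ p ℤ.* ℚ.↧ q ∣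
    0<den = subst (0 <_) (sym (ℤ.abs-* (ℚ.↧ p) (ℚ.↧ q))) (s≤s z≤n)
    den< : ↧ₙ p * ↧ₙ q < 2 ^ H
    den< = *-<-2^ (height p) (height q) dp< dq<
    num< : ℤ.∣ ↥ p ℤ.* ↧ q ℤ.+ ↥ q ℤ.* ↧ p ∣ < 2 ^ suc H
    num< = ≤-<-trans (ℤ.∣i+j∣≤∣i∣+∣j∣ (↥ p ℤ.* ↧ q) (↥ q ℤ.* ↧ p))
      (<-≤-trans (+-mono-<
        (subst (_< 2 ^ H) (sym (ℤ.abs-* (↥ p) (↧ q))) (*-<-2^ (height p) (height q) np< dq<))
        (subst (_< 2 ^ H) (sym (ℤ.abs-* (↥ q) (↧ p)))
          (subst (λ h → ℤ.∣ ↥ q ∣ * ↧ₙ p < 2 ^ h) (+-comm (height q) (height p))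
            (*-<-2^ (height q) (height p) nq< dp<))))
        (≤-reflexive (cong (λ z → 2 ^ H + z) (sym (+-identityʳ _)))))

  -- Reduction to lowest terms divides by a common factor, so it suffices to bound the unreduced
  -- fraction. Its denominator is one product below `2 ^ H`, its numerator a sum of two; the second
  -- summand costs the extra bit.
  height-+ : height (p ℚ.+ q) ≤ suc (height p + height q)
  height-+ = height≤ (p ℚ.+ q) H
    (≤-<-trans (abs-cancel (↥ (p ℚ.+ q)) (↧ (p ℚ.+ q)) (ℚ.↥-+ p q) (ℚ.↧-+ p q) 0<den) num<)
    (≤-<-trans (subst (↧ₙ (p ℚ.+ q) ≤_) (ℤ.abs-* (↧ p) (↧ q))
                 (abs-cancel (↧ (p ℚ.+ q)) (↧ (p ℚ.+ q)) (ℚ.↧-+ p q) (ℚ.↧-+ p q) 0<den))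
      (<-≤-trans den< (m≤m+n _ _)))

height-neg : ∀ q → height (ℚ.- q) ≡ height q
height-neg q = cong₂ _⊔_
  (cong bits (trans (cong ℤ.∣_∣ (ℚ.↥-neg q)) (ℤ.∣-i∣≡∣i∣ (↥ q))))
  (cong (bits ∘ ℤ.∣_∣) (ℚ.↧-neg q))

height-- : ∀ p q → height (p ℚ.- q) ≤ suc (height p + height q)
height-- p q = subst (λ h → height (p ℚ.- q) ≤ suc (height p + h)) (height-neg q)
  (height-+ p (ℚ.- q))

height-fromℕ : ∀ m → height (fromℕ m) ≤ suc (bits m)
height-fromℕ m = ⊔-lub
  (≤-trans (bits-mono (abs-cancel (↥ fromℕ m) (↧ fromℕ m) (ℚ.↥-/ (+ m) 1) (ℚ.↧-/ (+ m) 1) (s≤s z≤n))) (n≤1+n _))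
  (≤-trans (bits-mono (abs-cancel (↧ fromℕ m) (↧ fromℕ m) (ℚ.↧-/ (+ m) 1) (ℚ.↧-/ (+ m) 1) (s≤s z≤n))) (s≤s z≤n))

-- A size measure that is subadditive on rationals

mutual
  -- `size` with rationals measured by `height`. The two agree up to a factor 2, so bounds can be
  -- proved for `sz` and carried over to `cost`, which is charged in terms of `size`.
  sz : ∀ A → Value A → ℕ
  sz bool     _       = 1
  sz nat      m       = bits m
  sz rat      q       = height q
  sz (A ⊗ B)  (a , b) = suc (sz A a + sz B b)
  sz (list A) as      = szList A as

  szList : ∀ A → List (Value A) → ℕ
  szList A []       = 1
  szList A (a ∷ as) = suc (sz A a + szList A as)

∥_∥ : ∀ {Γ} → Env Γ → ℕ
∥ [] ∥                = 0
∥ _∷_ {x = A} a ρ ∥ = sz A a + ∥ ρ ∥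

mutual
  sz≤size : ∀ A a → sz A a ≤ size A a
  sz≤size bool     a       = ≤-refl
  sz≤size nat      a       = ≤-refl
  sz≤size rat      q       = m⊔n≤m+n (bits ℤ.∣ ↥ q ∣) (bits (↧ₙ q))
  sz≤size (A ⊗ B)  (a , b) = s≤s (+-mono-≤ (sz≤size A a) (sz≤size B b))
  sz≤size (list A) as      = szList≤sizeList A as

  szList≤sizeList : ∀ A as → szList A as ≤ sizeList A as
  szList≤sizeList A []       = ≤-refl
  szList≤sizeList A (a ∷ as) = s≤s (+-mono-≤ (sz≤size A a) (szList≤sizeList A as))

double-suc : ∀ {x y} a b → x ≤ 2 * a → y ≤ 2 * b → suc (x + y) ≤ 2 * suc (a + b)
double-suc a b p q = ≤-trans (s≤s (+-mono-≤ p q)) (≤-trans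
  (≤-reflexive (cong suc (sym (*-distribˡ-+ 2 a b))))
  (+-monoʳ-≤ 1 (+-monoʳ-≤ (a + b) (n≤1+n _))))

mutual
  size≤2sz : ∀ A a → size A a ≤ 2 * sz A a
  size≤2sz bool     a       = s≤s z≤n
  size≤2sz nat      a       = m≤m+n _ _
  size≤2sz rat      q       = +-mono-≤ (m≤m⊔n (bits ℤ.∣ ↥ q ∣) (bits (↧ₙ q)))
    (≤-trans (m≤n⊔m (bits ℤ.∣ ↥ q ∣) (bits (↧ₙ q))) (≤-reflexive (sym (+-identityʳ _))))
  size≤2sz (A ⊗ B)  (a , b) = double-suc (sz A a) (sz B b) (size≤2sz A a) (size≤2sz B b)
  size≤2sz (list A) as      = sizeList≤2szList A as

  sizeList≤2szList : ∀ A as → sizeList A as ≤ 2 * szList A as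
  sizeList≤2szList A []       = s≤s z≤n
  sizeList≤2szList A (a ∷ as) =
    double-suc (sz A a) (szList A as) (size≤2sz A a) (sizeList≤2szList A as)

-- Polynomials in one variable

data Poly : Set where
  con     : ℕ → Poly
  𝕏       : Poly
  _⊞_ _⊠_ : Poly → Poly → Poly

infixl 6 _⊞_
infixl 7 _⊠_

⟦_⟧ : Poly → ℕ → ℕ
⟦ con c ⟧ s = c
⟦ 𝕏 ⟧     s = s
⟦ p ⊞ q ⟧ s = ⟦ p ⟧ s + ⟦ q ⟧ s
⟦ p ⊠ q ⟧ s = ⟦ p ⟧ s * ⟦ q ⟧ s

⟦⟧-mono : ∀ p {s t} → s ≤ t → ⟦ p ⟧ s ≤ ⟦ p ⟧ t
⟦⟧-mono (con c) s≤t = ≤-refl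
⟦⟧-mono 𝕏       s≤t = s≤t
⟦⟧-mono (p ⊞ q) s≤t = +-mono-≤ (⟦⟧-mono p s≤t) (⟦⟧-mono q s≤t)
⟦⟧-mono (p ⊠ q) s≤t = *-mono-≤ (⟦⟧-mono p s≤t) (⟦⟧-mono q s≤t)

_∘ₚ_ : Poly → Poly → Poly
con c   ∘ₚ r = con c
𝕏       ∘ₚ r = r
(p ⊞ q) ∘ₚ r = (p ∘ₚ r) ⊞ (q ∘ₚ r)
(p ⊠ q) ∘ₚ r = (p ∘ₚ r) ⊠ (q ∘ₚ r)

⟦∘⟧ : ∀ p r s → ⟦ p ∘ₚ r ⟧ s ≡ ⟦ p ⟧ (⟦ r ⟧ s)
⟦∘⟧ (con c) r s = refl
⟦∘⟧ 𝕏       r s = refl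
⟦∘⟧ (p ⊞ q) r s = cong₂ _+_ (⟦∘⟧ p r s) (⟦∘⟧ q r s)
⟦∘⟧ (p ⊠ q) r s = cong₂ _*_ (⟦∘⟧ p r s) (⟦∘⟧ q r s)

monomial-bound : ∀ p → ∃[ a ] ∃[ d ] (∀ s → ⟦ p ⟧ s ≤ a * suc s ^ d)
monomial-bound (con c) = c , 0 , λ s → ≤-reflexive (sym (*-identityʳ c))
monomial-bound 𝕏       = 1 , 1 , λ s →
  ≤-trans (n≤1+n s) (≤-reflexive (sym (trans (*-identityˡ _) (*-identityʳ _))))
monomial-bound (p ⊞ q) with monomial-bound p | monomial-bound q
... | a , d , f | b , e , g = a + b , d + e , λ s → ≤-trans
  (+-mono-≤ (≤-trans (f s) (*-monoʳ-≤ a (^-monoʳ-≤ (suc s) (m≤m+n d e))))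
            (≤-trans (g s) (*-monoʳ-≤ b (^-monoʳ-≤ (suc s) (m≤n+m e d)))))
  (≤-reflexive (sym (*-distribʳ-+ (suc s ^ (d + e)) a b)))
monomial-bound (p ⊠ q) with monomial-bound p | monomial-bound q
... | a , d , f | b , e , g = a * b , d + e , λ s → ≤-trans
  (*-mono-≤ (f s) (g s))
  (≤-reflexive (trans ([m*n]*[o*p]≡[m*o]*[n*p] a (suc s ^ d) b (suc s ^ e))
    (cong (a * b *_) (sym (^-distribˡ-+-* (suc s) d e)))))

-- Terms of polynomially bounded cost

Bounded : ∀ {Γ} → (Env Γ → ℕ) → Set
Bounded f = ∃[ p ] (∀ ρ → f ρ ≤ ⟦ p ⟧ ∥ ρ ∥)

module _ {Γ : Ctx} {f g : Env Γ → ℕ} where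
  infixl 6 _b+_
  infixl 7 _b*_

  _b+_ : Bounded f → Bounded g → Bounded (λ ρ → f ρ + g ρ)
  (p , h) b+ (q , k) = p ⊞ q , λ ρ → +-mono-≤ (h ρ) (k ρ)

  _b*_ : Bounded f → Bounded g → Bounded (λ ρ → f ρ * g ρ)
  (p , h) b* (q , k) = p ⊠ q , λ ρ → *-mono-≤ (h ρ) (k ρ)

  b-≤ : (∀ ρ → f ρ ≤ g ρ) → Bounded g → Bounded f
  b-≤ le (p , h) = p , λ ρ → ≤-trans (le ρ) (h ρ)

module _ {Γ : Ctx} where
  b-const : ∀ c → Bounded {Γ} (λ _ → c)
  b-const c = con c , λ _ → ≤-refl

  b-env : Bounded {Γ} ∥_∥
  b-env = 𝕏 , λ _ → ≤-refl

  b-poly : ∀ p {f : Env Γ → ℕ} → Bounded f → Bounded (λ ρ → ⟦ p ⟧ (f ρ))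
  b-poly p (q , h) = p ∘ₚ q , λ ρ →
    ≤-trans (⟦⟧-mono p (h ρ)) (≤-reflexive (sym (⟦∘⟧ p q _)))

-- Records rather than definitions, so that the terms can be inferred.
record Tame {Γ A} (t : Term Γ A) : Set where
  constructor tame
  field bounded : Bounded (cost t)

size≤cost : ∀ {Γ A} (t : Term Γ A) ρ → size A (eval t ρ) ≤ cost t ρ
size≤cost t ρ = ≤-trans (m≤m+n _ _) (n≤1+n _)

sz≤cost : ∀ {Γ A} (t : Term Γ A) ρ → sz A (eval t ρ) ≤ cost t ρ
sz≤cost {A = A} t ρ = ≤-trans (sz≤size A _) (size≤cost t ρ)

sz-lookup : ∀ {Γ A} (ρ : Env Γ) (i : A ∈ Γ) → sz A (All.lookup ρ i) ≤ ∥ ρ ∥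
sz-lookup (a ∷ ρ) (here refl) = m≤m+n _ _
sz-lookup (a ∷ ρ) (there i)   = ≤-trans (sz-lookup ρ i) (m≤n+m _ _)

-- The cost of an operand already contains its size, so for such an operation the size of the result
-- is paid for by the operands, up to constants.
Small : ∀ {A B C} → Op A B C → Set
Small {A} {B} {C} o = ∀ a b → sz C (applyOp o a b) ≤ suc (sz A a + sz B b)

small-add : Small add
small-add a b = ≤-trans (bits-+ a b) (n≤1+n _)

small-radd : Small radd
small-radd = height-+

small-rsub : Small rsub
small-rsub = height--

small-leq : Small leq
small-leq a b = s≤s z≤n

small-rleq : Small rleq
small-rleq a b = s≤s z≤n

module _ {Γ : Ctx} where

  tame-var : ∀ {A} (i : A ∈ Γ) → Tame (var i)
  tame-var {A} i = tame $ b-≤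
    (λ ρ → s≤s (+-monoˡ-≤ 0 (≤-trans (size≤2sz A _) (*-monoʳ-≤ 2 (sz-lookup ρ i)))))
    (b-const 1 b+ (b-const 2 b* b-env b+ b-const 0))

  tame-op : ∀ {A B C} {o : Op A B C} {t : Term Γ A} {s : Term Γ B} →
            Small o → Tame t → Tame s → Tame (op o t s)
  tame-op {C = C} {t = t} {s} small (tame bt) (tame bs) = tame $ b-≤
    (λ ρ → s≤s (+-monoˡ-≤ (cost t ρ + cost s ρ)
      (≤-trans (size≤2sz C _) (*-monoʳ-≤ 2 (≤-trans (small _ _)
        (s≤s (+-mono-≤ (sz≤cost t ρ) (sz≤cost s ρ))))))))
    (b-const 1 b+ (b-const 2 b* (b-const 1 b+ (bt b+ bs)) b+ (bt b+ bs)))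

  tame-boolean : ∀ b → Tame {Γ} (boolean b)
  tame-boolean b = tame (b-const _)

  tame-numeral : ∀ m → Tame {Γ} (numeral m)
  tame-numeral m = tame (b-const _)

  tame-toRat : ∀ {t : Term Γ nat} → Tame t → Tame (toRat t)
  tame-toRat {t} (tame bt) = tame $ b-≤
    (λ ρ → s≤s (+-monoˡ-≤ (cost t ρ) (≤-trans (size≤2sz rat (fromℕ (eval t ρ)))
      (*-monoʳ-≤ 2 (≤-trans (height-fromℕ (eval t ρ)) (s≤s (sz≤cost t ρ)))))))
    (b-const 1 b+ (b-const 2 b* (b-const 1 b+ bt) b+ bt))

  tame-nil : ∀ {A} → Tame {Γ} (nil {A = A})
  tame-nil = tame (b-const _)

  tame-let : ∀ {A B} {t : Term Γ A} {s : Term (A ∷ Γ) B} →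
             Tame t → Tame s → Tame (let′ t s)
  tame-let {A} {t = t} {s} (tame bt) (tame (p , h)) = tame $ b-≤
    (λ ρ → let C = h (eval t ρ ∷ ρ)
               K = ⟦⟧-mono p (+-monoˡ-≤ ∥ ρ ∥ (sz≤cost t ρ)) in
      s≤s (+-mono-≤ (≤-trans (size≤cost s _) (≤-trans C K))
                    (+-monoʳ-≤ (cost t ρ) (≤-trans C K))))
    (b-const 1 b+ (b-poly p (bt b+ b-env) b+ (bt b+ b-poly p (bt b+ b-env))))

  tame-pair : ∀ {A B} {t : Term Γ A} {s : Term Γ B} →
              Tame t → Tame s → Tame (pair t s)
  tame-pair {t = t} {s} (tame bt) (tame bs) = tame $ b-≤
    (λ ρ → s≤s (+-monoˡ-≤ (cost t ρ + cost s ρ)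
      (s≤s (+-mono-≤ (size≤cost t ρ) (size≤cost s ρ)))))
    (b-const 1 b+ (b-const 1 b+ (bt b+ bs) b+ (bt b+ bs)))

  tame-cons : ∀ {A} {t : Term Γ A} {s : Term Γ (list A)} →
              Tame t → Tame s → Tame (cons t s)
  tame-cons {t = t} {s} (tame bt) (tame bs) = tame $ b-≤
    (λ ρ → s≤s (+-monoˡ-≤ (cost t ρ + cost s ρ)
      (s≤s (+-mono-≤ (size≤cost t ρ) (size≤cost s ρ)))))
    (b-const 1 b+ (b-const 1 b+ (bt b+ bs) b+ (bt b+ bs)))

  tame-fst : ∀ {A B} {t : Term Γ (A ⊗ B)} → Tame t → Tame (fst t)
  tame-fst {A} {B} {t} (tame bt) = tame $ b-≤
    (λ ρ → s≤s (+-monoˡ-≤ (cost t ρ) (≤-trans (m≤m+n _ (size B _))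
      (≤-trans (n≤1+n _) (size≤cost t ρ)))))
    (b-const 1 b+ (bt b+ bt))

  tame-snd : ∀ {A B} {t : Term Γ (A ⊗ B)} → Tame t → Tame (snd t)
  tame-snd {A} {B} {t} (tame bt) = tame $ b-≤
    (λ ρ → s≤s (+-monoˡ-≤ (cost t ρ) (≤-trans (m≤n+m _ (size A _))
      (≤-trans (n≤1+n _) (size≤cost t ρ)))))
    (b-const 1 b+ (bt b+ bt))

  tame-cond : ∀ {A} {c : Term Γ bool} {t s : Term Γ A} →
              Tame c → Tame t → Tame s → Tame (cond c t s)
  tame-cond {A} {c} {t} {s} (tame bc) (tame bt) (tame bs) = tame $ b-≤
    (λ ρ → s≤s (+-mono-≤ (size-if ρ (eval c ρ)) (+-monoʳ-≤ (cost c ρ) (cost-if ρ (eval c ρ)))))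
    (b-const 1 b+ ((bt b+ bs) b+ (bc b+ (bt b+ bs))))
    where
    size-if : ∀ ρ b → size A (if b then eval t ρ else eval s ρ) ≤ cost t ρ + cost s ρ
    size-if ρ true  = ≤-trans (size≤cost t ρ) (m≤m+n (cost t ρ) (cost s ρ))
    size-if ρ false = ≤-trans (size≤cost s ρ) (m≤n+m (cost s ρ) (cost t ρ))
    cost-if : ∀ ρ b → (if b then cost t ρ else cost s ρ) ≤ cost t ρ + cost s ρ
    cost-if ρ true  = m≤m+n (cost t ρ) (cost s ρ)
    cost-if ρ false = m≤n+m (cost s ρ) (cost t ρ)

  tame-caseList : ∀ {A B} {t : Term Γ (list A)} {z : Term Γ B}
                  {s : Term (A ∷ list A ∷ Γ) B} →
                  Tame t → Tame z → Tame s → Tame (caseList t z s)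
  tame-caseList {A} {B} {t} {z} {s} (tame bt) (tame bz) (tame (p , h)) = tame $ b-≤
    (λ ρ → s≤s (+-mono-≤ (size-elim ρ (eval t ρ) (sz≤cost t ρ))
                 (+-monoʳ-≤ (cost t ρ) (cost-elim ρ (eval t ρ) (sz≤cost t ρ)))))
    (b-const 1 b+ (K b+ (bt b+ K)))
    where
    K = bz b+ b-poly p (bt b+ b-env)
    step≤ : ∀ ρ a as → szList A (a ∷ as) ≤ cost t ρ →
            cost s (a ∷ as ∷ ρ) ≤ ⟦ p ⟧ (cost t ρ + ∥ ρ ∥)
    step≤ ρ a as le = ≤-trans (h _) (⟦⟧-mono p (≤-trans
      (≤-reflexive (sym (+-assoc (sz A a) (szList A as) ∥ ρ ∥)))
      (+-monoˡ-≤ ∥ ρ ∥ (≤-trans (n≤1+n _) le))))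
    cost-elim : ∀ ρ l → szList A l ≤ cost t ρ →
                elimList (cost z ρ) (λ a as → cost s (a ∷ as ∷ ρ)) l
                ≤ cost z ρ + ⟦ p ⟧ (cost t ρ + ∥ ρ ∥)
    cost-elim ρ []       le = m≤m+n _ _
    cost-elim ρ (a ∷ as) le = ≤-trans (step≤ ρ a as le) (m≤n+m _ _)
    size-elim : ∀ ρ l → szList A l ≤ cost t ρ →
                size B (elimList (eval z ρ) (λ a as → eval s (a ∷ as ∷ ρ)) l)
                ≤ cost z ρ + ⟦ p ⟧ (cost t ρ + ∥ ρ ∥)
    size-elim ρ []       le = ≤-trans (size≤cost z ρ) (m≤m+n _ _)
    size-elim ρ (a ∷ as) le =
      ≤-trans (size≤cost s _) (≤-trans (step≤ ρ a as le) (m≤n+m _ _))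

-- Folds and the growth of their accumulators

foldAcc : ∀ {Γ A B} → Term Γ B → Term (A ∷ B ∷ Γ) B → Env Γ → List (Value A) → Value B
foldAcc z s ρ = foldr (λ a b → eval s (a ∷ b ∷ ρ)) (eval z ρ)

record AccBound {Γ A B} (z : Term Γ B) (s : Term (A ∷ B ∷ Γ) B) : Set where
  constructor accBound
  field
    poly  : Poly
    bound : ∀ ρ as → sz B (foldAcc z s ρ as) ≤ ⟦ poly ⟧ (∥ ρ ∥ + szList A as)

-- The accumulators met by the body are the results of folding the suffixes of the list. `AccBound`
-- bounds all of them by the same polynomial, hence every call has the same polynomial bound, and
-- there are at most as many calls as the size of the list.
tame-fold : ∀ {Γ A B} {t : Term Γ (list A)} {z : Term Γ B} {s : Term (A ∷ B ∷ Γ) B} →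
            AccBound z s → Tame t → Tame z → Tame s → Tame (fold t z s)
tame-fold {Γ} {A} {B} {t} {z} {s} (accBound q acc≤) (tame bt) (tame bz) (tame (p , h)) = tame $ b-≤
  (λ ρ → s≤s (+-mono-≤ (size-acc ρ) (+-monoʳ-≤ (cost t ρ) (+-monoʳ-≤ (cost z ρ)
    (≤-trans (calls ρ (cost t ρ) (eval t ρ) (sz≤cost t ρ))
      (*-monoˡ-≤ _ (sz≤cost t ρ)))))))
  (b-const 1 b+ (b-const 2 b* b-poly q (b-env b+ bt)
    b+ (bt b+ (bz b+ bt b* b-poly p (bt b+ (b-poly q (b-env b+ bt) b+ b-env))))))
  where
  size-acc : ∀ ρ → size B (eval (fold t z s) ρ) ≤ 2 * ⟦ q ⟧ (∥ ρ ∥ + cost t ρ)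
  size-acc ρ = ≤-trans (size≤2sz B _) (*-monoʳ-≤ 2 (≤-trans (acc≤ ρ (eval t ρ))
    (⟦⟧-mono q (+-monoʳ-≤ ∥ ρ ∥ (sz≤cost t ρ)))))
  calls : ∀ ρ W as → szList A as ≤ W →
    foldCost (λ a b → eval s (a ∷ b ∷ ρ)) (λ a b → cost s (a ∷ b ∷ ρ)) (eval z ρ) as
    ≤ szList A as * ⟦ p ⟧ (W + (⟦ q ⟧ (∥ ρ ∥ + W) + ∥ ρ ∥))
  calls ρ W []       le = z≤n
  calls ρ W (a ∷ as) le = +-mono-≤
    (≤-trans (h _) (⟦⟧-mono p (+-mono-≤ a≤ (+-monoˡ-≤ ∥ ρ ∥
      (≤-trans (acc≤ ρ as) (⟦⟧-mono q (+-monoʳ-≤ ∥ ρ ∥ as≤)))))))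
    (≤-trans (calls ρ W as as≤) (*-monoˡ-≤ _ (m≤n+m _ (sz A a))))
    where
    a≤ : sz A a ≤ W
    a≤ = ≤-trans (≤-trans (m≤m+n _ _) (n≤1+n _)) le
    as≤ : szList A as ≤ W
    as≤ = ≤-trans (≤-trans (m≤n+m _ _) (n≤1+n _)) le

-- I W m b: after m iterations the accumulator b is as large as the total
-- size W of all other data permits.
acc-invariant : ∀ {Γ A B} {z : Term Γ B} {s : Term (A ∷ B ∷ Γ) B}
  (I : ℕ → ℕ → Value B → Set) (q : Poly) →
  (∀ ρ W → ∥ ρ ∥ ≤ W → I W 0 (eval z ρ)) →
  (∀ ρ W m a b → ∥ ρ ∥ + sz A a ≤ W → I W m b → I W (suc m) (eval s (a ∷ b ∷ ρ))) →
  (∀ W m b → m ≤ W → I W m b → sz B b ≤ ⟦ q ⟧ W) →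
  AccBound z s
acc-invariant {A = A} {B} {z} {s} I q init next final = accBound q λ ρ as →
  final _ (length as) _ (≤-trans (len≤ as) (m≤n+m _ ∥ ρ ∥))
    (go ρ _ as ≤-refl)
  where
  len≤ : ∀ as → length as ≤ szList A as
  len≤ []       = z≤n
  len≤ (a ∷ as) = s≤s (≤-trans (len≤ as) (m≤n+m _ _))
  go : ∀ ρ W as → ∥ ρ ∥ + szList A as ≤ W → I W (length as) (foldAcc z s ρ as)
  go ρ W []       le = init ρ W (≤-trans (m≤m+n _ _) le)
  go ρ W (a ∷ as) le = next ρ W _ a _
    (≤-trans (+-monoʳ-≤ ∥ ρ ∥ (≤-trans (m≤m+n _ _) (n≤1+n _))) le)
    (go ρ W as (≤-trans (+-monoʳ-≤ ∥ ρ ∥ (≤-trans (m≤n+m _ (sz A a)) (n≤1+n _))) le))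

private
  rearrange : ∀ x y z → suc (x + (y + z)) ≡ y + (1 + x + z)
  rearrange x y z = trans (cong suc (trans (sym (+-assoc x y z)) (trans (cong (_+ z) (+-comm x y))
    (+-assoc y x z)))) (sym (+-suc y (x + z)))

module _ {Γ : Ctx} {A B : Ty} where

  record Flat {C} (t : Term (A ∷ B ∷ Γ) C) : Set where
    constructor flat-by
    field
      poly  : Poly
      bound : ∀ ρ a b → sz C (eval t (a ∷ b ∷ ρ)) ≤ ⟦ poly ⟧ (∥ ρ ∥ + sz A a)

  record Growing {C} (t : Term (A ∷ B ∷ Γ) C) : Set where
    constructor growing-by
    field
      poly  : Poly
      bound : ∀ ρ a b → sz C (eval t (a ∷ b ∷ ρ)) ≤ sz B b + ⟦ poly ⟧ (∥ ρ ∥ + sz A a)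

  -- The bound is linear in the number `m` of calls, since each call adds the same amount. A step
  -- bound merely polynomial in the accumulator would have to be composed with itself `m` times.
  acc-growing : ∀ {z : Term Γ B} {s : Term (A ∷ B ∷ Γ) B} →
                Tame z → Growing s → AccBound z s
  acc-growing {z} {s} (tame (p , h)) (growing-by q g) = acc-invariant {z = z} {s}
    (λ W m b → sz B b ≤ ⟦ p ⟧ W + m * ⟦ q ⟧ W) (p ⊞ 𝕏 ⊠ q)
    (λ ρ W le → ≤-trans (≤-trans (sz≤cost z ρ) (≤-trans (h ρ) (⟦⟧-mono p le))) (m≤m+n _ _))
    (λ ρ W m a b le I → ≤-trans (g ρ a b) (≤-trans (+-mono-≤ I (⟦⟧-mono q le))
      (≤-reflexive (trans (+-assoc (⟦ p ⟧ W) _ _)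
        (cong (λ z → ⟦ p ⟧ W + z) (+-comm (m * ⟦ q ⟧ W) _))))))
    (λ W m b m≤W I → ≤-trans I (+-monoʳ-≤ (⟦ p ⟧ W) (*-monoˡ-≤ (⟦ q ⟧ W) m≤W)))

  default : ∀ C → Value C
  default bool     = false
  default nat      = 0
  default rat      = 0ℚ
  default (C ⊗ D)  = default C , default D
  default (list C) = []

  -- Independence of the accumulator is expressed by putting a fixed default value in its place. For
  -- a term that does not mention the accumulator, both sides compute to the same value.
  flat : ∀ {C} {t : Term (A ∷ B ∷ Γ) C} → Tame t →
         (∀ ρ a b → eval t (a ∷ b ∷ ρ) ≡ eval t (a ∷ default B ∷ ρ)) → Flat t
  flat {C} {t} (tame (p , h)) eq = flat-by (p ∘ₚ (𝕏 ⊞ con (sz B (default B)))) $ λ ρ a b → ≤-trans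
    (≤-reflexive (cong (sz C) (eq ρ a b)))
    (≤-trans (sz≤cost t _) (≤-trans (h _) (≤-trans
      (⟦⟧-mono p (≤-reflexive (trans (sym (+-assoc (sz A a) (sz B (default B)) ∥ ρ ∥))
        (trans (+-comm _ ∥ ρ ∥) (sym (+-assoc ∥ ρ ∥ (sz A a) _))))))
      (≤-reflexive (sym (⟦∘⟧ p _ _))))))

  growing-acc : Growing (var (there (here refl)))
  growing-acc = growing-by (con 0) λ ρ a b → m≤m+n _ _

  growing-flat : {t : Term (A ∷ B ∷ Γ) B} → Flat t → Growing t
  growing-flat (flat-by q h) = growing-by q λ ρ a b → ≤-trans (h ρ a b) (m≤n+m _ _)

  growing-cond : ∀ {C} {c : Term (A ∷ B ∷ Γ) bool} {t s : Term (A ∷ B ∷ Γ) C} →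
                 Growing t → Growing s → Growing (cond c t s)
  growing-cond {C} {c} {t} {s} (growing-by p h) (growing-by q g) = growing-by (p ⊞ q) λ ρ a b → go ρ a b (eval c (a ∷ b ∷ ρ))
    where
    go : ∀ ρ a b c′ → sz C (if c′ then eval t (a ∷ b ∷ ρ) else eval s (a ∷ b ∷ ρ))
         ≤ sz B b + ⟦ p ⊞ q ⟧ (∥ ρ ∥ + sz A a)
    go ρ a b true  = ≤-trans (h ρ a b) (+-monoʳ-≤ (sz B b) (m≤m+n _ _))
    go ρ a b false = ≤-trans (g ρ a b) (+-monoʳ-≤ (sz B b) (m≤n+m _ _))

  growing-op : ∀ {C D E} {o : Op C D E} {t : Term (A ∷ B ∷ Γ) C} {s : Term (A ∷ B ∷ Γ) D} →
               Small o → Flat t → Growing s → Growing (op o t s)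
  growing-op {C} {D} {E} {o} {t} {s} small (flat-by p h) (growing-by q g) = growing-by (con 1 ⊞ p ⊞ q) λ ρ a b → ≤-trans
    (small _ _) (≤-trans (s≤s (+-mono-≤ (h ρ a b) (g ρ a b)))
      (≤-reflexive (rearrange (⟦ p ⟧ (∥ ρ ∥ + sz A a)) (sz B b) _)))

  growing-cons : ∀ {C} {t : Term (A ∷ B ∷ Γ) C} {s : Term (A ∷ B ∷ Γ) (list C)} →
                 Flat t → Growing s → Growing (cons t s)
  growing-cons {C} {t} {s} (flat-by p h) (growing-by q g) = growing-by (con 1 ⊞ p ⊞ q) λ ρ a b → ≤-trans
    (s≤s (+-mono-≤ (h ρ a b) (g ρ a b)))
      (≤-reflexive (rearrange (⟦ p ⟧ (∥ ρ ∥ + sz A a)) (sz B b) _))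

-- The algorithm as a function on lists

pattern v0 = here refl
pattern v1 = there v0
pattern v2 = there v1
pattern v3 = there v2
pattern v4 = there v3
pattern v5 = there v4
pattern v6 = there v5
pattern v7 = there v6

infix 4 _≐_
_≐_ : ℕ → ℕ → Bool
m ≐ n = if m ≤ᵇ n then n ≤ᵇ m else false

infixl 6 _⊓ʳ_
_⊓ʳ_ : ℚ → ℚ → ℚ
p ⊓ʳ q = if p ℚ.≤ᵇ q then p else q

-- Positions are counted from the right end of the list.
ix : ∀ {A : Set} → A → List A → ℕ → A
ix d xs i =
  proj₂ (foldr (λ a p → suc (proj₁ p) , (if proj₁ p ≐ i then a else proj₂ p)) (0 , d) xs)

-- A vertex with its phase and the decision whether to open it.
Item : Set
Item = ℕ × ℕ × Bool

-- An item with the sum of the loads of its predecessors and the end points of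
-- its interval of capacity.
Interval : Set
Interval = Item × ℚ × ℚ × ℚ

ItemTy IntervalTy : Ty
ItemTy     = nat ⊗ nat ⊗ bool
IntervalTy = ItemTy ⊗ rat ⊗ rat ⊗ rat

-- The length of the intersection of `[a , b]` and `[c , d]`: what `[a , b]` has to the left of `d`
-- minus what it has to the left of `c`. In this form it is a difference in either interval, so that
-- sums over consecutive intervals telescope.
meet : ℚ → ℚ → ℚ → ℚ → ℚ
meet a b c d = ((b ⊓ʳ d) ℚ.- (a ⊓ʳ d)) ℚ.- ((b ⊓ʳ c) ℚ.- (a ⊓ʳ c))

-- The number q of vertices opened so far; the opening r < 1 of the vertex in
-- the bag and its capacity g; the items if this vertex is eventually opened,
-- and if it is not.
State : Set
State = ℕ × ℚ × ℕ × List Item × List Item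

-- The new state after a vertex u of opening s and capacity Λ, where o tells
-- whether the openings of u and the bag suffice to open one of them, and c
-- whether u has at least the capacity of the bag.
merged : (o c : Bool) → ℕ → ℚ → ℕ → State → State
merged o c u s Λ (q , r , g , T , F) =
  if o
  then (if c
        then (suc q , (r ℚ.+ s) ℚ.- fromℕ 1 , g , (u , suc q , true) ∷ T , (u , suc q , true) ∷ F)
        else (suc q , (r ℚ.+ s) ℚ.- fromℕ 1 , Λ , (u , suc q , true) ∷ T , (u , suc q , false) ∷ T))
  else (if c
        then (q , r ℚ.+ s , Λ , (u , q , true) ∷ F , (u , q , false) ∷ F)
        else (q , r ℚ.+ s , g , (u , q , false) ∷ T , (u , q , false) ∷ F))

module Algorithm (V : List ℕ) (adj : ℕ → ℕ → Bool) (L : ℕ → ℕ)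
                 (X : ℕ → ℕ → ℚ) (Y : ℕ → ℚ) where

  near₁ near₂ near₃ : ℕ → ℕ → Bool
  near₁ i j = if i ≐ j then true else adj i j
  near₂ i j = foldr (λ w b → if b then true else (if near₁ i w then near₁ w j else false)) false V
  near₃ i j = foldr (λ w b → if b then true else (if near₁ i w then near₂ w j else false)) false V

  Line : Set
  Line = List (ℕ × Bool)

  coveredBy : Line → ℕ → Bool
  coveredBy l v = foldr (λ q b → if b then true else near₂ v (proj₁ q)) false l

  -- The flag `false` means that a vertex stands before its subtree, `true` that it stands behind
  -- it. The new vertex becomes a child of `q` with the opposite flag, immediately next to `q` on
  -- the side of the subtree of `q`.
  insertNext : ℕ → ℕ × Bool → Line → Line
  insertNext v q l = if proj₂ q then (v , false) ∷ q ∷ l else q ∷ (v , true) ∷ l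

  insert : ℕ → Line → Bool × Line
  insert v = foldr (λ q b →
    if proj₁ b then (true , q ∷ proj₂ b)
    else (if near₃ v (proj₁ q) then (true , insertNext v q (proj₂ b))
          else (false , q ∷ proj₂ b))) (false , [])

  extend : ℕ → Line → Line
  extend v l = if coveredBy l v then l else proj₂ (insert v l)

  -- As many rounds as there are vertices suffice, because each round that begins with uncovered
  -- vertices covers at least one more.
  line : Line
  line = foldr (λ _ l → foldr extend l V) ((0 , false) ∷ []) V

  midpoints : List ℕ
  midpoints = foldr (λ q l → proj₁ q ∷ l) [] line

  -- A midpoint at distance at most 1 takes precedence over those at distance 2. This is what puts
  -- the whole closed neighbourhood of a midpoint into its cluster.
  centre : List ℕ → ℕ → ℕ
  centre ms u = foldr (λ m c → if near₁ u m then m else c)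
                      (foldr (λ m c → if near₂ u m then m else c) 0 ms) ms

  cluster : List ℕ → ℕ → List ℕ → List ℕ
  cluster ms m l = foldr (λ u l → if centre ms u ≐ m then u ∷ l else l) l V

  order : List ℕ → List ℕ
  order ms = foldr (cluster ms) [] ms

  scanStep : ℕ → State → State
  scanStep u st@(q , r , g , _) =
    merged (fromℕ 1 ℚ.≤ᵇ (r ℚ.+ Y u)) (g ≤ᵇ L u) u (Y u) (L u) st

  scan : List ℕ → State
  scan = foldr scanStep (0 , fromℕ 0 , 0 , [] , [])

  load : ℕ → ℚ
  load i = foldr (λ v s → X i v ℚ.+ s) (fromℕ 0) V

  -- The load of all phases up to and including `p + 1`. The capacity interval of an item of phase
  -- `p` is cut off here, so it runs ahead by one phase at most.
  limit : List Item → ℕ → ℚ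
  limit D p = foldr (λ e s → if suc (proj₁ (proj₂ e)) ≤ᵇ suc (suc p)
                             then load (proj₁ e) ℚ.+ s else s) (fromℕ 0) D

  fill : List Item → Item → ℚ × ℚ × List Interval → ℚ × ℚ × List Interval
  fill D e@(i , p , d) (M , N , out) =
    let N′ = if d then limit D p ⊓ʳ (N ℚ.+ fromℕ (L i)) else N
    in load i ℚ.+ M , N′ , (e , M , N , N′) ∷ out

  fills : List Item → List Item → ℚ × ℚ × List Interval
  fills D = foldr (fill D) (fromℕ 0 , fromℕ 0 , [])

  before : ℕ → ℕ → ℚ
  before i v = foldr (λ w s → if suc w ≤ᵇ v then X i w ℚ.+ s else s) (fromℕ 0) V

  -- The load interval of `i` starts at `a` and is divided among the vertices it serves in
  -- increasing order of their numbers. The segment belonging to `v` is intersected with the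
  -- capacity interval of the first item.
  share : ℕ → Interval → Interval → ℚ
  share v (_ , _ , c , d) ((i , _) , a , _) =
    meet (a ℚ.+ before i v) ((a ℚ.+ before i v) ℚ.+ X i v) c d

  assigned : List Interval → ℕ → ℕ → ℚ
  assigned out u v = foldr (λ e′ s → if proj₁ (proj₁ e′) ≐ u
    then foldr (λ e t → share v e′ e ℚ.+ t) (fromℕ 0) out ℚ.+ s else s) (fromℕ 0) out

  open? : List Interval → ℕ → ℚ
  open? out u = foldr (λ e s → if proj₁ (proj₁ e) ≐ u
    then (if proj₂ (proj₂ (proj₁ e)) then fromℕ 1 ℚ.+ s else s) else s) (fromℕ 0) out

  output : List Interval → List (List ℚ) × List ℚ
  output out = foldr (λ u l → foldr (λ v l → assigned out u v ∷ l) [] V ∷ l) [] V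
             , foldr (λ u l → open? out u ∷ l) [] V

  decisions : List Item
  decisions = proj₂ (proj₂ (proj₂ (proj₂ (scan (order midpoints)))))

  intervals : List Interval
  intervals = proj₂ (proj₂ (fills decisions decisions))

  result : List (List ℚ) × List ℚ
  result = output intervals

-- The program

record Tables (Γ : Ctx) : Set where
  constructor tables
  field
    adjᵗ : list (list bool) ∈ Γ
    Lᵗ   : list nat ∈ Γ
    Xᵗ   : list (list rat) ∈ Γ
    Yᵗ   : list rat ∈ Γ
    Vᵗ   : list nat ∈ Γ

open Tables

wk : ∀ {Γ A} → Tables Γ → Tables (A ∷ Γ)
wk (tables a l x y v) = tables (there a) (there l) (there x) (there y) (there v)

same : ∀ {Γ} → Term Γ nat → Term Γ nat → Term Γ bool
same t s = cond (op leq t s) (op leq s t) (boolean false)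

module _ {Γ} (T : Tables Γ) (ρ : Env Γ) where

  adjacency : ℕ → ℕ → Bool
  adjacency i j = ix false (ix [] (All.lookup ρ (adjᵗ T)) i) j

  capacities : ℕ → ℕ
  capacities = ix 0 (All.lookup ρ (Lᵗ T))

  amounts : ℕ → ℕ → ℚ
  amounts i j = ix (fromℕ 0) (ix [] (All.lookup ρ (Xᵗ T)) i) j

  openings : ℕ → ℚ
  openings = ix (fromℕ 0) (All.lookup ρ (Yᵗ T))

increment : ∀ {Γ} → Term Γ nat → Term Γ nat
increment t = op add (numeral 1) t

zeroʳ : ∀ {Γ} → Term Γ rat
zeroʳ = toRat (numeral 0)

minimum : ∀ {Γ} → rat ∈ Γ → rat ∈ Γ → Term Γ rat
minimum p q = cond (op rleq (var p) (var q)) (var p) (var q)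

nth : ∀ {Γ A} → Term Γ A → list A ∈ Γ → nat ∈ Γ → Term Γ A
nth d xs i = snd (fold (var xs) (pair (numeral 0) d)
  (pair (increment (fst (var v1)))
        (cond (same (fst (var v1)) (var (there (there i)))) (var v0) (snd (var v1)))))

meetᵗ : ∀ {Γ} (a b c d : rat ∈ Γ) → Term Γ rat
meetᵗ a b c d = op rsub (op rsub (minimum b d) (minimum a d))
                           (op rsub (minimum b c) (minimum a c))

adjacent : ∀ {Γ} → Tables Γ → nat ∈ Γ → nat ∈ Γ → Term Γ bool
adjacent T i j = let′ (nth nil (adjᵗ T) i) (nth (boolean false) v0 (there j))

amount : ∀ {Γ} → Tables Γ → nat ∈ Γ → nat ∈ Γ → Term Γ rat
amount T i j = let′ (nth nil (Xᵗ T) i) (nth zeroʳ v0 (there j))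

capacityᵗ : ∀ {Γ} → Tables Γ → nat ∈ Γ → Term Γ nat
capacityᵗ T i = nth (numeral 0) (Lᵗ T) i

openingᵗ : ∀ {Γ} → Tables Γ → nat ∈ Γ → Term Γ rat
openingᵗ T i = nth zeroʳ (Yᵗ T) i

near₁ᵗ near₂ᵗ near₃ᵗ : ∀ {Γ} → Tables Γ → nat ∈ Γ → nat ∈ Γ → Term Γ bool
near₁ᵗ T i j = cond (same (var i) (var j)) (boolean true) (adjacent T i j)
near₂ᵗ T i j = fold (var (Vᵗ T)) (boolean false)
  (cond (var v1) (boolean true)
    (cond (near₁ᵗ (wk (wk T)) (there (there i)) v0)
          (near₁ᵗ (wk (wk T)) v0 (there (there j))) (boolean false)))
near₃ᵗ T i j = fold (var (Vᵗ T)) (boolean false)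
  (cond (var v1) (boolean true)
    (cond (near₁ᵗ (wk (wk T)) (there (there i)) v0)
          (near₂ᵗ (wk (wk T)) v0 (there (there j))) (boolean false)))

LineTy : Ty
LineTy = list (nat ⊗ bool)

coveredByᵗ : ∀ {Γ} → Tables Γ → LineTy ∈ Γ → nat ∈ Γ → Term Γ bool
coveredByᵗ T l v = fold (var l) (boolean false)
  (cond (var v1) (boolean true)
    (let′ (fst (var v0)) (near₂ᵗ (wk (wk (wk T))) (there (there (there v))) v0)))

insertᵗ : ∀ {Γ} → Tables Γ → LineTy ∈ Γ → nat ∈ Γ → Term Γ (bool ⊗ LineTy)
insertᵗ T l v = fold (var l) (pair (boolean false) nil)
  (cond (fst (var v1)) (pair (boolean true) (cons (var v0) (snd (var v1))))
    (cond (let′ (fst (var v0)) (near₃ᵗ (wk (wk (wk T))) (there (there (there v))) v0))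
      (pair (boolean true)
        (cond (snd (var v0))
          (cons (pair (var (there (there v))) (boolean false)) (cons (var v0) (snd (var v1))))
          (cons (var v0) (cons (pair (var (there (there v))) (boolean true)) (snd (var v1))))))
      (pair (boolean false) (cons (var v0) (snd (var v1))))))

extendᵗ : ∀ {Γ} → Tables Γ → nat ∈ Γ → LineTy ∈ Γ → Term Γ LineTy
extendᵗ T v l = cond (coveredByᵗ T l v) (var l) (snd (insertᵗ T l v))

roundᵗ : ∀ {Γ} → Tables Γ → LineTy ∈ Γ → Term Γ LineTy
roundᵗ T l = fold (var (Vᵗ T)) (var l) (extendᵗ (wk (wk T)) v0 v1)

lineᵗ : ∀ {Γ} → Tables Γ → Term Γ LineTy
lineᵗ T = fold (var (Vᵗ T)) (cons (pair (numeral 0) (boolean false)) nil) (roundᵗ (wk (wk T)) v1)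

midpointsᵗ : ∀ {Γ} → LineTy ∈ Γ → Term Γ (list nat)
midpointsᵗ l = fold (var l) nil (cons (fst (var v0)) (var v1))

centreᵗ : ∀ {Γ} → Tables Γ → list nat ∈ Γ → nat ∈ Γ → Term Γ nat
centreᵗ T ms u =
  fold (var ms)
    (fold (var ms) (numeral 0)
      (cond (near₂ᵗ (wk (wk T)) (there (there u)) v0) (var v0) (var v1)))
    (cond (near₁ᵗ (wk (wk T)) (there (there u)) v0) (var v0) (var v1))

clusterᵗ : ∀ {Γ} → Tables Γ → list nat ∈ Γ → nat ∈ Γ → list nat ∈ Γ → Term Γ (list nat)
clusterᵗ T ms m l = fold (var (Vᵗ T)) (var l)
  (cond (same (centreᵗ (wk (wk T)) (there (there ms)) v0) (var (there (there m))))
        (cons (var v0) (var v1)) (var v1))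

orderᵗ : ∀ {Γ} → Tables Γ → list nat ∈ Γ → Term Γ (list nat)
orderᵗ T ms = fold (var ms) nil (clusterᵗ (wk (wk T)) (there (there ms)) v0 v1)

StateTy : Ty
StateTy = nat ⊗ rat ⊗ nat ⊗ list ItemTy ⊗ list ItemTy

item : ∀ {Γ} → Term Γ nat → Term Γ nat → Bool → Term Γ (list ItemTy) → Term Γ (list ItemTy)
item u q d l = cons (pair u (pair q (boolean d))) l

scanStepᵗ : ∀ {Γ} → Tables Γ → Term (nat ∷ StateTy ∷ Γ) StateTy
scanStepᵗ {Γ} T =
  let′ (op radd (fst (snd (var v1))) (openingᵗ (wk (wk T)) v0))
  (let′ (capacityᵗ (wk (wk (wk T))) v1)
  (cond (op rleq (toRat (numeral 1)) (var v1))
    (cond (op leq g (var v0))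
      (pair q⁺ (pair t⁻ (pair g         (pair (item u q⁺ true T′)  (item u q⁺ true F′)))))
      (pair q⁺ (pair t⁻ (pair (var v0)  (pair (item u q⁺ true T′)  (item u q⁺ false T′))))))
    (cond (op leq g (var v0))
      (pair q (pair (var v1) (pair (var v0) (pair (item u q true F′)  (item u q false F′)))))
      (pair q (pair (var v1) (pair g        (pair (item u q false T′) (item u q false F′))))))))
  where
  Δ : Ctx
  Δ = nat ∷ rat ∷ nat ∷ StateTy ∷ Γ
  u q q⁺ g : Term Δ nat
  u  = var v2
  q  = fst (var v3)
  q⁺ = increment q
  g  = fst (snd (snd (var v3)))
  t⁻ : Term Δ rat
  t⁻ = op rsub (var v1) (toRat (numeral 1))
  T′ F′ : Term Δ (list ItemTy)
  T′ = fst (snd (snd (snd (var v3))))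
  F′ = snd (snd (snd (snd (var v3))))

scanᵗ : ∀ {Γ} → Tables Γ → list nat ∈ Γ → Term Γ StateTy
scanᵗ T o = fold (var o)
  (pair (numeral 0) (pair zeroʳ (pair (numeral 0) (pair nil nil)))) (scanStepᵗ T)

loadᵗ : ∀ {Γ} → Tables Γ → nat ∈ Γ → Term Γ rat
loadᵗ T i = fold (var (Vᵗ T)) zeroʳ
  (op radd (amount (wk (wk T)) (there (there i)) v0) (var v1))

limitᵗ : ∀ {Γ} → Tables Γ → list ItemTy ∈ Γ → nat ∈ Γ → Term Γ rat
limitᵗ T D p = fold (var D) zeroʳ
  (cond (op leq (increment (fst (snd (var v0)))) (op add (numeral 2) (var (there (there p)))))
    (op radd (let′ (fst (var v0)) (loadᵗ (wk (wk (wk T))) v0)) (var v1)) (var v1))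

FillTy : Ty
FillTy = rat ⊗ rat ⊗ list IntervalTy

filledᵗ : ∀ {Γ} → Tables Γ → list ItemTy ∈ Γ → Term (ItemTy ∷ FillTy ∷ Γ) rat
filledᵗ T D = cond (snd (snd (var v0)))
  (let′ (fst (snd (var v0)))
  (let′ (limitᵗ (wk (wk (wk T))) (there (there (there D))) v0)
  (let′ (fst (var v2))
  (let′ (op radd (fst (snd (var (v4)))) (toRat (capacityᵗ (wk (wk (wk (wk (wk T))))) v0)))
    (minimum v2 v0)))))
  (fst (snd (var v1)))

fillᵗ : ∀ {Γ} → Tables Γ → list ItemTy ∈ Γ → Term (ItemTy ∷ FillTy ∷ Γ) FillTy
fillᵗ T D =
  let′ (filledᵗ T D)
  (pair (op radd (let′ (fst (var v1)) (loadᵗ (wk (wk (wk (wk T)))) v0)) (fst (var v2)))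
    (pair (var v0)
      (cons (pair (var v1) (pair (fst (var v2)) (pair (fst (snd (var v2))) (var v0))))
            (snd (snd (var v2))))))

fillsᵗ : ∀ {Γ} → Tables Γ → list ItemTy ∈ Γ → Term Γ FillTy
fillsᵗ T D = fold (var D) (pair zeroʳ (pair zeroʳ nil)) (fillᵗ T D)

beforeᵗ : ∀ {Γ} → Tables Γ → nat ∈ Γ → nat ∈ Γ → Term Γ rat
beforeᵗ T i v = fold (var (Vᵗ T)) zeroʳ
  (cond (op leq (increment (var v0)) (var (there (there v))))
    (op radd (amount (wk (wk T)) (there (there i)) v0) (var v1)) (var v1))

shareᵗ : ∀ {Γ} → Tables Γ → nat ∈ Γ → IntervalTy ∈ Γ → IntervalTy ∈ Γ → Term Γ rat
shareᵗ T v e′ e =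
  let′ (fst (fst (var e)))
  (let′ (op radd (fst (snd (var (there e)))) (beforeᵗ (wk T) v0 (there v)))
  (let′ (op radd (var v0) (amount (wk (wk T)) v1 (there (there v))))
  (let′ (fst (snd (snd (var (there (there (there e′)))))))
  (let′ (snd (snd (snd (var (there (there (there (there e′))))))))
    (meetᵗ v3 v2 v1 v0)))))

assignedᵗ : ∀ {Γ} → Tables Γ → list IntervalTy ∈ Γ → nat ∈ Γ → nat ∈ Γ → Term Γ rat
assignedᵗ T out u v = fold (var out) zeroʳ
  (cond (same (fst (fst (var v0))) (var (there (there u))))
    (op radd
      (fold (var (there (there out))) zeroʳ
        (op radd (shareᵗ (wk (wk (wk (wk T)))) (there (there (there (there v)))) v2 v0) (var v1)))
      (var v1))
    (var v1))

open?ᵗ : ∀ {Γ} → list IntervalTy ∈ Γ → nat ∈ Γ → Term Γ rat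
open?ᵗ out u = fold (var out) zeroʳ
  (cond (same (fst (fst (var v0))) (var (there (there u))))
    (cond (snd (snd (fst (var v0)))) (op radd (toRat (numeral 1)) (var v1)) (var v1))
    (var v1))

resultᵗ : ∀ {Γ} → Tables Γ → list IntervalTy ∈ Γ → Term Γ AssignmentTy
resultᵗ T out = pair
  (fold (var (Vᵗ T)) nil
    (cons (fold (var (there (there (Vᵗ T)))) nil
            (cons (assignedᵗ (wk (wk (wk (wk T)))) (there (there (there (there out)))) v2 v0) (var v1)))
      (var v1)))
  (fold (var (Vᵗ T)) nil (cons (open?ᵗ (there (there out)) v0) (var v1)))

verticesᵗ : ∀ {Γ} → list nat ∈ Γ → Term Γ (list nat)
verticesᵗ l = fold (var l) nil
  (cons (caseList (var v1) (numeral 0) (increment (var v0))) (var v1))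

nextVertex : List ℕ → ℕ
nextVertex = elimList 0 (λ v _ → suc v)

vertices : List ℕ → List ℕ
vertices = foldr (λ _ l → nextVertex l ∷ l) []

rounding : Program InstanceTy AssignmentTy
rounding =
  let′ (fst (var v0))
  (let′ (fst (snd (var v1)))
  (let′ (fst (snd (snd (snd (var v2)))))
  (let′ (snd (snd (snd (snd (var v3)))))
  (let′ (verticesᵗ v2)
  (let T = tables v4 v3 v2 v1 v0 in
   let′ (lineᵗ T)
  (let T = wk T in
   let′ (midpointsᵗ v0)
  (let T = wk T in
   let′ (orderᵗ T v0)
  (let T = wk T in
   let′ (snd (snd (snd (snd (scanᵗ T v0)))))
  (let T = wk T in
   let′ (snd (snd (fillsᵗ T v0)))
  (let T = wk T in
   resultᵗ T v0))))))))))

-- Cost bounds for the parts of the program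

sz-if : ∀ A b {x y : Value A} → sz A (if b then x else y) ≤ sz A x + sz A y
sz-if A true  = m≤m+n _ _
sz-if A false = m≤n+m _ _

acc-bool : ∀ {Γ A} {z : Term Γ bool} {s : Term (A ∷ bool ∷ Γ) bool} → AccBound z s
acc-bool = accBound (con 1) λ _ _ → ≤-refl

module _ {Γ : Ctx} where

  tame-same : {t s : Term Γ nat} → Tame t → Tame s → Tame (same t s)
  tame-same bt bs = tame-cond (tame-op small-leq bt bs) (tame-op small-leq bs bt)
                              (tame-boolean false)

  tame-increment : {t : Term Γ nat} → Tame t → Tame (increment t)
  tame-increment bt = tame-op small-add (tame-numeral 1) bt

  tame-zeroʳ : Tame {Γ} zeroʳ
  tame-zeroʳ = tame-toRat (tame-numeral 0)

  tame-minimum : (p q : rat ∈ Γ) → Tame (minimum p q)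
  tame-minimum p q =
    tame-cond (tame-op small-rleq (tame-var p) (tame-var q)) (tame-var p) (tame-var q)

  tame-meet : (a b c d : rat ∈ Γ) → Tame (meetᵗ a b c d)
  tame-meet a b c d = tame-op small-rsub
    (tame-op small-rsub (tame-minimum b d) (tame-minimum a d))
    (tame-op small-rsub (tame-minimum b c) (tame-minimum a c))

bits-suc : ∀ n → bits (suc n) ≤ suc (bits n)
bits-suc n = bits-+ 1 n

tame-nth : ∀ {Γ A} {d : Term Γ A} (xs : list A ∈ Γ) (i : nat ∈ Γ) → Tame d → Tame (nth d xs i)
tame-nth {Γ} {A} {d} xs i bd = tame-snd (tame-fold
  (acc-growing bz (growing-by (con 1 ⊞ 𝕏) growth))
  (tame-var xs) bz
  (tame-pair (tame-increment (tame-fst (tame-var v1)))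
    (tame-cond (tame-same (tame-fst (tame-var v1)) (tame-var (there (there i))))
      (tame-var v0) (tame-snd (tame-var v1)))))
  where
  bz : Tame {Γ} (pair (numeral 0) d)
  bz = tame-pair (tame-numeral 0) bd
  growth : ∀ (ρ : Env Γ) a (b : ℕ × Value A) →
    sz (nat ⊗ A) (suc (proj₁ b) , (if proj₁ b ≐ All.lookup ρ i then a else proj₂ b))
    ≤ sz (nat ⊗ A) b + (1 + (∥ ρ ∥ + sz A a))
  growth ρ a b@(c , r) = ≤-trans
    (s≤s (+-mono-≤ (bits-suc c) (sz-if A (c ≐ All.lookup ρ i))))
    (≤-slack ∥ ρ ∥ (arith (bits c) (sz A r) (sz A a) ∥ ρ ∥))
    where
    arith : ∀ c r a e → suc (suc c + (a + r)) + e ≡ suc (c + r) + (1 + (e + a))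
    arith = solve-∀

ix-size : ∀ A d xs i → sz A (ix d xs i) ≤ sz A d + szList A xs
ix-size A d xs i = go xs
  where
  go : ∀ xs → sz A (ix d xs i) ≤ sz A d + szList A xs
  go []       = m≤m+n _ _
  go (x ∷ xs) = ≤-trans (sz-if A (proj₁ (foldr (λ a p → suc (proj₁ p) ,
      (if proj₁ p ≐ i then a else proj₂ p)) (0 , d) xs) ≐ i))
    (≤-trans (+-monoʳ-≤ (sz A x) (go xs)) (≤-slack 1 (arith (sz A x) (sz A d) _)))
    where
    arith : ∀ x d l → x + (d + l) + 1 ≡ d + suc (x + l)
    arith = solve-∀

tame-adjacent : ∀ {Γ} (T : Tables Γ) i j → Tame (adjacent T i j)
tame-adjacent T i j = tame-let (tame-nth (adjᵗ T) i tame-nil) (tame-nth v0 (there j) (tame-boolean false))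

tame-amount : ∀ {Γ} (T : Tables Γ) i j → Tame (amount T i j)
tame-amount T i j = tame-let (tame-nth (Xᵗ T) i tame-nil) (tame-nth v0 (there j) tame-zeroʳ)

tame-capacity : ∀ {Γ} (T : Tables Γ) i → Tame (capacityᵗ T i)
tame-capacity T i = tame-nth (Lᵗ T) i (tame-numeral 0)

tame-opening : ∀ {Γ} (T : Tables Γ) i → Tame (openingᵗ T i)
tame-opening T i = tame-nth (Yᵗ T) i tame-zeroʳ

tame-near₁ : ∀ {Γ} (T : Tables Γ) i j → Tame (near₁ᵗ T i j)
tame-near₁ T i j =
  tame-cond (tame-same (tame-var i) (tame-var j)) (tame-boolean true) (tame-adjacent T i j)

tame-near₂ : ∀ {Γ} (T : Tables Γ) i j → Tame (near₂ᵗ T i j)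
tame-near₂ T i j = tame-fold acc-bool (tame-var (Vᵗ T)) (tame-boolean false)
  (tame-cond (tame-var v1) (tame-boolean true)
    (tame-cond (tame-near₁ (wk (wk T)) _ _) (tame-near₁ (wk (wk T)) _ _) (tame-boolean false)))

tame-near₃ : ∀ {Γ} (T : Tables Γ) i j → Tame (near₃ᵗ T i j)
tame-near₃ T i j = tame-fold acc-bool (tame-var (Vᵗ T)) (tame-boolean false)
  (tame-cond (tame-var v1) (tame-boolean true)
    (tame-cond (tame-near₁ (wk (wk T)) _ _) (tame-near₂ (wk (wk T)) _ _) (tame-boolean false)))

tame-coveredBy : ∀ {Γ} (T : Tables Γ) l v → Tame (coveredByᵗ T l v)
tame-coveredBy T l v = tame-fold acc-bool (tame-var l) (tame-boolean false)
  (tame-cond (tame-var v1) (tame-boolean true)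
    (tame-let (tame-fst (tame-var v0)) (tame-near₂ (wk (wk (wk T))) _ _)))

insertion-step-size : ∀ c₁ c₂ c₃ v (q : ℕ × Bool) d l →
  sz (bool ⊗ LineTy)
    (if c₁ then (true , q ∷ l)
     else (if c₂ then (true , (if c₃ then (v , false) ∷ q ∷ l else q ∷ (v , true) ∷ l))
           else (false , q ∷ l)))
  ≤ sz (bool ⊗ LineTy) (d , l) + (4 + (bits v + sz (nat ⊗ bool) q))
insertion-step-size true  _     _     v q d l = ≤-slack (3 + bits v) (arith (bits v) (sz (nat ⊗ bool) q) (sz LineTy l))
  where
  arith : ∀ v q l → suc (1 + suc (q + l)) + (3 + v) ≡ suc (1 + l) + (4 + (v + q))
  arith = solve-∀
insertion-step-size false true  true  v q d l = ≤-slack 0 (arith (bits v) (sz (nat ⊗ bool) q) (sz LineTy l))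
  where
  arith : ∀ v q l → suc (1 + suc (suc (v + 1) + suc (q + l))) + 0 ≡ suc (1 + l) + (4 + (v + q))
  arith = solve-∀
insertion-step-size false true  false v q d l = ≤-slack 0 (arith (bits v) (sz (nat ⊗ bool) q) (sz LineTy l))
  where
  arith : ∀ v q l → suc (1 + suc (q + suc (suc (v + 1) + l))) + 0 ≡ suc (1 + l) + (4 + (v + q))
  arith = solve-∀
insertion-step-size false false _     v q d l = ≤-slack (3 + bits v) (arith (bits v) (sz (nat ⊗ bool) q) (sz LineTy l))
  where
  arith : ∀ v q l → suc (1 + suc (q + l)) + (3 + v) ≡ suc (1 + l) + (4 + (v + q))
  arith = solve-∀

tame-insert : ∀ {Γ} (T : Tables Γ) l v → Tame (insertᵗ T l v)
tame-insert T l v = tame-fold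
  (acc-growing bz (growing-by (con 4 ⊞ 𝕏) λ { ρ q (d , l) → ≤-trans
    (insertion-step-size d _ (proj₂ q) (All.lookup ρ v) q d l)
    (+-monoʳ-≤ (sz (bool ⊗ LineTy) (d , l))
      (+-monoʳ-≤ 4 (+-monoˡ-≤ (sz (nat ⊗ bool) q) (sz-lookup ρ v)))) }))
  (tame-var l) bz
  (tame-cond (tame-fst (tame-var v1))
    (tame-pair (tame-boolean true) (tame-cons (tame-var v0) (tame-snd (tame-var v1))))
    (tame-cond (tame-let (tame-fst (tame-var v0)) (tame-near₃ (wk (wk (wk T))) _ _))
      (tame-pair (tame-boolean true)
        (tame-cond (tame-snd (tame-var v0))
          (tame-cons (tame-pair (tame-var _) (tame-boolean false))
            (tame-cons (tame-var v0) (tame-snd (tame-var v1))))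
          (tame-cons (tame-var v0)
            (tame-cons (tame-pair (tame-var _) (tame-boolean true)) (tame-snd (tame-var v1))))))
      (tame-pair (tame-boolean false) (tame-cons (tame-var v0) (tame-snd (tame-var v1))))))
  where
  bz = tame-pair (tame-boolean false) tame-nil

module _ (V : List ℕ) (adj : ℕ → ℕ → Bool) (L : ℕ → ℕ) (X′ : ℕ → ℕ → ℚ) (Y : ℕ → ℚ) where
  open Algorithm V adj L X′ Y

  -- The general bound for the fold in `insert` is only polynomial in the size of `l`, which does
  -- not survive iteration, as `l` is itself an accumulator in `extend`. That at most one entry is
  -- added gives a growth independent of `l`.
  insert-size : ∀ v l → sz LineTy (proj₂ (insert v l))
                ≤ sz LineTy l + (if proj₁ (insert v l) then 3 + bits v else 0)
  insert-size v []      = ≤-refl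
  insert-size v (q ∷ l) with insert v l | insert-size v l
  ... | true  , l′ | le = s≤s (≤-trans (+-monoʳ-≤ (sz (nat ⊗ bool) q) le)
                            (≤-reflexive (sym (+-assoc (sz (nat ⊗ bool) q) _ _))))
  ... | false , l′ | le with near₃ v (proj₁ q)
  ...   | false = s≤s (≤-trans (+-monoʳ-≤ (sz (nat ⊗ bool) q) le)
                            (≤-reflexive (sym (+-assoc (sz (nat ⊗ bool) q) _ _))))
  ...   | true  with proj₂ q
  ...     | true  = ≤-trans (s≤s (s≤s (+-monoʳ-≤ (bits v + 1) (s≤s (+-monoʳ-≤ (sz (nat ⊗ bool) q) le)))))
                      (≤-reflexive (arith (bits v) (sz (nat ⊗ bool) q) (sz LineTy l)))
    where
    arith : ∀ v q l → suc (suc (v + 1 + suc (q + (l + 0)))) ≡ suc (q + l) + (3 + v)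
    arith = solve-∀
  ...     | false = ≤-trans (s≤s (+-monoʳ-≤ (sz (nat ⊗ bool) q) (s≤s (s≤s (+-monoʳ-≤ (bits v + 1) le)))))
                      (≤-reflexive (arith (bits v) (sz (nat ⊗ bool) q) (sz LineTy l)))
    where
    arith : ∀ v q l → suc (q + suc (suc (v + 1 + (l + 0)))) ≡ suc (q + l) + (3 + v)
    arith = solve-∀

  extend-size : ∀ v l → sz LineTy (extend v l) ≤ sz LineTy l + (3 + bits v)
  extend-size v l with coveredBy l v
  ... | true  = m≤m+n _ _
  ... | false = ≤-trans (insert-size v l) (+-monoʳ-≤ (sz LineTy l) (if≤ (proj₁ (insert v l))))
    where
    if≤ : ∀ b → (if b then 3 + bits v else 0) ≤ 3 + bits v
    if≤ true  = ≤-refl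
    if≤ false = z≤n

  round-size : ∀ l W → sz LineTy (foldr extend l W) ≤ sz LineTy l + 4 * szList nat W
  round-size l []      = m≤m+n _ _
  round-size l (v ∷ W) = ≤-trans (extend-size v (foldr extend l W))
    (≤-trans (+-monoˡ-≤ (3 + bits v) (round-size l W))
      (≤-slack (1 + 3 * bits v) (arith (sz LineTy l) (bits v) (szList nat W))))
    where
    arith : ∀ l v w → l + 4 * w + (3 + v) + (1 + 3 * v) ≡ l + 4 * suc (v + w)
    arith = solve-∀

filter-size : ∀ (c : ℕ → Bool) l W →
  szList nat (foldr (λ u l → if c u then u ∷ l else l) l W) ≤ szList nat l + szList nat W
filter-size c l []      = m≤m+n _ _
filter-size c l (u ∷ W) with c u
... | true  = ≤-trans (s≤s (+-monoʳ-≤ (bits u) (filter-size c l W)))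
                (≤-reflexive (arith (bits u) (szList nat l) (szList nat W)))
  where
  arith : ∀ u l w → suc (u + (l + w)) ≡ l + suc (u + w)
  arith = solve-∀
... | false = ≤-trans (filter-size c l W)
                (+-monoʳ-≤ (szList nat l) (≤-trans (m≤n+m _ (bits u)) (n≤1+n _)))

tame-extend : ∀ {Γ} (T : Tables Γ) v l → Tame (extendᵗ T v l)
tame-extend T v l = tame-cond (tame-coveredBy T l v) (tame-var l) (tame-snd (tame-insert T l v))

tame-round : ∀ {Γ} (T : Tables Γ) l → Tame (roundᵗ T l)
tame-round T l = tame-fold
  (acc-growing (tame-var l) (growing-by (con 3 ⊞ 𝕏) λ ρ v b → ≤-trans
    (extend-size (All.lookup ρ (Vᵗ T)) (adjacency T ρ) (λ _ → 0) (λ _ _ → 0ℚ) (λ _ → 0ℚ) v b)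
    (+-monoʳ-≤ (sz LineTy b) (+-monoʳ-≤ 3 (m≤n+m (bits v) ∥ ρ ∥)))))
  (tame-var (Vᵗ T)) (tame-var l) (tame-extend (wk (wk T)) _ _)

tame-line : ∀ {Γ} (T : Tables Γ) → Tame (lineᵗ T)
tame-line T = tame-fold
  (acc-growing bz (growing-by (con 4 ⊠ 𝕏) λ ρ v b → ≤-trans
    (round-size (All.lookup ρ (Vᵗ T)) (adjacency T ρ) (λ _ → 0) (λ _ _ → 0ℚ) (λ _ → 0ℚ) b (All.lookup ρ (Vᵗ T)))
    (+-monoʳ-≤ (sz LineTy b) (*-monoʳ-≤ 4 (≤-trans (sz-lookup ρ (Vᵗ T)) (m≤m+n ∥ ρ ∥ (bits v)))))))
  (tame-var (Vᵗ T)) bz (tame-round (wk (wk T)) _)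
  where
  bz = tame-cons (tame-pair (tame-numeral 0) (tame-boolean false)) tame-nil

tame-midpoints : ∀ {Γ} (l : LineTy ∈ Γ) → Tame (midpointsᵗ l)
tame-midpoints l = tame-fold
  (acc-growing tame-nil (growing-cons (flat bm (λ _ _ _ → refl)) growing-acc))
  (tame-var l) tame-nil (tame-cons bm (tame-var v1))
  where
  bm = tame-fst (tame-var v0)

tame-centre : ∀ {Γ} (T : Tables Γ) ms u → Tame (centreᵗ T ms u)
tame-centre T ms u = tame-fold
  (acc-growing inner (growing-cond (growing-flat (flat (tame-var v0) (λ _ _ _ → refl))) growing-acc))
  (tame-var ms) inner (tame-cond (tame-near₁ (wk (wk T)) _ _) (tame-var v0) (tame-var v1))
  where
  inner = tame-fold
    (acc-growing (tame-numeral 0)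
      (growing-cond (growing-flat (flat (tame-var v0) (λ _ _ _ → refl))) growing-acc))
    (tame-var ms) (tame-numeral 0) (tame-cond (tame-near₂ (wk (wk T)) _ _) (tame-var v0) (tame-var v1))

tame-cluster : ∀ {Γ} (T : Tables Γ) ms m l → Tame (clusterᵗ T ms m l)
tame-cluster T ms m l = tame-fold
  (acc-growing (tame-var l)
    (growing-cond (growing-cons (flat (tame-var v0) (λ _ _ _ → refl)) growing-acc) growing-acc))
  (tame-var (Vᵗ T)) (tame-var l)
  (tame-cond (tame-same (tame-centre (wk (wk T)) _ _) (tame-var _)) (tame-cons (tame-var v0) (tame-var v1)) (tame-var v1))

tame-order : ∀ {Γ} (T : Tables Γ) ms → Tame (orderᵗ T ms)
tame-order T ms = tame-fold
  (acc-growing tame-nil (growing-by 𝕏 λ ρ m b → ≤-trans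
    (filter-size (λ u → eval (same (centreᵗ (wk (wk (wk (wk T)))) (there (there (there (there ms)))) v0)
                                   (var v2)) (_∷_ {x = nat} u (_∷_ {x = list nat} [] (m ∷ b ∷ ρ)))) b (All.lookup ρ (Vᵗ T)))
    (+-monoʳ-≤ (szList nat b) (≤-trans (sz-lookup ρ (Vᵗ T)) (m≤m+n ∥ ρ ∥ (bits m))))))
  (tame-var ms) tame-nil (tame-cluster (wk (wk T)) _ _ _)

tame-load : ∀ {Γ} (T : Tables Γ) i → Tame (loadᵗ T i)
tame-load T i = tame-fold
  (acc-growing tame-zeroʳ (growing-op small-radd (flat bx (λ _ _ _ → refl)) growing-acc))
  (tame-var (Vᵗ T)) tame-zeroʳ (tame-op small-radd bx (tame-var v1))
  where
  bx = tame-amount (wk (wk T)) _ _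

tame-limit : ∀ {Γ} (T : Tables Γ) D p → Tame (limitᵗ T D p)
tame-limit T D p = tame-fold
  (acc-growing tame-zeroʳ
    (growing-cond (growing-op small-radd (flat bx (λ _ _ _ → refl)) growing-acc) growing-acc))
  (tame-var D) tame-zeroʳ
  (tame-cond (tame-op small-leq (tame-increment (tame-fst (tame-snd (tame-var v0))))
                                (tame-op small-add (tame-numeral 2) (tame-var _)))
    (tame-op small-radd bx (tame-var v1)) (tame-var v1))
  where
  bx = tame-let (tame-fst (tame-var v0)) (tame-load (wk (wk (wk T))) _)

tame-before : ∀ {Γ} (T : Tables Γ) i v → Tame (beforeᵗ T i v)
tame-before T i v = tame-fold
  (acc-growing tame-zeroʳ
    (growing-cond (growing-op small-radd (flat bx (λ _ _ _ → refl)) growing-acc) growing-acc))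
  (tame-var (Vᵗ T)) tame-zeroʳ
  (tame-cond (tame-op small-leq (tame-increment (tame-var v0)) (tame-var _))
    (tame-op small-radd bx (tame-var v1)) (tame-var v1))
  where
  bx = tame-amount (wk (wk T)) _ _

tame-share : ∀ {Γ} (T : Tables Γ) v e′ e → Tame (shareᵗ T v e′ e)
tame-share T v e′ e =
  tame-let (tame-fst (tame-fst (tame-var e)))
  (tame-let (tame-op small-radd (tame-fst (tame-snd (tame-var _))) (tame-before (wk T) _ _))
  (tame-let (tame-op small-radd (tame-var v0) (tame-amount (wk (wk T)) _ _))
  (tame-let (tame-fst (tame-snd (tame-snd (tame-var _))))
  (tame-let (tame-snd (tame-snd (tame-snd (tame-var _))))
    (tame-meet v3 v2 v1 v0)))))

tame-assigned : ∀ {Γ} (T : Tables Γ) out u v → Tame (assignedᵗ T out u v)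
tame-assigned T out u v = tame-fold
  (acc-growing tame-zeroʳ
    (growing-cond (growing-op small-radd (flat inner (λ _ _ _ → refl)) growing-acc) growing-acc))
  (tame-var out) tame-zeroʳ
  (tame-cond (tame-same (tame-fst (tame-fst (tame-var v0))) (tame-var _))
    (tame-op small-radd inner (tame-var v1)) (tame-var v1))
  where
  inner = tame-fold
    (acc-growing tame-zeroʳ (growing-op small-radd (flat (tame-share (wk (wk (wk (wk T)))) _ _ _) (λ _ _ _ → refl)) growing-acc))
    (tame-var _) tame-zeroʳ (tame-op small-radd (tame-share (wk (wk (wk (wk T)))) _ _ _) (tame-var v1))

tame-open? : ∀ {Γ} (out : list IntervalTy ∈ Γ) u → Tame (open?ᵗ out u)
tame-open? out u = tame-fold
  (acc-growing tame-zeroʳ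
    (growing-cond (growing-cond (growing-op small-radd (flat b1 (λ _ _ _ → refl)) growing-acc) growing-acc)
      growing-acc))
  (tame-var out) tame-zeroʳ
  (tame-cond (tame-same (tame-fst (tame-fst (tame-var v0))) (tame-var _))
    (tame-cond (tame-snd (tame-snd (tame-fst (tame-var v0)))) (tame-op small-radd b1 (tame-var v1)) (tame-var v1))
    (tame-var v1))
  where
  b1 = tame-toRat (tame-numeral 1)

tame-result : ∀ {Γ} (T : Tables Γ) out → Tame (resultᵗ T out)
tame-result T out = tame-pair
  (tame-fold (acc-growing tame-nil (growing-cons (flat row (λ _ _ _ → refl)) growing-acc))
    (tame-var _) tame-nil (tame-cons row (tame-var v1)))
  (tame-fold (acc-growing tame-nil (growing-cons (flat (tame-open? _ _) (λ _ _ _ → refl)) growing-acc))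
    (tame-var _) tame-nil (tame-cons (tame-open? _ _) (tame-var v1)))
  where
  row = tame-fold
    (acc-growing tame-nil (growing-cons (flat (tame-assigned (wk (wk (wk (wk T)))) _ _ _) (λ _ _ _ → refl)) growing-acc))
    (tame-var _) tame-nil (tame-cons (tame-assigned (wk (wk (wk (wk T)))) _ _ _) (tame-var v1))

sz-item : ∀ u q d → sz ItemTy (u , q , d) ≤ 4 + (bits u + q)
sz-item u q d = ≤-trans (s≤s (+-monoʳ-≤ (bits u) (s≤s (+-monoˡ-≤ 1 (bits≤self q)))))
  (≤-slack 0 (arith (bits u) q))
  where
  arith : ∀ u q → suc (u + suc (suc q + 1)) + 0 ≡ 4 + (u + q)
  arith = solve-∀

-- Opening the vertex in the bag makes both new lists continue `T`, so the size of the whole state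
-- can nearly double in a step. Bounded separately, each list gains one item per step. For the
-- rational, `4 + W` consists of one for the sum, `1 + W` for the summand, one for the difference
-- and one for the height of 1.
ScanInv : ℕ → ℕ → Value StateTy → Set
ScanInv W m (q , r , g , T , F) =
  q ≤ m × height r ≤ 1 + m * (4 + W) × bits g ≤ 2 + W ×
  szList ItemTy T ≤ 1 + m * (5 + (W + m)) × szList ItemTy F ≤ 1 + m * (5 + (W + m))

scan-list-inv : ∀ W m u q d l → bits u ≤ W → q ≤ suc m →
  szList ItemTy l ≤ 1 + m * (5 + (W + m)) →
  szList ItemTy ((u , q , d) ∷ l) ≤ 1 + suc m * (5 + (W + suc m))
scan-list-inv W m u q d l u≤ q≤ l≤ = s≤s (≤-trans
  (+-mono-≤ (≤-trans (sz-item u q d) (+-monoʳ-≤ 4 (+-mono-≤ u≤ q≤))) l≤)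
  (≤-slack m (arith W m)))
  where
  arith : ∀ W m → 4 + (W + suc m) + (1 + m * (5 + (W + m))) + m ≡ suc m * (5 + (W + suc m))
  arith = solve-∀

scan-inv-step : ∀ o c (u : ℕ) (s : ℚ) (Λ : ℕ) W m st →
  bits u ≤ W → height s ≤ 1 + W → bits Λ ≤ 2 + W → ScanInv W m st →
  ScanInv W (suc m) (merged o c u s Λ st)
scan-inv-step o c u s Λ W m (q , r , g , T , F) u≤ s≤ Λ≤ (q≤ , r≤ , g≤ , T≤ , F≤) = by o c
  where
  t≤ : height (r ℚ.+ s) ≤ m * (4 + W) + 3 + W
  t≤ = ≤-trans (height-+ r s) (≤-trans (s≤s (+-mono-≤ r≤ s≤)) (≤-slack 0 (arith W (m * (4 + W)))))
    where
    arith : ∀ W k → suc (1 + k + (1 + W)) + 0 ≡ k + 3 + W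
    arith = solve-∀
  r₀≤ : height (r ℚ.+ s) ≤ 1 + suc m * (4 + W)
  r₀≤ = ≤-trans t≤ (≤-slack 2 (arith W (m * (4 + W))))
    where
    arith : ∀ W k → k + 3 + W + 2 ≡ 1 + (4 + W + k)
    arith = solve-∀
  r₁≤ : height ((r ℚ.+ s) ℚ.- fromℕ 1) ≤ 1 + suc m * (4 + W)
  r₁≤ = ≤-trans (height-- (r ℚ.+ s) (fromℕ 1))
    (≤-trans (s≤s (+-monoˡ-≤ 1 t≤)) (≤-slack 0 (arith W (m * (4 + W)))))
    where
    arith : ∀ W k → suc (k + 3 + W + 1) + 0 ≡ 1 + (4 + W + k)
    arith = solve-∀
  cons≤ : ∀ q′ d l → q′ ≤ suc m → szList ItemTy l ≤ 1 + m * (5 + (W + m)) →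
          szList ItemTy ((u , q′ , d) ∷ l) ≤ 1 + suc m * (5 + (W + suc m))
  cons≤ q′ d l = scan-list-inv W m u q′ d l u≤
  q₀≤ : q ≤ suc m
  q₀≤ = m≤n⇒m≤1+n q≤
  by : ∀ o c → ScanInv W (suc m) (merged o c u s Λ (q , r , g , T , F))
  by true  true  = s≤s q≤ , r₁≤ , g≤  , cons≤ (suc q) true T (s≤s q≤) T≤ , cons≤ (suc q) true F (s≤s q≤) F≤
  by true  false = s≤s q≤ , r₁≤ , Λ≤ , cons≤ (suc q) true T (s≤s q≤) T≤ , cons≤ (suc q) false T (s≤s q≤) T≤
  by false true  = q₀≤ , r₀≤ , Λ≤ , cons≤ q true F q₀≤ F≤ , cons≤ q false F q₀≤ F≤
  by false false = q₀≤ , r₀≤ , g≤  , cons≤ q false T q₀≤ T≤ , cons≤ q false F q₀≤ F≤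

tame-item : ∀ {Γ} {u q : Term Γ nat} {l : Term Γ (list ItemTy)} d →
            Tame u → Tame q → Tame l → Tame (item u q d l)
tame-item d bu bq bl = tame-cons (tame-pair bu (tame-pair bq (tame-boolean d))) bl

tame-scanStep : ∀ {Γ} (T : Tables Γ) → Tame (scanStepᵗ T)
tame-scanStep {Γ} T =
  tame-let (tame-op small-radd (tame-fst (tame-snd (tame-var v1))) (tame-opening (wk (wk T)) _))
  (tame-let (tame-capacity (wk (wk (wk T))) _)
  (tame-cond (tame-op small-rleq (tame-toRat (tame-numeral 1)) (tame-var v1))
    (tame-cond (tame-op small-leq g (tame-var v0))
      (state q⁺ t⁻ g            (tame-item true u q⁺ T′)  (tame-item true u q⁺ F′))
      (state q⁺ t⁻ (tame-var v0) (tame-item true u q⁺ T′)  (tame-item false u q⁺ T′)))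
    (tame-cond (tame-op small-leq g (tame-var v0))
      (state q (tame-var v1) (tame-var v0) (tame-item true u q F′)  (tame-item false u q F′))
      (state q (tame-var v1) g             (tame-item false u q T′) (tame-item false u q F′)))))
  where
  Δ : Ctx
  Δ = nat ∷ rat ∷ nat ∷ StateTy ∷ Γ
  st = tame-var {Δ} v3
  u  = tame-var {Δ} v2
  q  = tame-fst st
  q⁺ = tame-increment q
  g  = tame-fst (tame-snd (tame-snd st))
  t⁻ = tame-op small-rsub (tame-var {Δ} v1) (tame-toRat (tame-numeral 1))
  T′ = tame-fst (tame-snd (tame-snd (tame-snd st)))
  F′ = tame-snd (tame-snd (tame-snd (tame-snd st)))
  state : ∀ {a b c d e} → Tame {Δ} a → Tame b → Tame c → Tame d → Tame e →
          Tame {A = StateTy} (pair a (pair b (pair c (pair d e))))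
  state a b c d e = tame-pair a (tame-pair b (tame-pair c (tame-pair d e)))

tame-scan : ∀ {Γ} (T : Tables Γ) o → Tame (scanᵗ T o)
tame-scan {Γ} T o = tame-fold
  (acc-invariant {z = z} {s = scanStepᵗ T} ScanInv
    (con 1 ⊞ (𝕏 ⊞ (con 1 ⊞ 𝕏 ⊠ (con 4 ⊞ 𝕏)
      ⊞ (con 2 ⊞ 𝕏 ⊞ (con 2 ⊞ 𝕏 ⊠ (con 5 ⊞ (𝕏 ⊞ 𝕏)) ⊞ (con 1 ⊞ 𝕏 ⊠ (con 5 ⊞ (𝕏 ⊞ 𝕏))))))) ⊞ con 3)
    (λ ρ W _ → z≤n , ≤-refl , s≤s z≤n , ≤-refl , ≤-refl)
    (λ ρ W m u st le I → scan-inv-step (fromℕ 1 ℚ.≤ᵇ (proj₁ (proj₂ st) ℚ.+ ix (fromℕ 0) (All.lookup ρ (Yᵗ T)) u))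
        (proj₁ (proj₂ (proj₂ st)) ≤ᵇ ix 0 (All.lookup ρ (Lᵗ T)) u)
        u _ _ W m st
      (≤-trans (m≤n+m _ ∥ ρ ∥) le)
      (≤-trans (ix-size rat (fromℕ 0) (All.lookup ρ (Yᵗ T)) u)
        (s≤s (≤-trans (sz-lookup ρ (Yᵗ T)) (≤-trans (m≤m+n _ _) le))))
      (≤-trans (ix-size nat 0 (All.lookup ρ (Lᵗ T)) u)
        (s≤s (≤-trans (sz-lookup ρ (Lᵗ T)) (≤-trans (m≤m+n _ _) (m≤n⇒m≤1+n le)))))
      I)
    final)
  (tame-var o) bz (tame-scanStep T)
  where
  z : Term Γ StateTy
  z = pair (numeral 0) (pair zeroʳ (pair (numeral 0) (pair nil nil)))
  bz : Tame z
  bz = tame-pair (tame-numeral 0) (tame-pair tame-zeroʳ (tame-pair (tame-numeral 0) (tame-pair tame-nil tame-nil)))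
  final : ∀ W m st → m ≤ W → ScanInv W m st → sz StateTy st ≤ _
  final W m (q , r , g , T , F) m≤W (q≤ , r≤ , g≤ , T≤ , F≤) = ≤-trans
    (s≤s (+-mono-≤ (≤-trans (bits≤self q) (s≤s (≤-trans q≤ m≤W)))
      (s≤s (+-mono-≤ (≤-trans r≤ (s≤s (*-monoˡ-≤ (4 + W) m≤W)))
        (s≤s (+-mono-≤ g≤ (s≤s (+-mono-≤ (≤-trans T≤ list≤) (≤-trans F≤ list≤)))))))))
    (≤-reflexive (arith W (W * (4 + W)) (W * (5 + (W + W)))))
    where
    list≤ : 1 + m * (5 + (W + m)) ≤ 1 + W * (5 + (W + W))
    list≤ = s≤s (*-mono-≤ m≤W (+-monoʳ-≤ 5 (+-monoʳ-≤ W m≤W)))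
    arith : ∀ W a b → suc (suc W + suc (1 + a + suc (2 + W + suc (1 + b + (1 + b)))))
      ≡ 1 + (W + (1 + a + (2 + W + (2 + b + (1 + b))))) + 3
    arith = solve-∀

-- Every new interval stores copies of the running sums, so the growth of the list does depend on
-- the accumulator. The heights of the sums are bounded linearly in `m` on their own, with `K` the
-- growth per step; three of them enter each interval, whence the `3 * (m * K)`.
FillInv : ℕ → ℕ → ℕ → Value FillTy → Set
FillInv K W m (M , N , out) =
  height M ≤ 1 + m * K × height N ≤ 1 + m * K × szList IntervalTy out ≤ 1 + m * (W + (8 + 3 * (m * K)))

fill-step-inv : ∀ K W m e (b l n : ℚ) d M N out →
  height l + 1 ≤ K → height b + (height n + 2) ≤ K → sz ItemTy e ≤ W →
  FillInv K W m (M , N , out) →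
  let N′ = if d then b ⊓ʳ (N ℚ.+ n) else N in
  FillInv K W (suc m) (l ℚ.+ M , N′ , (e , M , N , N′) ∷ out)
fill-step-inv K W m e b l n d M N out l≤ b≤ e≤ (M≤ , N≤ , out≤) =
  M′≤ , N′≤ , s≤s (≤-trans
    (+-mono-≤ (s≤s (+-mono-≤ e≤ (s≤s (+-mono-≤ M≤ (s≤s (+-mono-≤ N≤ N′≤)))))) out≤)
    (≤-slack (1 + 2 * K + 3 * (m * K)) (arith W m K)))
  where
  arith : ∀ W m K →
    suc (W + suc (1 + m * K + suc (1 + m * K + (1 + (K + m * K))))) + (1 + m * (W + (8 + 3 * (m * K))))
      + (1 + 2 * K + 3 * (m * K))
    ≡ W + (8 + 3 * (K + m * K)) + m * (W + (8 + 3 * (K + m * K)))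
  arith = solve-∀
  M′≤ : height (l ℚ.+ M) ≤ 1 + suc m * K
  M′≤ = ≤-trans (height-+ l M) (s≤s (≤-trans (+-monoʳ-≤ (height l) M≤)
    (≤-trans (≤-reflexive (sym (+-assoc (height l) 1 (m * K)))) (+-monoˡ-≤ (m * K) l≤))))
  N′≤ : height (if d then b ⊓ʳ (N ℚ.+ n) else N) ≤ 1 + suc m * K
  N′≤ = by d (b ℚ.≤ᵇ (N ℚ.+ n))
    where
    arith₀ : ∀ b n k → b + (1 + k + (1 + n)) ≡ b + (n + 2) + k
    arith₀ = solve-∀
    b+N+n≤ : height b + suc (height N + height n) ≤ 1 + suc m * K
    b+N+n≤ = ≤-trans (+-monoʳ-≤ (height b) (≤-trans (≤-reflexive (sym (+-suc (height N) (height n))))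
        (+-monoˡ-≤ (1 + height n) N≤)))
      (≤-trans (≤-reflexive (arith₀ (height b) (height n) (m * K)))
        (≤-trans (+-monoˡ-≤ (m * K) b≤) (n≤1+n _)))
    by : ∀ d c → height (if d then (if c then b else N ℚ.+ n) else N) ≤ 1 + suc m * K
    by false _     = ≤-trans N≤ (s≤s (m≤n+m _ K))
    by true  true  = ≤-trans (m≤m+n _ _) b+N+n≤
    by true  false = ≤-trans (height-+ N n) (≤-trans (m≤n+m _ (height b)) b+N+n≤)

module _ {Γ : Ctx} (T : Tables Γ) (D : list ItemTy ∈ Γ) where

  private
    limit⁺ loadᵉ : Term (ItemTy ∷ FillTy ∷ Γ) rat
    limit⁺ = let′ (fst (snd (var v0))) (limitᵗ (wk (wk (wk T))) (there (there (there D))) v0)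
    loadᵉ  = let′ (fst (var v0)) (loadᵗ (wk (wk (wk T))) v0)

    abstract
      flat-limit : Flat limit⁺
      flat-limit = flat (tame-let (tame-fst (tame-snd (tame-var v0))) (tame-limit (wk (wk (wk T))) _ _)) (λ _ _ _ → refl)

      flat-load : Flat loadᵉ
      flat-load = flat (tame-let (tame-fst (tame-var v0)) (tame-load (wk (wk (wk T))) _)) (λ _ _ _ → refl)

    P : Poly
    P = Flat.poly flat-limit ⊞ Flat.poly flat-load ⊞ 𝕏 ⊞ con 8

  tame-filled : Tame (filledᵗ T D)
  tame-filled = tame-cond (tame-snd (tame-snd (tame-var v0)))
    (tame-let (tame-fst (tame-snd (tame-var v0)))
    (tame-let (tame-limit (wk (wk (wk T))) _ _)
    (tame-let (tame-fst (tame-var v2))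
    (tame-let (tame-op small-radd (tame-fst (tame-snd (tame-var v4))) (tame-toRat (tame-capacity (wk (wk (wk (wk (wk T))))) _)))
      (tame-minimum v2 v0)))))
    (tame-fst (tame-snd (tame-var v1)))

  tame-fill : Tame (fillᵗ T D)
  tame-fill = tame-let tame-filled
    (tame-pair (tame-op small-radd (tame-let (tame-fst (tame-var v1)) (tame-load (wk (wk (wk (wk T)))) _)) (tame-fst (tame-var v2)))
      (tame-pair (tame-var v0)
        (tame-cons (tame-pair (tame-var v1) (tame-pair (tame-fst (tame-var v2)) (tame-pair (tame-fst (tame-snd (tame-var v2))) (tame-var v0))))
              (tame-snd (tame-snd (tame-var v2))))))

  tame-fills : Tame (fillsᵗ T D)
  tame-fills = tame-fold
    (acc-invariant {z = z} {s = fillᵗ T D} (λ W → FillInv (⟦ P ⟧ W) W)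
      ((con 1 ⊞ 𝕏 ⊠ P) ⊞ (con 1 ⊞ 𝕏 ⊠ P) ⊞ (con 1 ⊞ 𝕏 ⊠ (𝕏 ⊞ (con 8 ⊞ con 3 ⊠ (𝕏 ⊠ P)))) ⊞ con 2)
      (λ ρ W _ → ≤-refl , ≤-refl , ≤-refl)
      step′
      final)
    (tame-var D) bz tame-fill
    where
    z : Term Γ FillTy
    z = pair zeroʳ (pair zeroʳ nil)
    bz : Tame z
    bz = tame-pair tame-zeroʳ (tame-pair tame-zeroʳ tame-nil)
    step′ : ∀ ρ W m e acc → ∥ ρ ∥ + sz ItemTy e ≤ W → FillInv (⟦ P ⟧ W) W m acc →
            FillInv (⟦ P ⟧ W) W (suc m) (eval (fillᵗ T D) (e ∷ acc ∷ ρ))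
    step′ ρ W m e@(i , p , d) (M , N , out) le I = fill-step-inv (⟦ P ⟧ W) W m e
      (eval limit⁺ (e ∷ (M , N , out) ∷ ρ)) (eval loadᵉ (e ∷ (M , N , out) ∷ ρ))
      (fromℕ (capacities T ρ i)) d M N out
      (≤-trans (+-monoˡ-≤ 1 (≤-trans (Flat.bound flat-load ρ e (M , N , out)) (⟦⟧-mono (Flat.poly flat-load) le)))
        (≤-slack (⟦ Flat.poly flat-limit ⟧ W + W + 7)
          (arith₁ (⟦ Flat.poly flat-limit ⟧ W) (⟦ Flat.poly flat-load ⟧ W) W)))
      (≤-trans (+-mono-≤ (≤-trans (Flat.bound flat-limit ρ e (M , N , out)) (⟦⟧-mono (Flat.poly flat-limit) le))
                  (+-monoˡ-≤ 2 (≤-trans (height-fromℕ (capacities T ρ i)) (s≤s (≤-trans (ix-size nat 0 (All.lookup ρ (Lᵗ T)) i)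
                    (s≤s (≤-trans (sz-lookup ρ (Lᵗ T)) (≤-trans (m≤m+n _ _) le))))))))
        (≤-slack (⟦ Flat.poly flat-load ⟧ W + 4)
          (arith₂ (⟦ Flat.poly flat-limit ⟧ W) (⟦ Flat.poly flat-load ⟧ W) W)))
      (≤-trans (m≤n+m _ ∥ ρ ∥) le) I
      where
      arith₁ : ∀ a b W → b + 1 + (a + W + 7) ≡ a + b + W + 8
      arith₁ = solve-∀
      arith₂ : ∀ a b W → a + (suc (suc W) + 2) + (b + 4) ≡ a + b + W + 8
      arith₂ = solve-∀
    final : ∀ W m acc → m ≤ W → FillInv (⟦ P ⟧ W) W m acc → sz FillTy acc ≤ _
    final W m (M , N , out) m≤W (M≤ , N≤ , out≤) = ≤-trans
      (s≤s (+-mono-≤ (≤-trans M≤ (s≤s (*-monoˡ-≤ K m≤W)))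
        (s≤s (+-mono-≤ (≤-trans N≤ (s≤s (*-monoˡ-≤ K m≤W)))
          (≤-trans out≤ (s≤s (*-mono-≤ m≤W (+-monoʳ-≤ W (+-monoʳ-≤ 8 (*-monoʳ-≤ 3 (*-monoˡ-≤ K m≤W))))))))))) 
      (≤-reflexive (arith (1 + W * K) (1 + W * (W + (8 + 3 * (W * K))))))
      where
      K = ⟦ P ⟧ W
      arith : ∀ a b → suc (a + suc (a + b)) ≡ a + a + b + 2
      arith = solve-∀

-- The number put in front is read off the accumulator. It is bounded by means of the number `m` of
-- calls, since it goes up by one with each of them.
tame-vertices : ∀ {Γ} (l : list nat ∈ Γ) → Tame (verticesᵗ l)
tame-vertices {Γ} l = tame-fold
  (acc-invariant {z = nil} {s = cons (caseList (var v1) (numeral 0) (increment (var v0))) (var v1)}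
    (λ W m b → nextVertex b ≤ m × szList nat b ≤ 1 + m * (2 + m))
    (con 1 ⊞ 𝕏 ⊠ (con 2 ⊞ 𝕏))
    (λ ρ W _ → z≤n , ≤-refl)
    (λ ρ W m a b _ (I , J) → s≤s I ,
      s≤s (≤-trans (+-mono-≤ (≤-trans (bits≤self (nextVertex b)) (s≤s I)) J)
        (≤-slack (1 + m) (arith m))))
    (λ W m b m≤W (_ , J) → ≤-trans J (s≤s (*-mono-≤ m≤W (+-monoʳ-≤ 2 m≤W)))))
  (tame-var l) tame-nil
  (tame-cons (tame-caseList (tame-var v1) (tame-numeral 0) (tame-increment (tame-var v0))) (tame-var v1))
  where
  arith : ∀ m → suc m + (1 + m * (2 + m)) + (1 + m) ≡ suc m * (2 + suc m)
  arith = solve-∀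

abstract
  tame-rounding : Tame rounding
  tame-rounding =
    tame-let (tame-fst (tame-var v0))
    (tame-let (tame-fst (tame-snd (tame-var v1)))
    (tame-let (tame-fst (tame-snd (tame-snd (tame-snd (tame-var v2)))))
    (tame-let (tame-snd (tame-snd (tame-snd (tame-snd (tame-var v3)))))
    (tame-let (tame-vertices v2)
    (let T = tables v4 v3 v2 v1 v0 in
     tame-let (tame-line T)
    (let T = wk T in
     tame-let (tame-midpoints v0)
    (let T = wk T in
     tame-let (tame-order T v0)
    (let T = wk T in
     tame-let (tame-snd (tame-snd (tame-snd (tame-snd (tame-scan T v0)))))
    (let T = wk T in
     tame-let (tame-snd (tame-snd (tame-fills T v0)))
    (let T = wk T in
     tame-result T v0))))))))))

tame⇒polynomial : ∀ {A B} (p : Program A B) → Tame p → ∀ P → PolynomialTimeOn P p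
tame⇒polynomial {A} t (tame (p , h)) P with monomial-bound p
... | a , d , g = a , d , λ i _ → ≤-trans (h (i ∷ []))
  (≤-trans (⟦⟧-mono p (≤-trans (≤-reflexive (+-identityʳ _)) (sz≤size A i))) (g _))

-- The program computes the algorithm

record Evaluates {Γ A} (t : Term Γ A) (ρ : Env Γ) (a : Value A) : Set where
  constructor evaluates
  field evaluation : eval t ρ ≡ a

let-evaluates : ∀ {Γ A B} {t : Term Γ A} {s : Term (A ∷ Γ) B} {ρ : Env Γ} {a b} →
                Evaluates t ρ a → Evaluates s (a ∷ ρ) b → Evaluates (let′ t s) ρ b
let-evaluates (evaluates refl) (evaluates eq) = evaluates eq

module _ {Γ : Ctx} (T : Tables Γ) (ρ : Env Γ) where
  open Algorithm (All.lookup ρ (Vᵗ T)) (adjacency T ρ) (capacities T ρ) (amounts T ρ) (openings T ρ)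

  eval-line : eval (lineᵗ T) ρ ≡ line
  eval-line = refl

  eval-midpoints : ∀ l → All.lookup ρ l ≡ line → eval (midpointsᵗ l) ρ ≡ midpoints
  eval-midpoints l eq = cong (foldr (λ q l → proj₁ q ∷ l) []) eq

  eval-order : ∀ ms → eval (orderᵗ T ms) ρ ≡ order (All.lookup ρ ms)
  eval-order ms = refl

  eval-scan : ∀ o → eval (scanᵗ T o) ρ ≡ scan (All.lookup ρ o)
  eval-scan o = refl

  eval-fills : ∀ D → eval (fillsᵗ T D) ρ ≡ fills (All.lookup ρ D) (All.lookup ρ D)
  eval-fills D = refl

  eval-result : ∀ out → eval (resultᵗ T out) ρ ≡ output (All.lookup ρ out)
  eval-result out = refl

-- Each stage is evaluated in an environment that holds the values of the stages before it, one
-- `let′` at a time, so that stages are compared one by one.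
rounding-computes : ∀ A Ls k Xs Ys → run rounding (A , Ls , k , Xs , Ys) ≡
  Algorithm.result (vertices Ls) (λ i j → ix false (ix [] A i) j) (ix 0 Ls)
    (λ i j → ix (fromℕ 0) (ix [] Xs i) j) (ix (fromℕ 0) Ys)
rounding-computes A Ls k Xs Ys = Evaluates.evaluation {t = rounding} {(A , Ls , k , Xs , Ys) ∷ []}
  (let-evaluates (evaluates refl) (let-evaluates (evaluates refl) (let-evaluates (evaluates refl)
  (let-evaluates (evaluates refl) (let-evaluates (evaluates refl)
  (let-evaluates {a = line} (evaluates (eval-line T₀ ρ₀))
  (let-evaluates {a = midpoints} (evaluates (eval-midpoints (wk T₀) ρ₁ v0 refl))
  (let-evaluates {a = order midpoints} (evaluates (eval-order (wk (wk T₀)) ρ₂ v0))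
  (let-evaluates {a = decisions}
    (evaluates (cong (λ st → proj₂ (proj₂ (proj₂ (proj₂ st)))) (eval-scan (wk (wk (wk T₀))) ρ₃ v0)))
  (let-evaluates {a = intervals}
    (evaluates (cong (λ st → proj₂ (proj₂ st)) (eval-fills (wk (wk (wk (wk T₀)))) ρ₄ v0)))
  (evaluates (eval-result (wk (wk (wk (wk (wk T₀))))) ρ₅ v0))))))))))))
  where
  open Algorithm (vertices Ls) (λ i j → ix false (ix [] A i) j) (ix 0 Ls)
    (λ i j → ix (fromℕ 0) (ix [] Xs i) j) (ix (fromℕ 0) Ys)
  Γ₀ = list nat ∷ list rat ∷ list (list rat) ∷ list nat ∷ list (list bool) ∷ InstanceTy ∷ []
  T₀ : Tables Γ₀
  T₀ = tables v4 v3 v2 v1 v0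
  ρ₀ : Env Γ₀
  ρ₀ = vertices Ls ∷ Ys ∷ Xs ∷ Ls ∷ A ∷ (A , Ls , k , Xs , Ys) ∷ []
  ρ₁ : Env (LineTy ∷ Γ₀)
  ρ₁ = line ∷ ρ₀
  ρ₂ : Env (list nat ∷ LineTy ∷ Γ₀)
  ρ₂ = midpoints ∷ ρ₁
  ρ₃ : Env (list nat ∷ list nat ∷ LineTy ∷ Γ₀)
  ρ₃ = order midpoints ∷ ρ₂
  ρ₄ : Env (list ItemTy ∷ list nat ∷ list nat ∷ LineTy ∷ Γ₀)
  ρ₄ = decisions ∷ ρ₃
  ρ₅ : Env (list IntervalTy ∷ list ItemTy ∷ list nat ∷ list nat ∷ LineTy ∷ Γ₀)
  ρ₅ = intervals ∷ ρ₄

-- Order, minima and sums of rationals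

ℚ-ring : AlmostCommutativeRing 0ℓ 0ℓ
ℚ-ring = fromCommutativeRing ℚ.+-*-commutativeRing (λ x → dec⇒maybe (0ℚ ℚ.≟ x))


≤-by : ∀ {a b} e → 0ℚ ℚ.≤ e → e ℚ.+ a ≡ b → a ℚ.≤ b
≤-by {a} e 0≤e eq = ℚ.≤-trans (ℚ.≤-reflexive (sym (ℚ.+-identityˡ a)))
  (ℚ.≤-trans (ℚ.+-monoˡ-≤ a 0≤e) (ℚ.≤-reflexive eq))

infixl 6 _0+_
_0+_ : ∀ {a b} → 0ℚ ℚ.≤ a → 0ℚ ℚ.≤ b → 0ℚ ℚ.≤ a ℚ.+ b
_0+_ = ℚ.+-mono-≤

infixl 7 _0*_
_0*_ : ∀ {a b} → 0ℚ ℚ.≤ a → 0ℚ ℚ.≤ b → 0ℚ ℚ.≤ a ℚ.* b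
_0*_ {a} {b} p q = ℚ.nonNegative⁻¹ (a ℚ.* b)
  ⦃ ℚ.nonNeg*nonNeg⇒nonNeg a ⦃ ℚ.nonNegative p ⦄ b ⦃ ℚ.nonNegative q ⦄ ⦄

0≤- : ∀ {a b} → a ℚ.≤ b → 0ℚ ℚ.≤ b ℚ.- a
0≤- {a} {b} le = ℚ.≤-trans (ℚ.≤-reflexive (sym (ℚ.+-inverseʳ a))) (ℚ.+-monoˡ-≤ (ℚ.- a) le)

fromℕ≡mkℚ : ∀ m → fromℕ m ≡ mkℚ (+ m) 0 (coprime-sym (1-coprimeTo m))
fromℕ≡mkℚ m = ℚ.normalize-coprime (coprime-sym (1-coprimeTo m))

fromℕ-mono : ∀ m n → m ≤ n → fromℕ m ℚ.≤ fromℕ n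
fromℕ-mono m n le = subst₂ ℚ._≤_ (sym (fromℕ≡mkℚ m)) (sym (fromℕ≡mkℚ n))
  (ℚ.*≤* (subst₂ ℤ._≤_ (sym (ℤ.*-identityʳ (+ m))) (sym (ℤ.*-identityʳ (+ n))) (ℤ.+≤+ le)))

fromℕ-cancel-≤ : ∀ m n → fromℕ m ℚ.≤ fromℕ n → m ≤ n
fromℕ-cancel-≤ m n le = ℤ.drop‿+≤+ (subst₂ ℤ._≤_ (ℤ.*-identityʳ (+ m)) (ℤ.*-identityʳ (+ n))
  (ℚ.drop-*≤* (subst₂ ℚ._≤_ (fromℕ≡mkℚ m) (fromℕ≡mkℚ n) le)))

fromℕ-suc : ∀ m → fromℕ (suc m) ≡ 1ℚ ℚ.+ fromℕ m
fromℕ-suc m = trans (cong (λ z → (+ 1 ℤ.+ z) ℚ./ 1) (sym (ℤ.*-identityʳ (+ m))))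
  (sym (cong (1ℚ ℚ.+_) (fromℕ≡mkℚ m)))

0≤fromℕ : ∀ m → 0ℚ ℚ.≤ fromℕ m
0≤fromℕ m = fromℕ-mono 0 m z≤n

module _ {p q : ℚ} where
  ≤ᵇ-true : (p ℚ.≤ᵇ q) ≡ true → p ℚ.≤ q
  ≤ᵇ-true eq = ℚ.≤ᵇ⇒≤ (subst T (sym eq) tt)

  ≤ᵇ-false : (p ℚ.≤ᵇ q) ≡ false → q ℚ.< p
  ≤ᵇ-false eq = ℚ.≰⇒> λ le → subst T eq (ℚ.≤⇒≤ᵇ le)

≤ᵇ-trueⁿ : ∀ m n → (m ≤ᵇ n) ≡ true → m ≤ n
≤ᵇ-trueⁿ m n eq = ≤ᵇ⇒≤ m n (subst T (sym eq) tt)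

≤ᵇ-falseⁿ : ∀ m n → (m ≤ᵇ n) ≡ false → n < m
≤ᵇ-falseⁿ m n eq = ≰⇒> λ le → subst T eq (≤⇒≤ᵇ le)

true-≤ᵇ : ∀ {m n} → m ≤ n → (m ≤ᵇ n) ≡ true
true-≤ᵇ {m} {n} le with m ≤ᵇ n in eq
... | true  = refl
... | false = contradiction le (<⇒≱ (≤ᵇ-falseⁿ m n eq))

false-≤ᵇ : ∀ {m n} → n < m → (m ≤ᵇ n) ≡ false
false-≤ᵇ {m} {n} lt with m ≤ᵇ n in eq
... | false = refl
... | true  = contradiction (≤ᵇ-trueⁿ m n eq) (<⇒≱ lt)

⊓ʳ-sel : ∀ p q → (p ⊓ʳ q ≡ p × p ℚ.≤ q) ⊎ (p ⊓ʳ q ≡ q × q ℚ.≤ p)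
⊓ʳ-sel p q with p ℚ.≤ᵇ q in eq
... | true  = inj₁ (refl , ≤ᵇ-true eq)
... | false = inj₂ (refl , ℚ.<⇒≤ (≤ᵇ-false eq))

⊓ʳ≤ˡ : ∀ p q → p ⊓ʳ q ℚ.≤ p
⊓ʳ≤ˡ p q with ⊓ʳ-sel p q
... | inj₁ (eq , le) = ℚ.≤-reflexive eq
... | inj₂ (eq , le) = subst (ℚ._≤ p) (sym eq) le

⊓ʳ≤ʳ : ∀ p q → p ⊓ʳ q ℚ.≤ q
⊓ʳ≤ʳ p q with ⊓ʳ-sel p q
... | inj₁ (eq , le) = subst (ℚ._≤ q) (sym eq) le
... | inj₂ (eq , le) = ℚ.≤-reflexive eq

⊓ʳ-glb : ∀ {r} p q → r ℚ.≤ p → r ℚ.≤ q → r ℚ.≤ p ⊓ʳ q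
⊓ʳ-glb {r} p q a b with ⊓ʳ-sel p q
... | inj₁ (eq , _) = subst (r ℚ.≤_) (sym eq) a
... | inj₂ (eq , _) = subst (r ℚ.≤_) (sym eq) b

total : ∀ {A : Set} → (A → ℚ) → List A → ℚ
total f = foldr (λ a s → f a ℚ.+ s) 0ℚ

total-nonneg : ∀ {A : Set} (f : A → ℚ) → (∀ a → 0ℚ ℚ.≤ f a) → ∀ as → 0ℚ ℚ.≤ total f as
total-nonneg f 0≤f []       = ℚ.≤-refl
total-nonneg f 0≤f (a ∷ as) = 0≤f a 0+ total-nonneg f 0≤f as

bit : Bool → ℚ
bit true  = 1ℚ
bit false = 0ℚ

-- The scan and its invariants

module Rounding (V : List ℕ) (adj : ℕ → ℕ → Bool) (L : ℕ → ℕ) (X : ℕ → ℕ → ℚ) (Y : ℕ → ℚ)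
  (0≤X : ∀ u v → 0ℚ ℚ.≤ X u v)
  (Y-bounds : ∀ u → 0ℚ ℚ.≤ Y u × Y u ℚ.≤ 1ℚ)
  (load≤ : ∀ u → Algorithm.load V adj L X Y u ℚ.≤ fromℕ (L u) ℚ.* Y u)
  where

  open Algorithm V adj L X Y

  0≤load : ∀ u → 0ℚ ℚ.≤ load u
  0≤load u = total-nonneg (X u) (0≤X u) V

  data Step (u : ℕ) : State → State → Set where
    open-new : ∀ {q r g T F} → 1ℚ ℚ.≤ r ℚ.+ Y u → g ≤ L u → Step u (q , r , g , T , F)
      (suc q , (r ℚ.+ Y u) ℚ.- 1ℚ , g , (u , suc q , true) ∷ T , (u , suc q , true) ∷ F)
    open-bag : ∀ {q r g T F} → 1ℚ ℚ.≤ r ℚ.+ Y u → L u < g → Step u (q , r , g , T , F)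
      (suc q , (r ℚ.+ Y u) ℚ.- 1ℚ , L u , (u , suc q , true) ∷ T , (u , suc q , false) ∷ T)
    drop-bag : ∀ {q r g T F} → r ℚ.+ Y u ℚ.< 1ℚ → g ≤ L u → Step u (q , r , g , T , F)
      (q , r ℚ.+ Y u , L u , (u , q , true) ∷ F , (u , q , false) ∷ F)
    drop-new : ∀ {q r g T F} → r ℚ.+ Y u ℚ.< 1ℚ → L u ≤ g → Step u (q , r , g , T , F)
      (q , r ℚ.+ Y u , g , (u , q , false) ∷ T , (u , q , false) ∷ F)

  scan-step : ∀ u st → Step u st (scanStep u st)
  scan-step u (q , r , g , T , F) with 1ℚ ℚ.≤ᵇ (r ℚ.+ Y u) in o | g ≤ᵇ L u in c
  ... | true  | true  = open-new (≤ᵇ-true o) (≤ᵇ-trueⁿ g _ c)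
  ... | true  | false = open-bag (≤ᵇ-true o) (≤ᵇ-falseⁿ g _ c)
  ... | false | true  = drop-bag (≤ᵇ-false o) (≤ᵇ-trueⁿ g _ c)
  ... | false | false = drop-new (≤ᵇ-false o) (<⇒≤ (≤ᵇ-falseⁿ g _ c))

  infixr 5 _∷ᵣ_
  data Run : List ℕ → State → Set where
    []ᵣ  : Run [] (0 , 0ℚ , 0 , [] , [])
    _∷ᵣ_ : ∀ {u us st st′} → Step u st st′ → Run us st → Run (u ∷ us) st′

  scan-run : ∀ us → Run us (scan us)
  scan-run []       = []ᵣ
  scan-run (u ∷ us) = scan-step u (scan us) ∷ᵣ scan-run us

  phase : State → ℕ
  phase = proj₁

  rest : State → ℚ
  rest st = proj₁ (proj₂ st)

  bag : State → ℚ
  bag st = fromℕ (proj₁ (proj₂ (proj₂ st)))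

  items : Bool → State → List Item
  items true  (_ , _ , _ , T , _) = T
  items false (_ , _ , _ , _ , F) = F

  phase-step : ∀ {u st st′} → Step u st st′ → phase st ≤ phase st′ × phase st′ ≤ suc (phase st)
  phase-step (open-new _ _) = n≤1+n _ , ≤-refl
  phase-step (open-bag _ _) = n≤1+n _ , ≤-refl
  phase-step (drop-bag _ _) = ≤-refl , n≤1+n _
  phase-step (drop-new _ _) = ≤-refl , n≤1+n _

  rest-bounds : ∀ {us st} → Run us st → 0ℚ ℚ.≤ rest st × rest st ℚ.< 1ℚ
  rest-bounds []ᵣ = ℚ.≤-refl , ≤ᵇ-false refl
  rest-bounds (_∷ᵣ_ {u} (open-new o _) run) with rest-bounds run
  ... | 0≤r , r<1 = 0≤- o , ℚ.+-monoˡ-< (ℚ.- 1ℚ) (ℚ.+-mono-<-≤ r<1 (proj₂ (Y-bounds u)))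
  rest-bounds (_∷ᵣ_ {u} (open-bag o _) run) with rest-bounds run
  ... | 0≤r , r<1 = 0≤- o , ℚ.+-monoˡ-< (ℚ.- 1ℚ) (ℚ.+-mono-<-≤ r<1 (proj₂ (Y-bounds u)))
  rest-bounds (_∷ᵣ_ {u} (drop-bag o _) run) = proj₁ (rest-bounds run) 0+ proj₁ (Y-bounds u) , o
  rest-bounds (_∷ᵣ_ {u} (drop-new o _) run) = proj₁ (rest-bounds run) 0+ proj₁ (Y-bounds u) , o

  -- Opening is only shifted, never created or lost: what is not in the bag has been used up in
  -- units of one, each of which raises the phase.
  phase+rest : ∀ {us st} → Run us st → fromℕ (phase st) ℚ.+ rest st ≡ total Y us
  phase+rest []ᵣ = refl
  phase+rest (_∷ᵣ_ {u} s run) = trans (by s) (cong (Y u ℚ.+_) (phase+rest run))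
    where
    raised : ∀ q r y → fromℕ (suc q) ℚ.+ (r ℚ.+ y ℚ.- 1ℚ) ≡ y ℚ.+ (fromℕ q ℚ.+ r)
    raised q r y = trans (cong (ℚ._+ (r ℚ.+ y ℚ.- 1ℚ)) (fromℕ-suc q)) (arith (fromℕ q) r y)
      where
      arith : ∀ q r y → (1ℚ ℚ.+ q) ℚ.+ (r ℚ.+ y ℚ.- 1ℚ) ≡ y ℚ.+ (q ℚ.+ r)
      arith = Ring.solve-∀ ℚ-ring
    kept : ∀ q r y → q ℚ.+ (r ℚ.+ y) ≡ y ℚ.+ (q ℚ.+ r)
    kept = Ring.solve-∀ ℚ-ring
    by : ∀ {u st st′} → Step u st st′ →
         fromℕ (phase st′) ℚ.+ rest st′ ≡ Y u ℚ.+ (fromℕ (phase st) ℚ.+ rest st)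
    by {u} (open-new {q} {r} _ _) = raised q r (Y u)
    by {u} (open-bag {q} {r} _ _) = raised q r (Y u)
    by {u} (drop-bag {q} {r} _ _) = kept (fromℕ q) r (Y u)
    by {u} (drop-new {q} {r} _ _) = kept (fromℕ q) r (Y u)

  decided : Item → Bool
  decided e = proj₂ (proj₂ e)

  -- The initial bag of capacity 0 stands for no vertex and is never opened.
  opened-count : ∀ {us st} → Run us st →
    total (bit ∘ decided) (items false st) ≡ fromℕ (phase st) ×
    (total (bit ∘ decided) (items true st) ≡ fromℕ (suc (phase st)) ⊎ proj₁ (proj₂ (proj₂ st)) ≡ 0)
  opened-count []ᵣ = refl , inj₂ refl
  opened-count (open-new {q} _ _ ∷ᵣ run) with opened-count run
  ... | f , inj₁ t   = trans (cong (1ℚ ℚ.+_) f) (sym (fromℕ-suc q)) ,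
    inj₁ (trans (cong (1ℚ ℚ.+_) t) (sym (fromℕ-suc (suc q))))
  ... | f , inj₂ g≡0 = trans (cong (1ℚ ℚ.+_) f) (sym (fromℕ-suc q)) , inj₂ g≡0
  opened-count (open-bag {q} _ lt ∷ᵣ run) with opened-count run
  ... | f , inj₁ t   = trans (ℚ.+-identityˡ _) t , inj₁ (trans (cong (1ℚ ℚ.+_) t) (sym (fromℕ-suc (suc q))))
  ... | f , inj₂ refl = contradiction lt λ ()
  opened-count (drop-bag {q} _ _ ∷ᵣ run) with opened-count run
  ... | f , _ = trans (ℚ.+-identityˡ _) f , inj₁ (trans (cong (1ℚ ℚ.+_) f) (sym (fromℕ-suc q)))
  opened-count (drop-new _ _ ∷ᵣ run) with opened-count run
  ... | f , inj₁ t   = trans (ℚ.+-identityˡ _) f , inj₁ (trans (ℚ.+-identityˡ _) t)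
  ... | f , inj₂ g≡0 = trans (ℚ.+-identityˡ _) f , inj₂ g≡0

  below : List Item → ℕ → ℚ
  below es p = foldr (λ e s → if suc (proj₁ (proj₂ e)) ≤ᵇ p then load (proj₁ e) ℚ.+ s else s) 0ℚ es

  below-nonneg : ∀ es p → 0ℚ ℚ.≤ below es p
  below-nonneg []                 p = ℚ.≤-refl
  below-nonneg ((i , ph , _) ∷ es) p with suc ph ≤ᵇ p
  ... | true  = 0≤load i 0+ below-nonneg es p
  ... | false = below-nonneg es p

  below-grows : ∀ e es p → below es p ℚ.≤ below (e ∷ es) p
  below-grows (i , ph , _) es p with suc ph ≤ᵇ p
  ... | true  = ≤-by (load i) (0≤load i) refl
  ... | false = ℚ.≤-refl

  below-mono : ∀ es {p p′} → p ≤ p′ → below es p ℚ.≤ below es p′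
  below-mono []                      le = ℚ.≤-refl
  below-mono ((i , ph , d) ∷ es) {p} {p′} le with suc ph ≤ᵇ p in eq
  ... | false = ℚ.≤-trans (below-mono es le) (below-grows (i , ph , d) es p′)
  ... | true rewrite true-≤ᵇ (≤-trans (≤ᵇ-trueⁿ (suc ph) p eq) le) = ℚ.+-monoʳ-≤ (load i) (below-mono es le)

  below-late : ∀ i ph d es {p} → p ≤ ph → below ((i , ph , d) ∷ es) p ≡ below es p
  below-late i ph d es {p} le rewrite false-≤ᵇ {suc ph} {p} (s≤s le) = refl

  below-early : ∀ i ph d es {p} → ph < p → below ((i , ph , d) ∷ es) p ≡ load i ℚ.+ below es p
  below-early i ph d es lt rewrite true-≤ᵇ lt = refl

  below-cong : ∀ i ph d d′ es es′ p → below es p ≡ below es′ p →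
               below ((i , ph , d) ∷ es) p ≡ below ((i , ph , d′) ∷ es′) p
  below-cong i ph d d′ es es′ p = cong (λ s → if suc ph ≤ᵇ p then load i ℚ.+ s else s)

  -- The two lists contain the same vertices with the same phases and differ only in the decisions,
  -- at which `below` does not look. Thus the limits do not depend on the fate of the bag.
  below-indep : ∀ {us st} → Run us st → ∀ p → below (items true st) p ≡ below (items false st) p
  below-indep []ᵣ p = refl
  below-indep (_∷ᵣ_ {u} (open-new {q} {T = T} {F} _ _) run) p =
    below-cong u (suc q) true true T F p (below-indep run p)
  below-indep (_∷ᵣ_ {u} (open-bag {q} {T = T} _ _) run) p = below-cong u (suc q) true false T T p refl
  below-indep (_∷ᵣ_ {u} (drop-bag {q} {F = F} _ _) run) p = below-cong u q true false F F p refl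
  below-indep (_∷ᵣ_ {u} (drop-new {q} {T = T} {F} _ _) run) p =
    below-cong u q false false T F p (below-indep run p)

  -- `β` tells whether the vertex in the bag after the step will be opened, `β′` which of the two
  -- old lists this choice continues. The vertex and its phase are the same for both values of `β`.
  data Extends (u : ℕ) (st st′ : State) (β : Bool) : Set where
    extends : ∀ d β′ → items β st′ ≡ (u , phase st′ , d) ∷ items β′ st → Extends u st st′ β

  step-extends : ∀ {u st st′} → Step u st st′ → ∀ β → Extends u st st′ β
  step-extends (open-new _ _) true  = extends true true refl
  step-extends (open-new _ _) false = extends true false refl
  step-extends (open-bag _ _) true  = extends true true refl
  step-extends (open-bag _ _) false = extends false true refl
  step-extends (drop-bag _ _) true  = extends true false refl
  step-extends (drop-bag _ _) false = extends false false refl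
  step-extends (drop-new _ _) true  = extends false true refl
  step-extends (drop-new _ _) false = extends false false refl

  below-items : ∀ {us st} → Run us st → ∀ β p → below (items β st) p ≡ below (items false st) p
  below-items run true  p = below-indep run p
  below-items run false p = refl

  total-items : ∀ (f : ℕ → ℚ) {us st} → Run us st → ∀ β → total (f ∘ proj₁) (items β st) ≡ total f us
  total-items f []ᵣ true  = refl
  total-items f []ᵣ false = refl
  total-items f (_∷ᵣ_ {u} s run) β with step-extends s β
  ... | extends d β′ eq = trans (cong (total (f ∘ proj₁)) eq) (cong (f u ℚ.+_) (total-items f run β′))

  below-all : ∀ {us st} → Run us st → ∀ {p} → phase st < p → below (items false st) p ≡ total load us
  below-all []ᵣ lt = refl
  below-all {st = st′} (_∷ᵣ_ {u} {us} {st} s run) {p} lt with step-extends s false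
  ... | extends d β′ eq = trans (cong (λ l → below l p) eq)
    (trans (below-early u (phase st′) d (items β′ st) lt)
      (cong (load u ℚ.+_) (trans (below-items run β′ p)
        (below-all run (≤-<-trans (proj₁ (phase-step s)) lt)))))

  below-stable : ∀ {u us st st′} → Step u st st′ → Run us st → ∀ {p} → p ≤ phase st′ →
                 below (items false st′) p ≡ below (items false st) p
  below-stable {u} {us} {st} {st′} s run {p} le with step-extends s false
  ... | extends d β′ eq = trans (cong (λ l → below l p) eq)
    (trans (below-late u (phase st′) d (items β′ st) le) (below-items run β′ p))

  filled : (ℕ → ℚ) → List Item → ℚ
  filled b []                = 0ℚ
  filled b ((i , p , d) ∷ es) =
    if d then b p ⊓ʳ (filled b es ℚ.+ fromℕ (L i)) else filled b es

  module _ (B : ℕ → ℚ) (B-mono : ∀ {p p′} → p ≤ p′ → B p ℚ.≤ B p′) (0≤B : ∀ p → 0ℚ ℚ.≤ B p) where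

    b : ℕ → ℚ
    b p = B (suc (suc p))

    N : List Item → ℚ
    N = filled b

    -- B counts the loads by phase in some run continuing the present one.
    record Continues (st : State) : Set where
      field
        agrees  : ∀ {p} → p ≤ phase st → B p ≡ below (items false st) p
        exceeds : ∀ p → below (items false st) p ℚ.≤ B p
    open Continues

    continues-step : ∀ {u us st st′} → Step u st st′ → Run us st → Continues st′ → Continues st
    continues-step {u} {us} {st} {st′} s run c .agrees le =
      trans (agrees c le′) (below-stable s run le′)
      where le′ = ≤-trans le (proj₁ (phase-step s))
    continues-step {u} {us} {st} {st′} s run c .exceeds p with step-extends s false
    ... | extends d β′ eq = ℚ.≤-trans (ℚ.≤-reflexive (sym (below-items run β′ p)))
      (ℚ.≤-trans (below-grows (u , phase st′ , d) (items β′ st) p)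
        (ℚ.≤-trans (ℚ.≤-reflexive (cong (λ l → below l p) (sym eq))) (exceeds c p)))

    total≤B : ∀ {us st} → Run us st → Continues st → ∀ {p} → phase st < p → total load us ℚ.≤ B p
    total≤B run c lt = ℚ.≤-trans (ℚ.≤-reflexive (sym (below-all run lt))) (exceeds c _)

    -- The reason for looking two phases ahead in `b`: the phase of `u` exceeds that of `st` by at
    -- most one, so the limit valid before the step already contains the load of `u`. A sum that has
    -- reached this limit is therefore sufficient after the step as well, even if the phase and with
    -- it the limit go up.
    total≤b : ∀ {u us st st′} → Step u st st′ → Run us st → Continues st′ →
              load u ℚ.+ total load us ℚ.≤ b (phase st)
    total≤b s run c = total≤B (s ∷ᵣ run) c (s≤s (proj₂ (phase-step s)))

    N≤b : ∀ {us st} → Run us st → ∀ β → N (items β st) ℚ.≤ b (phase st)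
    N≤b []ᵣ true  = 0≤B 2
    N≤b []ᵣ false = 0≤B 2
    N≤b {st = st′} (_∷ᵣ_ {u} {us} {st} s run) β with step-extends s β
    ... | extends true  β′ eq = subst (λ l → N l ℚ.≤ b (phase st′)) (sym eq) (⊓ʳ≤ˡ _ _)
    ... | extends false β′ eq = subst (λ l → N l ℚ.≤ b (phase st′)) (sym eq)
      (ℚ.≤-trans (N≤b run β′) (B-mono (s≤s (s≤s (proj₁ (phase-step s))))))

    private
      spare : ∀ u → 0ℚ ℚ.≤ fromℕ (L u) ℚ.* Y u ℚ.- load u
      spare u = 0≤- (load≤ u)

      0≤1-Y : ∀ u → 0ℚ ℚ.≤ 1ℚ ℚ.- Y u
      0≤1-Y u = 0≤- (proj₂ (Y-bounds u))

    -- The last summand of the target is what the bag eventually adds.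
    Saturated : List ℕ → State → Bool → Set
    Saturated us st β =
      b (phase st) ℚ.≤ N (items β st) ⊎
      total load us ℚ.+ (bit β ℚ.- rest st) ℚ.* bag st ℚ.≤ N (items β st)

    min-saturated : ∀ p {x t} → t ℚ.≤ x → b p ℚ.≤ b p ⊓ʳ x ⊎ t ℚ.≤ b p ⊓ʳ x
    min-saturated p {x} t≤x with ⊓ʳ-sel (b p) x
    ... | inj₁ (eq , _) = inj₁ (ℚ.≤-reflexive (sym eq))
    ... | inj₂ (eq , _) = inj₂ (ℚ.≤-trans t≤x (ℚ.≤-reflexive (sym eq)))

    private
      ΔL : ∀ {m n} → m ≤ n → 0ℚ ℚ.≤ fromℕ n ℚ.- fromℕ m
      ΔL le = 0≤- (fromℕ-mono _ _ le)

      0≤1-bit : ∀ β → 0ℚ ℚ.≤ 1ℚ ℚ.- bit β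
      0≤1-bit true  = ℚ.≤-refl
      0≤1-bit false = fromℕ-mono 0 1 z≤n

    -- In all four cases opening moves to a vertex of at least the same capacity, and the load of
    -- `u` is paid for by its own share `Λ * Y u`. Where an opened vertex is truncated, the first
    -- alternative takes over by `min-saturated`.
    saturated : ∀ {us st} → Run us st → Continues st → ∀ β → Saturated us st β
    saturated []ᵣ c true  = inj₂ ℚ.≤-refl
    saturated []ᵣ c false = inj₂ ℚ.≤-refl
    saturated (_∷ᵣ_ {u} {us} s@(open-new {q} {r} {g} {T} {F} o le) run) c β =
      subst (λ l → b (suc q) ℚ.≤ N l ⊎ target ℚ.≤ N l) (items≡ β)
        (min-saturated (suc q) (target≤ (saturated run (continues-step s run c) β)))
      where
      G = fromℕ g ; Λ = fromℕ (L u) ; M = total load us ; n = N (items β (q , r , g , T , F))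
      target = (load u ℚ.+ M) ℚ.+ (bit β ℚ.- (r ℚ.+ Y u ℚ.- 1ℚ)) ℚ.* G
      items≡ : ∀ β → (u , suc q , true) ∷ items β (q , r , g , T , F)
                     ≡ items β (suc q , r ℚ.+ Y u ℚ.- 1ℚ , g , (u , suc q , true) ∷ T , (u , suc q , true) ∷ F)
      items≡ true  = refl
      items≡ false = refl
      target≤ : Saturated us (q , r , g , T , F) β → target ℚ.≤ n ℚ.+ Λ
      -- The sum already holds all load including that of `u`. The term for the bag is at most `G`,
      -- because its remaining opening is nonnegative, and `Λ` makes up for that.
      target≤ (inj₁ b≤n) = ≤-by _
        (0≤- b≤n 0+ 0≤- (total≤b s run c) 0+ ΔL le 0+ ((0≤1-bit β 0+ 0≤- o) 0* 0≤fromℕ g))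
        (arith n (b q) (load u) M Λ G (bit β) (r ℚ.+ Y u))
        where
        arith : ∀ n b l M Λ G β t → (n ℚ.- b) ℚ.+ (b ℚ.- (l ℚ.+ M)) ℚ.+ (Λ ℚ.- G)
          ℚ.+ ((1ℚ ℚ.- β) ℚ.+ (t ℚ.- 1ℚ)) ℚ.* G ℚ.+ ((l ℚ.+ M) ℚ.+ (β ℚ.- (t ℚ.- 1ℚ)) ℚ.* G) ≡ n ℚ.+ Λ
        arith = Ring.solve-∀ ℚ-ring
      -- Of the new capacity `Λ`, the part `Λ * y` pays for the load of `u`. The rest,
      -- `(1 - y) * Λ`, replaces the opening `1 - y` taken out of the bag, whose capacity `G` is not
      -- larger.
      target≤ (inj₂ t≤n) = ≤-by _
        (0≤- t≤n 0+ spare u 0+ (0≤1-Y u 0* ΔL le))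
        (arith n (load u) M Λ G (bit β) r (Y u))
        where
        arith : ∀ n l M Λ G β r y → (n ℚ.- (M ℚ.+ (β ℚ.- r) ℚ.* G)) ℚ.+ (Λ ℚ.* y ℚ.- l)
          ℚ.+ (1ℚ ℚ.- y) ℚ.* (Λ ℚ.- G) ℚ.+ ((l ℚ.+ M) ℚ.+ (β ℚ.- (r ℚ.+ y ℚ.- 1ℚ)) ℚ.* G) ≡ n ℚ.+ Λ
        arith = Ring.solve-∀ ℚ-ring
    saturated (_∷ᵣ_ {u} {us} s@(open-bag {q} {r} {g} {T} {F} o le) run) c β = by β
      where
      G = fromℕ g ; Λ = fromℕ (L u) ; M = total load us ; n = N T ; t = r ℚ.+ Y u ℚ.- 1ℚ
      target≤ : ∀ β → Saturated us (q , r , g , T , F) true →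
                (load u ℚ.+ M) ℚ.+ (bit β ℚ.- t) ℚ.* Λ ℚ.≤ n ℚ.+ bit β ℚ.* Λ
      target≤ β (inj₁ b≤n) = ≤-by _
        (0≤- b≤n 0+ 0≤- (total≤b s run c) 0+ (0≤- o 0* 0≤fromℕ (L u)))
        (arith n (b q) (load u) M Λ (bit β) (r ℚ.+ Y u))
        where
        arith : ∀ n b l M Λ β t → (n ℚ.- b) ℚ.+ (b ℚ.- (l ℚ.+ M)) ℚ.+ (t ℚ.- 1ℚ) ℚ.* Λ
          ℚ.+ ((l ℚ.+ M) ℚ.+ (β ℚ.- (t ℚ.- 1ℚ)) ℚ.* Λ) ≡ n ℚ.+ β ℚ.* Λ
        arith = Ring.solve-∀ ℚ-ring
      -- Raising the opening of the bag vertex from `r` to 1 gains `(1 - r) * G`. This exceeds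
      -- `(1 - r) * Λ`, the loss from taking the opening `1 - r` away from `u`.
      target≤ β (inj₂ t≤n) = ≤-by _
        (0≤- t≤n 0+ spare u 0+ (0≤- (ℚ.<⇒≤ (proj₂ (rest-bounds run))) 0* ΔL (<⇒≤ le)))
        (arith n (load u) M Λ G (bit β) r (Y u))
        where
        arith : ∀ n l M Λ G β r y → (n ℚ.- (M ℚ.+ (1ℚ ℚ.- r) ℚ.* G)) ℚ.+ (Λ ℚ.* y ℚ.- l)
          ℚ.+ (1ℚ ℚ.- r) ℚ.* (G ℚ.- Λ) ℚ.+ ((l ℚ.+ M) ℚ.+ (β ℚ.- (r ℚ.+ y ℚ.- 1ℚ)) ℚ.* Λ) ≡ n ℚ.+ β ℚ.* Λ
        arith = Ring.solve-∀ ℚ-ring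
      ih = saturated run (continues-step s run c) true
      by : ∀ β → Saturated (u ∷ us) (suc q , t , L u , (u , suc q , true) ∷ T , (u , suc q , false) ∷ T) β
      by true  = min-saturated (suc q) (ℚ.≤-trans (target≤ true ih) (ℚ.≤-reflexive (cong (n ℚ.+_) (ℚ.*-identityˡ Λ))))
      by false = inj₂ (ℚ.≤-trans (target≤ false ih)
        (ℚ.≤-reflexive (trans (cong (n ℚ.+_) (ℚ.*-zeroˡ Λ)) (ℚ.+-identityʳ n))))
    saturated (_∷ᵣ_ {u} {us} s@(drop-bag {q} {r} {g} {T} {F} o le) run) c β = by β ih
      where
      G = fromℕ g ; Λ = fromℕ (L u) ; M = total load us ; n = N F ; t = r ℚ.+ Y u
      ih = saturated run (continues-step s run c) false
      target≤ : ∀ β → M ℚ.+ (0ℚ ℚ.- r) ℚ.* G ℚ.≤ n →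
                (load u ℚ.+ M) ℚ.+ (bit β ℚ.- t) ℚ.* Λ ℚ.≤ n ℚ.+ bit β ℚ.* Λ
      -- The opening `r` of the discarded vertex moves from capacity `G` to the capacity `Λ`, which
      -- is at least `G`.
      target≤ β t≤n = ≤-by _
        (0≤- t≤n 0+ spare u 0+ (proj₁ (rest-bounds run) 0* ΔL le))
        (arith n (load u) M Λ G (bit β) r (Y u))
        where
        arith : ∀ n l M Λ G β r y → (n ℚ.- (M ℚ.+ (0ℚ ℚ.- r) ℚ.* G)) ℚ.+ (Λ ℚ.* y ℚ.- l)
          ℚ.+ r ℚ.* (Λ ℚ.- G) ℚ.+ ((l ℚ.+ M) ℚ.+ (β ℚ.- (r ℚ.+ y)) ℚ.* Λ) ≡ n ℚ.+ β ℚ.* Λ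
        arith = Ring.solve-∀ ℚ-ring
      by : ∀ β → Saturated us (q , r , g , T , F) false →
           Saturated (u ∷ us) (q , t , L u , (u , q , true) ∷ F , (u , q , false) ∷ F) β
      by true  (inj₁ b≤n) = inj₁ (⊓ʳ-glb (b q) _ ℚ.≤-refl (ℚ.≤-trans b≤n (≤-by Λ (0≤fromℕ (L u)) (ℚ.+-comm Λ n))))
      by false (inj₁ b≤n) = inj₁ b≤n
      by true  (inj₂ t≤n) = min-saturated q
        (ℚ.≤-trans (target≤ true t≤n) (ℚ.≤-reflexive (cong (n ℚ.+_) (ℚ.*-identityˡ Λ))))
      by false (inj₂ t≤n) = inj₂ (ℚ.≤-trans (target≤ false t≤n)
        (ℚ.≤-reflexive (trans (cong (n ℚ.+_) (ℚ.*-zeroˡ Λ)) (ℚ.+-identityʳ n))))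
    saturated (_∷ᵣ_ {u} {us} s@(drop-new {q} {r} {g} {T} {F} o le) run) c β =
      by β (saturated run (continues-step s run c) β)
      where
      G = fromℕ g ; Λ = fromℕ (L u) ; M = total load us
      target≤ : ∀ β n → M ℚ.+ (bit β ℚ.- r) ℚ.* G ℚ.≤ n →
                (load u ℚ.+ M) ℚ.+ (bit β ℚ.- (r ℚ.+ Y u)) ℚ.* G ℚ.≤ n
      -- The opening of `u` moves to the bag, whose capacity `G` is at least `Λ`.
      target≤ β n t≤n = ≤-by _
        (0≤- t≤n 0+ spare u 0+ (proj₁ (Y-bounds u) 0* ΔL le))
        (arith n (load u) M Λ G (bit β) r (Y u))
        where
        arith : ∀ n l M Λ G β r y → (n ℚ.- (M ℚ.+ (β ℚ.- r) ℚ.* G)) ℚ.+ (Λ ℚ.* y ℚ.- l)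
          ℚ.+ y ℚ.* (G ℚ.- Λ) ℚ.+ ((l ℚ.+ M) ℚ.+ (β ℚ.- (r ℚ.+ y)) ℚ.* G) ≡ n
        arith = Ring.solve-∀ ℚ-ring
      by : ∀ β → Saturated us (q , r , g , T , F) β →
           Saturated (u ∷ us) (q , r ℚ.+ Y u , g , (u , q , false) ∷ T , (u , q , false) ∷ F) β
      by true  (inj₁ b≤n) = inj₁ b≤n
      by false (inj₁ b≤n) = inj₁ b≤n
      by true  (inj₂ t≤n) = inj₂ (target≤ true (N T) t≤n)
      by false (inj₂ t≤n) = inj₂ (target≤ false (N F) t≤n)

    bag-share≤ : ∀ {m n r} → 0ℚ ℚ.≤ r → r ℚ.≤ 1ℚ → m ≤ n → r ℚ.* fromℕ m ℚ.≤ fromℕ n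
    bag-share≤ {m} {n} {r} 0≤r r≤1 le = ≤-by _ (ΔL le 0+ (0≤- r≤1 0* 0≤fromℕ m)) (arith (fromℕ m) (fromℕ n) r)
      where
      arith : ∀ m n r → (n ℚ.- m) ℚ.+ (1ℚ ℚ.- r) ℚ.* m ℚ.+ r ℚ.* m ≡ n
      arith = Ring.solve-∀ ℚ-ring

    -- The left side changes only when the phase goes up; it then becomes the total load before `u`.
    -- That is when a vertex is opened, and the opened vertex can carry the part of this load that
    -- was accounted to the bag.
    below≤N : ∀ {us st} → Run us st → Continues st → ∀ β → below (items false st) (phase st) ℚ.≤ N (items β st)
    below≤N []ᵣ c true  = ℚ.≤-refl
    below≤N []ᵣ c false = ℚ.≤-refl
    below≤N (_∷ᵣ_ {u} {us} s@(open-new {q} {r} {g} {T} {F} o le) run) c β =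
      ℚ.≤-trans (ℚ.≤-reflexive (trans (below-stable s run ≤-refl) (below-all run ≤-refl)))
        (subst (λ l → M ℚ.≤ N l) (items≡ β)
          (⊓ʳ-glb (b (suc q)) _ (ℚ.≤-trans M≤b (B-mono (n≤1+n _))) (M≤ (saturated run (continues-step s run c) β))))
      where
      M = total load us ; Λ = fromℕ (L u) ; n = N (items β (q , r , g , T , F))
      M≤b : M ℚ.≤ b q
      M≤b = ℚ.≤-trans (≤-by (load u) (0≤load u) refl) (total≤b s run c)
      items≡ : ∀ β → (u , suc q , true) ∷ items β (q , r , g , T , F)
                     ≡ items β (suc q , r ℚ.+ Y u ℚ.- 1ℚ , g , (u , suc q , true) ∷ T , (u , suc q , true) ∷ F)
      items≡ true  = refl
      items≡ false = refl
      0≤bit : ∀ β → 0ℚ ℚ.≤ bit β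
      0≤bit true  = fromℕ-mono 0 1 z≤n
      0≤bit false = ℚ.≤-refl
      M≤ : Saturated us (q , r , g , T , F) β → M ℚ.≤ n ℚ.+ Λ
      M≤ (inj₁ b≤n) = ℚ.≤-trans M≤b (ℚ.≤-trans b≤n (≤-by Λ (0≤fromℕ (L u)) (ℚ.+-comm Λ n)))
      -- The missing amount is at most the share `r * G` of the bag, which fits into the capacity of
      -- `u` since `r` is at most 1 and `G` at most `Λ`.
      M≤ (inj₂ t≤n) = ≤-by _
        (0≤- t≤n 0+ 0≤- (bag-share≤ (proj₁ (rest-bounds run)) (ℚ.<⇒≤ (proj₂ (rest-bounds run))) le)
          0+ (0≤bit β 0* 0≤fromℕ g))
        (arith n M Λ (fromℕ g) (bit β) r)
        where
        arith : ∀ n M Λ G β r → (n ℚ.- (M ℚ.+ (β ℚ.- r) ℚ.* G)) ℚ.+ (Λ ℚ.- r ℚ.* G) ℚ.+ β ℚ.* G ℚ.+ M ≡ n ℚ.+ Λ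
        arith = Ring.solve-∀ ℚ-ring
    below≤N (_∷ᵣ_ {u} {us} s@(open-bag {q} {r} {g} {T} {F} o le) run) c β =
      ℚ.≤-trans (ℚ.≤-reflexive (trans (below-stable s run ≤-refl) (below-all run ≤-refl))) (by β)
      where
      M = total load us ; Λ = fromℕ (L u)
      M≤b : M ℚ.≤ b q
      M≤b = ℚ.≤-trans (≤-by (load u) (0≤load u) refl) (total≤b s run c)
      M≤N : M ℚ.≤ N T
      M≤N with saturated run (continues-step s run c) true
      ... | inj₁ b≤n = ℚ.≤-trans M≤b b≤n
      -- In `T` the bag counts as opened, with full capacity `G`, although only `r * G` of it is
      -- accounted for; the surplus `(1 - r) * G` is nonnegative.
      ... | inj₂ t≤n = ℚ.≤-trans
        (≤-by _ (0≤- (ℚ.<⇒≤ (proj₂ (rest-bounds run))) 0* 0≤fromℕ g) (ℚ.+-comm _ M)) t≤n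
      by : ∀ β → M ℚ.≤ N (items β (suc q , r ℚ.+ Y u ℚ.- 1ℚ , L u , (u , suc q , true) ∷ T , (u , suc q , false) ∷ T))
      by true  = ⊓ʳ-glb (b (suc q)) _ (ℚ.≤-trans M≤b (B-mono (n≤1+n _)))
                   (ℚ.≤-trans M≤N (≤-by Λ (0≤fromℕ (L u)) (ℚ.+-comm Λ (N T))))
      by false = M≤N
    below≤N (_∷ᵣ_ {u} {us} s@(drop-bag {q} {r} {g} {T} {F} o le) run) c β =
      ℚ.≤-trans (ℚ.≤-reflexive (below-stable s run ≤-refl)) (by β)
      where
      Λ = fromℕ (L u)
      ih = below≤N run (continues-step s run c) false
      by : ∀ β → below F q ℚ.≤ N (items β (q , r ℚ.+ Y u , L u , (u , q , true) ∷ F , (u , q , false) ∷ F))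
      by true  = ⊓ʳ-glb (b q) _ (ℚ.≤-trans ih (N≤b run false))
                   (ℚ.≤-trans ih (≤-by Λ (0≤fromℕ (L u)) (ℚ.+-comm Λ (N F))))
      by false = ih
    below≤N (_∷ᵣ_ {u} {us} s@(drop-new {q} {r} {g} {T} {F} o le) run) c β =
      ℚ.≤-trans (ℚ.≤-reflexive (below-stable s run ≤-refl)) (by β)
      where
      by : ∀ β → below F q ℚ.≤ N (items β (q , r ℚ.+ Y u , g , (u , q , false) ∷ T , (u , q , false) ∷ F))
      by true  = below≤N run (continues-step s run c) true
      by false = below≤N run (continues-step s run c) false

    -- Once the openings seen add up to an integer, all load is placed.
    N≡total : ∀ {us st} → Run us st → Continues st → rest st ≡ 0ℚ →
              (∀ p → B p ℚ.≤ total load us) → N (items false st) ≡ total load us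
    N≡total {us} {st} run c r≡0 B≤ = ℚ.≤-antisym
      (ℚ.≤-trans (N≤b run false) (B≤ _)) (≤N (saturated run c false))
      where
      ≤N : Saturated us st false → total load us ℚ.≤ N (items false st)
      ≤N (inj₁ b≤n) = ℚ.≤-trans (total≤B run c (n≤1+n _)) b≤n
      ≤N (inj₂ t≤n) = ℚ.≤-trans (ℚ.≤-reflexive (sym (trans
        (cong (λ r → total load us ℚ.+ (0ℚ ℚ.- r) ℚ.* bag st) r≡0) (arith (total load us) (bag st))))) t≤n
        where
        arith : ∀ M G → M ℚ.+ (0ℚ ℚ.- 0ℚ) ℚ.* G ≡ M
        arith = Ring.solve-∀ ℚ-ring

    intervalsOf : List Item → List Interval
    intervalsOf []       = []
    intervalsOf (e ∷ es) = (e , total (load ∘ proj₁) es , N es , N (e ∷ es)) ∷ intervalsOf es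

    -- The load interval of an item of phase `p` lies between `B p` and `B (p + 1)`, whereas its
    -- capacity interval is confined only to the range from `B (p - 1)` to `B (p + 2)`. So a load
    -- interval and a capacity interval have a common part of positive length only if their phases
    -- differ by at most one.
    record Fits (e : Interval) : Set where
      private
        i = proj₁ (proj₁ e)
        p = proj₁ (proj₂ (proj₁ e))
        d = proj₂ (proj₂ (proj₁ e))
        M = proj₁ (proj₂ e)
        lo = proj₁ (proj₂ (proj₂ e))
        hi = proj₂ (proj₂ (proj₂ e))
      field
        0≤M   : 0ℚ ℚ.≤ M
        B≤M   : B p ℚ.≤ M
        M≤B   : M ℚ.+ load i ℚ.≤ B (suc p)
        hi≤B  : hi ℚ.≤ b p
        B≤lo  : ∀ {t} → suc t ≤ p → B t ℚ.≤ lo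
        lo≤hi : lo ℚ.≤ hi
        hi≤lo : hi ℚ.≤ lo ℚ.+ (if d then fromℕ (L i) else 0ℚ)

    fits : ∀ {us st} → Run us st → Continues st → ∀ β → All Fits (intervalsOf (items β st))
    fits []ᵣ c true  = []
    fits []ᵣ c false = []
    fits {st = st′} (_∷ᵣ_ {u} {us} {st} s run) c β with step-extends s β
    ... | extends d β′ eq = subst (λ l → All Fits (intervalsOf l)) (sym eq)
      (record
        { 0≤M   = subst (0ℚ ℚ.≤_) (sym M≡) (total-nonneg load 0≤load us)
        ; B≤M   = subst (B (phase st′) ℚ.≤_) (sym M≡) B≤total
        ; M≤B   = ℚ.≤-trans (ℚ.≤-reflexive (trans (cong (ℚ._+ load u) M≡) (ℚ.+-comm _ (load u))))
                    (total≤B (s ∷ᵣ run) c ≤-refl)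
        ; hi≤B  = subst (λ l → N l ℚ.≤ b (phase st′)) eq (N≤b (s ∷ᵣ run) β)
        ; B≤lo  = λ {t} lt → ℚ.≤-trans
            (ℚ.≤-trans (B-mono (s≤s⁻¹ (≤-trans lt (proj₂ (phase-step s))))) (ℚ.≤-reflexive (agrees c′ ≤-refl)))
            (below≤N run c′ β′)
        ; lo≤hi = lo≤hi′ d
        ; hi≤lo = hi≤lo′ d
        } ∷ fits run c′ β′)
      where
      c′ = continues-step s run c
      es = items β′ st
      M≡ : total (load ∘ proj₁) es ≡ total load us
      M≡ = total-items load run β′
      B≤total : B (phase st′) ℚ.≤ total load us
      B≤total = ℚ.≤-trans (ℚ.≤-reflexive (trans (agrees c ≤-refl) (below-stable s run ≤-refl)))
        -- The sum `suc (phase st) + phase st′` serves as an index beyond both phases; there `below`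
        -- counts the whole load before `u`.
        (ℚ.≤-trans (below-mono (items false st) (m≤n+m (phase st′) (suc (phase st))))
          (ℚ.≤-reflexive (below-all run (m≤m+n (suc (phase st)) (phase st′)))))
      lo≤hi′ : ∀ d → N es ℚ.≤ N ((u , phase st′ , d) ∷ es)
      lo≤hi′ true  = ⊓ʳ-glb (b (phase st′)) _
        (ℚ.≤-trans (N≤b run β′) (B-mono (s≤s (s≤s (proj₁ (phase-step s))))))
        (≤-by (fromℕ (L u)) (0≤fromℕ (L u)) (ℚ.+-comm _ (N es)))
      lo≤hi′ false = ℚ.≤-refl
      hi≤lo′ : ∀ d → N ((u , phase st′ , d) ∷ es) ℚ.≤ N es ℚ.+ (if d then fromℕ (L u) else 0ℚ)
      hi≤lo′ true  = ⊓ʳ≤ʳ (b (phase st′)) _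
      hi≤lo′ false = ℚ.≤-reflexive (sym (ℚ.+-identityʳ (N es)))

-- Boolean tests and searches in lists

≐-refl : ∀ m → (m ≐ m) ≡ true
≐-refl m rewrite true-≤ᵇ (≤-refl {m}) = refl

≐-sound : ∀ m n → (m ≐ n) ≡ true → m ≡ n
≐-sound m n eq with m ≤ᵇ n in le
... | true = ≤-antisym (≤ᵇ-trueⁿ m n le) (≤ᵇ-trueⁿ n m eq)

≐-complete : ∀ {m n} → m ≡ n → (m ≐ n) ≡ true
≐-complete {m} refl = ≐-refl m

≐-false : ∀ m n → m ≢ n → (m ≐ n) ≡ false
≐-false m n m≢n with m ≐ n in eq
... | false = refl
... | true  = contradiction (≐-sound m n eq) m≢n

≐-sym : ∀ m n → (m ≐ n) ≡ (n ≐ m)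
≐-sym m n with m ≐ n in eq
... | true  = sym (≐-complete (sym (≐-sound m n eq)))
... | false = sym (≐-false n m λ n≡m → case (trans (sym (≐-complete (sym n≡m))) eq) of λ ())

if-and : ∀ a b → (if a then b else false) ≡ true → a ≡ true × b ≡ true
if-and true b eq = refl , eq

module _ {A : Set} (f : A → Bool) where

  some : List A → Bool
  some = foldr (λ a b → if b then true else f a) false

  some-sound : ∀ as → some as ≡ true → ∃[ a ] (a ∈ as × f a ≡ true)
  some-sound (a ∷ as) eq with some as in more
  ... | true  = let (b , b∈ , fb) = some-sound as more in b , there b∈ , fb
  ... | false = a , here refl , eq

  some-complete : ∀ {a as} → a ∈ as → f a ≡ true → some as ≡ true
  some-complete {as = _ ∷ as} (here refl) fa with some as
  ... | true  = refl
  ... | false = fa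
  some-complete {as = b ∷ as} (there a∈) fa rewrite some-complete a∈ fa = refl

module _ (f : ℕ → Bool) (d : ℕ) where

  pick : List ℕ → ℕ
  pick = foldr (λ m c → if f m then m else c) d

  pick-found : ∀ {m ms} → m ∈ ms → f m ≡ true → pick ms ∈ ms × f (pick ms) ≡ true
  pick-found {ms = m ∷ ms} (here refl) fm rewrite fm = here refl , fm
  pick-found {ms = m ∷ ms} (there m∈) fm′ with f m in fm
  ... | true  = here refl , fm
  ... | false = let (p∈ , fp) = pick-found m∈ fm′ in there p∈ , fp

  pick-either : ∀ ms → (pick ms ∈ ms × f (pick ms) ≡ true) ⊎ pick ms ≡ d
  pick-either []       = inj₂ refl
  pick-either (m ∷ ms) with f m in fm
  ... | true  = inj₁ (here refl , fm)
  ... | false with pick-either ms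
  ...   | inj₁ (p∈ , fp) = inj₁ (there p∈ , fp)
  ...   | inj₂ eq        = inj₂ eq

misses : ∀ {A : Set} → (A → Bool) → List A → ℕ
misses f = foldr (λ a c → if f a then c else suc c) 0

module _ {A : Set} {f g : A → Bool} (f⇒g : ∀ a → f a ≡ true → g a ≡ true) where

  misses-anti : ∀ as → misses g as ≤ misses f as
  misses-anti []       = z≤n
  misses-anti (a ∷ as) with f a in fa | g a in ga
  ... | true  | true  = misses-anti as
  ... | true  | false = contradiction (trans (sym (f⇒g a fa)) ga) λ ()
  ... | false | true  = m≤n⇒m≤1+n (misses-anti as)
  ... | false | false = s≤s (misses-anti as)

  misses-strict : ∀ {a as} → a ∈ as → f a ≡ false → g a ≡ true → misses g as < misses f as
  misses-strict {as = a ∷ as} (here refl) fa ga rewrite fa | ga = s≤s (misses-anti as)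
  misses-strict {as = b ∷ as} (there a∈) fa ga with f b in fb | g b in gb
  ... | true  | true  = misses-strict a∈ fa ga
  ... | true  | false = contradiction (trans (sym (f⇒g b fb)) gb) λ ()
  ... | false | true  = m≤n⇒m≤1+n (misses-strict a∈ fa ga)
  ... | false | false = s≤s (misses-strict a∈ fa ga)

misses≤length : ∀ {A : Set} (f : A → Bool) as → misses f as ≤ length as
misses≤length f []       = z≤n
misses≤length f (a ∷ as) with f a
... | true  = m≤n⇒m≤1+n (misses≤length f as)
... | false = s≤s (misses≤length f as)

misses-none : ∀ {A : Set} (f : A → Bool) {a as} → misses f as ≡ 0 → a ∈ as → f a ≡ true
misses-none f {as = b ∷ as} none a∈ with f b in fb
misses-none f none (here refl) | true = fb
misses-none f none (there a∈)  | true = misses-none f none a∈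

misses-some : ∀ {A : Set} (f : A → Bool) as → misses f as ≡ 0 ⊎ ∃[ a ] (a ∈ as × f a ≡ false)
misses-some f []       = inj₁ refl
misses-some f (a ∷ as) with f a in fa
... | false = inj₂ (a , here refl , fa)
... | true with misses-some f as
...   | inj₁ none         = inj₁ none
...   | inj₂ (b , b∈ , q) = inj₂ (b , there b∈ , q)

-- Neighbourhoods and the construction of the line

module Geometry (V : List ℕ) (adj : ℕ → ℕ → Bool) (L : ℕ → ℕ) (X : ℕ → ℕ → ℚ) (Y : ℕ → ℚ)
  (adj-sym : ∀ i j → adj i j ≡ adj j i) where

  open Algorithm V adj L X Y

  near₁-refl : ∀ i → near₁ i i ≡ true
  near₁-refl i rewrite ≐-refl i = refl

  near₁-sym : ∀ i j → near₁ i j ≡ near₁ j i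
  near₁-sym i j rewrite ≐-sym i j | adj-sym i j = refl

  near₂-sound : ∀ i j → near₂ i j ≡ true → ∃[ w ] (w ∈ V × near₁ i w ≡ true × near₁ w j ≡ true)
  near₂-sound i j eq with some-sound (λ w → if near₁ i w then near₁ w j else false) V eq
  ... | w , w∈ , both = w , w∈ , if-and (near₁ i w) (near₁ w j) both

  near₂-complete : ∀ {i w j} → w ∈ V → near₁ i w ≡ true → near₁ w j ≡ true → near₂ i j ≡ true
  near₂-complete {i} {w} {j} w∈ iw wj = some-complete (λ w → if near₁ i w then near₁ w j else false) w∈
    (trans (cong (λ b → if b then near₁ w j else false) iw) wj)

  near₃-sound : ∀ i j → near₃ i j ≡ true → ∃[ w ] (w ∈ V × near₁ i w ≡ true × near₂ w j ≡ true)
  near₃-sound i j eq with some-sound (λ w → if near₁ i w then near₂ w j else false) V eq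
  ... | w , w∈ , both = w , w∈ , if-and (near₁ i w) (near₂ w j) both

  near₃-complete : ∀ {i w j} → w ∈ V → near₁ i w ≡ true → near₂ w j ≡ true → near₃ i j ≡ true
  near₃-complete {i} {w} {j} w∈ iw wj = some-complete (λ w → if near₁ i w then near₂ w j else false) w∈
    (trans (cong (λ b → if b then near₂ w j else false) iw) wj)

  near₂-sym : ∀ {i j} → near₂ i j ≡ true → near₂ j i ≡ true
  near₂-sym {i} {j} eq with near₂-sound i j eq
  ... | w , w∈ , iw , wj = near₂-complete w∈ (trans (near₁-sym j w) wj) (trans (near₁-sym w i) iw)

  near₁⇒near₂ : ∀ {i j} → j ∈ V → near₁ i j ≡ true → near₂ i j ≡ true
  near₁⇒near₂ {j = j} j∈ ij = near₂-complete j∈ ij (near₁-refl j)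

  data Within : ℕ → ℕ → ℕ → Set where
    done : ∀ {i} → Within 0 i i
    hop  : ∀ {d i j k} → near₁ i j ≡ true → j ∈ V → Within d j k → Within (suc d) i k

  within-trans : ∀ {d e i j k} → Within d i j → Within e j k → Within (d + e) i k
  within-trans done          w = w
  within-trans (hop h j∈ v) w = hop h j∈ (within-trans v w)

  within-sym : ∀ {d i j} → i ∈ V → Within d i j → Within d j i
  within-sym i∈ done = done
  within-sym {suc d} {i} {j} i∈ (hop {j = k} h k∈ w) =
    subst (λ e → Within e j i) (+-comm d 1)
      (within-trans (within-sym k∈ w) (hop (trans (near₁-sym k i) h) i∈ done))

  within-pad : ∀ {d e i j} → i ∈ V → d ≤ e → Within d i j → Within e i j
  within-pad {e = zero}  i∈ z≤n       done         = done
  within-pad {e = suc e} i∈ z≤n       done         = hop (near₁-refl _) i∈ (within-pad i∈ z≤n done)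
  within-pad             i∈ (s≤s d≤e) (hop h j∈ w) = hop h j∈ (within-pad j∈ d≤e w)

  near₂⇒within : ∀ {i j} → j ∈ V → near₂ i j ≡ true → Within 2 i j
  near₂⇒within {i} {j} j∈ eq with near₂-sound i j eq
  ... | w , w∈ , iw , wj = hop iw w∈ (hop wj j∈ done)

  near₃⇒within : ∀ {i j} → j ∈ V → near₃ i j ≡ true → Within 3 i j
  near₃⇒within {i} {j} j∈ eq with near₃-sound i j eq
  ... | w , w∈ , iw , wj = hop iw w∈ (near₂⇒within j∈ wj)

  -- The line of midpoints

  data Inserted (v : ℕ) : Line → Line → Set where
    right-of  : ∀ {m l} → near₃ v m ≡ true → Inserted v ((m , false) ∷ l) ((m , false) ∷ (v , true) ∷ l)
    left-of : ∀ {m l} → near₃ v m ≡ true → Inserted v ((m , true) ∷ l) ((v , false) ∷ (m , true) ∷ l)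
    skip   : ∀ {q l l′} → Inserted v l l′ → Inserted v (q ∷ l) (q ∷ l′)

  data Insertion (v : ℕ) (l : Line) : Bool × Line → Set where
    nowhere  : (∀ {q} → q ∈ l → near₃ v (proj₁ q) ≡ false) → Insertion v l (false , l)
    inserted : ∀ {l′} → Inserted v l l′ → Insertion v l (true , l′)

  insertion : ∀ v l → Insertion v l (insert v l)
  insertion v []      = nowhere λ ()
  insertion v (q ∷ l) with insert v l | insertion v l
  ... | _ | inserted ins = inserted (skip ins)
  ... | _ | nowhere none with near₃ v (proj₁ q) in eq
  ...   | false = nowhere λ { (here refl) → eq ; (there q∈) → none q∈ }
  insertion v ((m , true)  ∷ l) | _ | nowhere none | true = inserted (left-of eq)
  insertion v ((m , false) ∷ l) | _ | nowhere none | true = inserted (right-of eq)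

  data Extension (v : ℕ) (l : Line) : Line → Set where
    unchanged : coveredBy l v ≡ true ⊎ (∀ {q} → q ∈ l → near₃ v (proj₁ q) ≡ false) → Extension v l l
    extended  : ∀ {l′} → coveredBy l v ≡ false → Inserted v l l′ → Extension v l l′

  extension : ∀ v l → Extension v l (extend v l)
  extension v l with coveredBy l v in eq
  ... | true = unchanged (inj₁ eq)
  ... | false with insert v l | insertion v l
  ...   | _ | nowhere none = unchanged (inj₂ none)
  ...   | _ | inserted ins = extended eq ins

  inserted-⊆ : ∀ {v l l′ q} → Inserted v l l′ → q ∈ l → q ∈ l′
  inserted-⊆ (right-of _)  (here eq)  = here eq
  inserted-⊆ (right-of _)  (there q∈) = there (there q∈)
  inserted-⊆ (left-of _) q∈         = there q∈
  inserted-⊆ (skip ins) (here eq)  = here eq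
  inserted-⊆ (skip ins) (there q∈) = there (inserted-⊆ ins q∈)

  inserted-∈ : ∀ {v l l′} → Inserted v l l′ → ∃[ b ] (v , b) ∈ l′
  inserted-∈ (right-of _)  = true , there (here refl)
  inserted-∈ (left-of _) = false , here refl
  inserted-∈ (skip ins) = let (b , v∈) = inserted-∈ ins in b , there v∈

  inserted-All : ∀ {P : ℕ → Set} {v l l′} → Inserted v l l′ → P v →
                 All (P ∘ proj₁) l → All (P ∘ proj₁) l′
  inserted-All (right-of _)  pv (p ∷ ps) = p ∷ pv ∷ ps
  inserted-All (left-of _) pv ps       = pv ∷ ps
  inserted-All (skip ins) pv (p ∷ ps) = p ∷ inserted-All ins pv ps

  extend-⊆ : ∀ v {l q} → q ∈ l → q ∈ extend v l
  extend-⊆ v {l} q∈ with extend v l | extension v l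
  ... | _ | unchanged _    = q∈
  ... | _ | extended _ ins = inserted-⊆ ins q∈

  -- Vertices of even depth come before, vertices of odd depth after their
  -- subtrees, whence neighbours on the line are at most three tree edges apart.
  gap : ℕ × Bool → ℕ × Bool → ℕ
  gap (_ , a) (_ , b) = (if a then 3 else 0) + (3 + (if b then 0 else 3))

  Gaps : Line → Set
  Gaps []           = ⊤
  Gaps (_ ∷ [])     = ⊤
  Gaps (q ∷ q′ ∷ l) = Within (gap q q′) (proj₁ q) (proj₁ q′) × Gaps (q′ ∷ l)

  Separated : Line → Set
  Separated = AllPairs (λ q q′ → near₂ (proj₁ q) (proj₁ q′) ≡ false)

  record Valid (l : Line) : Set where
    field
      vertexes  : All ((_∈ V) ∘ proj₁) l
      gaps      : Gaps l
      separated : Separated l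
  open Valid public

  module _ {v : ℕ} (v∈ : v ∈ V) where

    -- `gap` is exactly stable under insertion. The new vertex is within 3 of its parent, and the
    -- detour through the parent adds 3 to the gap on the other side. `gap` allows for this, since a
    -- second entry `false` instead of `true`, or a first entry `true` instead of `false`, raises it
    -- by 3.
    insert-front : ∀ {q l l′} → Inserted v l l′ → All ((_∈ V) ∘ proj₁) l → Gaps (q ∷ l) → Gaps (q ∷ l′)
    insert-gaps  : ∀ {l l′} → Inserted v l l′ → All ((_∈ V) ∘ proj₁) l → Gaps l → Gaps l′

    insert-front ins@(right-of _) ps (w , g) = w , insert-gaps ins ps g
    insert-front {q , a} (left-of {m} {l} near) (m∈ ∷ ps) (w , g) =
      subst (λ d → Within d q v) (+-assoc (if a then 3 else 0) 3 3)
        (within-trans w (within-sym v∈ (near₃⇒within m∈ near))) ,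
      near₃⇒within m∈ near , g
    insert-front (skip ins) (_ ∷ ps) (w , g) = w , insert-front ins ps g

    insert-gaps (right-of {m} {[]} near) (m∈ ∷ _) g = within-sym v∈ (near₃⇒within m∈ near) , tt
    insert-gaps (right-of {m} {q ∷ l} near) (m∈ ∷ _) (w , g) =
      within-sym v∈ (near₃⇒within m∈ near) , within-trans (near₃⇒within m∈ near) w , g
    insert-gaps (left-of near) (m∈ ∷ _) g = near₃⇒within m∈ near , g
    insert-gaps (skip ins) (_ ∷ ps) g = insert-front ins ps g

    insert-separated : ∀ {l l′} → Inserted v l l′ → All (λ q → near₂ v (proj₁ q) ≡ false) l →
                       Separated l → Separated l′
    insert-separated (right-of {m} _)  (n ∷ ns) (s ∷ ss) = (apart n ∷ s) ∷ ns ∷ ss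
      where
      apart : near₂ v m ≡ false → near₂ m v ≡ false
      apart n with near₂ m v in eq
      ... | false = refl
      ... | true  = contradiction (trans (sym (near₂-sym {m} eq)) n) λ ()
    insert-separated (left-of _) ns ss = ns ∷ ss
    insert-separated (skip {q} ins) (n ∷ ns) (s ∷ ss) =
      inserted-All {P = λ w → near₂ (proj₁ q) w ≡ false} ins (apart n) s ∷ insert-separated ins ns ss
      where
      apart : near₂ v (proj₁ q) ≡ false → near₂ (proj₁ q) v ≡ false
      apart n with near₂ (proj₁ q) v in eq
      ... | false = refl
      ... | true  = contradiction (trans (sym (near₂-sym {proj₁ q} eq)) n) λ ()

    extend-valid : ∀ {l} → Valid l → Valid (extend v l)
    extend-valid {l} val with extend v l | extension v l
    ... | _ | unchanged _     = val
    ... | _ | extended un ins = record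
      { vertexes  = inserted-All ins v∈ (vertexes val)
      ; gaps      = insert-gaps ins (vertexes val) (gaps val)
      ; separated = insert-separated ins (All.tabulate far) (separated val)
      }
      where
      far : ∀ {q} → q ∈ l → near₂ v (proj₁ q) ≡ false
      far {q} q∈ with near₂ v (proj₁ q) in eq
      ... | false = refl
      ... | true  = contradiction (trans (sym (some-complete (λ q → near₂ v (proj₁ q)) q∈ eq)) un) λ ()

  coveredBy-⊆ : ∀ {l l′} → (∀ {q} → q ∈ l → q ∈ l′) → ∀ v → coveredBy l v ≡ true → coveredBy l′ v ≡ true
  coveredBy-⊆ {l} sub v c with some-sound (λ q → near₂ v (proj₁ q)) l c
  ... | q , q∈ , eq = some-complete (λ q → near₂ v (proj₁ q)) (sub q∈) eq

  extend-covers : ∀ {v l q} → v ∈ V → q ∈ l → near₃ v (proj₁ q) ≡ true → coveredBy (extend v l) v ≡ true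
  extend-covers {v} {l} v∈ q∈ near with extend v l | extension v l
  ... | _ | unchanged (inj₁ c)    = c
  ... | _ | unchanged (inj₂ none) = contradiction (trans (sym (none q∈)) near) λ ()
  ... | _ | extended _ ins        = some-complete (λ q → near₂ v (proj₁ q)) (proj₂ (inserted-∈ ins))
    (near₁⇒near₂ {v} v∈ (near₁-refl v))

  round : Line → List ℕ → Line
  round l W = foldr extend l W

  round-⊆ : ∀ W {l q} → q ∈ l → q ∈ round l W
  round-⊆ []      q∈ = q∈
  round-⊆ (v ∷ W) q∈ = extend-⊆ v (round-⊆ W q∈)

  round-valid : ∀ {W l} → All (_∈ V) W → Valid l → Valid (round l W)
  round-valid []         val = val
  round-valid (v∈ ∷ W∈) val = extend-valid v∈ (round-valid W∈ val)

  round-covers : ∀ {W l v q} → v ∈ V → v ∈ W → q ∈ l → near₃ v (proj₁ q) ≡ true →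
                 coveredBy (round l W) v ≡ true
  round-covers {v ∷ W}         v∈ (here refl) q∈ near = extend-covers v∈ (round-⊆ W q∈) near
  round-covers {u ∷ W} {l} {v} v∈ (there v∈W) q∈ near =
    coveredBy-⊆ {round l W} (extend-⊆ u) v (round-covers v∈ v∈W q∈ near)

  module _ (root∈ : 0 ∈ V) (connected : ∀ {i} → i ∈ V → ∃[ d ] Within d i 0) where

    -- On the way from an uncovered vertex to the root there is a last uncovered vertex before a
    -- covered one. The latter is within 2 of the line, hence the former is within 3, close enough
    -- to be inserted.
    frontier : ∀ {l d v} → coveredBy l 0 ≡ true → coveredBy l v ≡ false → v ∈ V → Within d v 0 →
               ∃[ u ] ∃[ q ] (u ∈ V × coveredBy l u ≡ false × q ∈ l × near₃ u (proj₁ q) ≡ true)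
    frontier c un v∈ done = contradiction (trans (sym c) un) λ ()
    frontier {l} {v = v} c un v∈ (hop {j = j} h j∈ w) with coveredBy l j in cj
    ... | false = frontier c cj j∈ w
    ... | true with some-sound (λ q → near₂ j (proj₁ q)) l cj
    ...   | q , q∈ , near = v , q , v∈ , un , q∈ , near₃-complete j∈ h near

    lineAfter : List ℕ → Line
    lineAfter = foldr (λ _ l → round l V) ((0 , false) ∷ [])

    root-in-line : ∀ W → (0 , false) ∈ lineAfter W
    root-in-line []      = here refl
    root-in-line (_ ∷ W) = round-⊆ V (root-in-line W)

    root-covered : ∀ W → coveredBy (lineAfter W) 0 ≡ true
    root-covered W = some-complete (λ q → near₂ 0 (proj₁ q)) (root-in-line W)
      (near₁⇒near₂ {0} root∈ (near₁-refl 0))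

    -- As long as some vertex is uncovered, `frontier` supplies one that is covered by the end of
    -- the next round, since covered vertices stay covered. So the number of uncovered vertices
    -- drops by at least one per round.
    uncovered-count : ∀ W → misses (coveredBy (lineAfter W)) V ≡ 0 ⊎
                            misses (coveredBy (lineAfter W)) V + length W ≤ length V
    uncovered-count [] = inj₂ (≤-trans (≤-reflexive (+-identityʳ _)) (misses≤length _ V))
    uncovered-count (w ∷ W) with misses-some (coveredBy (lineAfter W)) V
    ... | inj₁ none = inj₁ (n≤0⇒n≡0 (≤-trans (misses-anti (coveredBy-⊆ (round-⊆ V)) V) (≤-reflexive none)))
    ... | inj₂ (v , v∈ , un) with uncovered-count W
    ...   | inj₁ none = contradiction (trans (sym (misses-none (coveredBy (lineAfter W)) none v∈)) un) λ ()
    ...   | inj₂ le with frontier (root-covered W) un v∈ (proj₂ (connected v∈))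
    ...     | u , q , u∈ , un′ , q∈ , near = inj₂ (≤-trans (≤-reflexive (+-suc _ (length W)))
      (≤-trans (+-monoˡ-≤ (length W) (misses-strict (coveredBy-⊆ (round-⊆ V)) u∈ un′
        (round-covers u∈ u∈ q∈ near))) le))

    line-covers : ∀ {v} → v ∈ V → coveredBy line v ≡ true
    line-covers = misses-none (coveredBy line) (go (uncovered-count V))
      where
      go : misses (coveredBy line) V ≡ 0 ⊎ misses (coveredBy line) V + length V ≤ length V →
           misses (coveredBy line) V ≡ 0
      go (inj₁ none) = none
      go (inj₂ le)   = n≤0⇒n≡0 (+-cancelʳ-≤ (length V) _ 0 le)

    line-valid : Valid line
    line-valid = go V
      where
      go : ∀ W → Valid (lineAfter W)
      go []      = record { vertexes = root∈ ∷ [] ; gaps = tt ; separated = [] ∷ [] }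
      go (_ ∷ W) = round-valid (All.tabulate λ v∈ → v∈) (go W)

-- Finite sums

module _ {A : Set} where

  total-cong : ∀ {f g : A → ℚ} as → (∀ {a} → a ∈ as → f a ≡ g a) → total f as ≡ total g as
  total-cong []       eq = refl
  total-cong (a ∷ as) eq = cong₂ ℚ._+_ (eq (here refl)) (total-cong as (eq ∘ there))

  total-mono : ∀ {f g : A → ℚ} as → (∀ {a} → a ∈ as → f a ℚ.≤ g a) → total f as ℚ.≤ total g as
  total-mono []       le = ℚ.≤-refl
  total-mono (a ∷ as) le = ℚ.+-mono-≤ (le (here refl)) (total-mono as (le ∘ there))

  total-zero : ∀ {f : A → ℚ} as → (∀ {a} → a ∈ as → f a ≡ 0ℚ) → total f as ≡ 0ℚ
  total-zero []       eq = refl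
  total-zero (a ∷ as) eq = trans (cong₂ ℚ._+_ (eq (here refl)) (total-zero as (eq ∘ there))) (ℚ.+-identityˡ 0ℚ)

  total-+ : ∀ (f g : A → ℚ) as → total (λ a → f a ℚ.+ g a) as ≡ total f as ℚ.+ total g as
  total-+ f g []       = refl
  total-+ f g (a ∷ as) = trans (cong ((f a ℚ.+ g a) ℚ.+_) (total-+ f g as)) (arith (f a) (g a) _ _)
    where
    arith : ∀ a b c d → (a ℚ.+ b) ℚ.+ (c ℚ.+ d) ≡ (a ℚ.+ c) ℚ.+ (b ℚ.+ d)
    arith = Ring.solve-∀ ℚ-ring

  total-* : ∀ c (f : A → ℚ) as → total (λ a → c ℚ.* f a) as ≡ c ℚ.* total f as
  total-* c f []       = sym (ℚ.*-zeroʳ c)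
  total-* c f (a ∷ as) = trans (cong (c ℚ.* f a ℚ.+_) (total-* c f as)) (sym (ℚ.*-distribˡ-+ c (f a) _))

total-swap : ∀ {A B : Set} (f : A → B → ℚ) as bs →
  total (λ a → total (f a) bs) as ≡ total (λ b → total (λ a → f a b) as) bs
total-swap f []       bs = sym (total-zero bs λ _ → refl)
total-swap f (a ∷ as) bs = trans (cong (total (f a) bs ℚ.+_) (total-swap f as bs))
  (sym (total-+ (f a) (λ b → total (λ a → f a b) as) bs))

infix 5 _when_
_when_ : ℚ → Bool → ℚ
x when c = if c then x else 0ℚ

when-+ : ∀ c x s → (if c then x ℚ.+ s else s) ≡ (x when c) ℚ.+ s
when-+ true  x s = refl
when-+ false x s = sym (ℚ.+-identityˡ s)

when-mono : ∀ c {x y} → (c ≡ true → x ℚ.≤ y) → (x when c) ℚ.≤ (y when c)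
when-mono true  le = le refl
when-mono false le = ℚ.≤-refl

when-nonneg : ∀ c {x} → 0ℚ ℚ.≤ x → 0ℚ ℚ.≤ (x when c)
when-nonneg true  le = le
when-nonneg false le = ℚ.≤-refl

total-when : ∀ {A : Set} c (f : A → ℚ) as → total (λ a → f a when c) as ≡ (total f as when c)
total-when true  f as = refl
total-when false f as = total-zero as λ _ → refl

conditional-sum : ∀ {A : Set} (c : A → Bool) (f : A → ℚ) as →
  foldr (λ a s → if c a then f a ℚ.+ s else s) 0ℚ as ≡ total (λ a → f a when c a) as
conditional-sum c f []       = refl
conditional-sum c f (a ∷ as) = trans (when-+ (c a) (f a) _) (cong ((f a when c a) ℚ.+_) (conditional-sum c f as))

Distinct : List ℕ → Set
Distinct = AllPairs _≢_

total-absent : ∀ {i ms} x → All (i ≢_) ms → total (λ m → x when (i ≐ m)) ms ≡ 0ℚ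
total-absent {i} {ms} x i≢ = total-zero ms λ {m} m∈ → cong (x when_) (≐-false i m (All.lookup i≢ m∈))

total-single : ∀ {i ms} x → Distinct ms → i ∈ ms → total (λ m → x when (i ≐ m)) ms ≡ x
total-single {i} x (i≢ ∷ _) (here refl) =
  trans (cong₂ ℚ._+_ (cong (x when_) (≐-refl i)) (total-absent x i≢)) (ℚ.+-identityʳ x)
total-single {i} {m ∷ _} x (m≢ ∷ ms) (there i∈) =
  trans (cong₂ ℚ._+_ (cong (x when_) (≐-false i m λ i≡m → All.lookup m≢ i∈ (sym i≡m))) (total-single x ms i∈))
    (ℚ.+-identityˡ x)

-- Intersections of intervals

⊓ʳ≡ˡ : ∀ {p q} → p ℚ.≤ q → p ⊓ʳ q ≡ p
⊓ʳ≡ˡ {p} {q} le with ⊓ʳ-sel p q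
... | inj₁ (eq , _)  = eq
... | inj₂ (eq , ge) = trans eq (ℚ.≤-antisym ge le)

⊓ʳ≡ʳ : ∀ {p q} → q ℚ.≤ p → p ⊓ʳ q ≡ q
⊓ʳ≡ʳ {p} {q} le with ⊓ʳ-sel p q
... | inj₁ (eq , ge) = trans eq (ℚ.≤-antisym ge le)
... | inj₂ (eq , _)  = eq

⊓ʳ-monoˡ : ∀ {p q} r → p ℚ.≤ q → p ⊓ʳ r ℚ.≤ q ⊓ʳ r
⊓ʳ-monoˡ {p} {q} r le = ⊓ʳ-glb q r (ℚ.≤-trans (⊓ʳ≤ˡ p r) le) (⊓ʳ≤ʳ p r)

⊓ʳ-monoʳ : ∀ {p q} r → p ℚ.≤ q → r ⊓ʳ p ℚ.≤ r ⊓ʳ q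
⊓ʳ-monoʳ {p} {q} r le = ⊓ʳ-glb r q (⊓ʳ≤ˡ r p) (ℚ.≤-trans (⊓ʳ≤ʳ r p) le)

-- The length of the part of [c , d] to the left of t.
cut : ℚ → ℚ → ℚ → ℚ
cut c d t = (t ⊓ʳ d) ℚ.- (t ⊓ʳ c)

-- The same in the second interval: the length of [a , b] to the left of t.
stretch : ℚ → ℚ → ℚ → ℚ
stretch a b t = (b ⊓ʳ t) ℚ.- (a ⊓ʳ t)

module _ {a b : ℚ} (a≤b : a ℚ.≤ b) where

  stretch-nonneg : ∀ t → 0ℚ ℚ.≤ stretch a b t
  stretch-nonneg t = 0≤- (⊓ʳ-monoˡ t a≤b)

  stretch≤ : ∀ t → stretch a b t ℚ.≤ b ℚ.- a
  stretch≤ t with ℚ.≤-total t a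
  ... | inj₁ t≤a = ℚ.≤-trans (ℚ.≤-reflexive (trans
        (cong₂ ℚ._-_ (⊓ʳ≡ʳ (ℚ.≤-trans t≤a a≤b)) (⊓ʳ≡ʳ t≤a)) (ℚ.+-inverseʳ t))) (0≤- a≤b)
  ... | inj₂ a≤t = ℚ.≤-trans (ℚ.≤-reflexive (cong (λ z → (b ⊓ʳ t) ℚ.- z) (⊓ʳ≡ˡ a≤t)))
        (ℚ.+-monoˡ-≤ (ℚ.- a) (⊓ʳ≤ˡ b t))

module _ (a b c d : ℚ) where

  meet-cut : meet a b c d ≡ cut c d b ℚ.- cut c d a
  meet-cut = arith (b ⊓ʳ d) (a ⊓ʳ d) (b ⊓ʳ c) (a ⊓ʳ c)
    where
    arith : ∀ p q r s → (p ℚ.- q) ℚ.- (r ℚ.- s) ≡ (p ℚ.- r) ℚ.- (q ℚ.- s)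
    arith = Ring.solve-∀ ℚ-ring

  meet≤ : a ℚ.≤ b → meet a b c d ℚ.≤ b ℚ.- a
  meet≤ a≤b = ≤-by _ (stretch-nonneg a≤b c 0+ 0≤- (stretch≤ a≤b d)) (arith (stretch a b c) (stretch a b d) (b ℚ.- a))
    where
    arith : ∀ p q r → (p ℚ.+ (r ℚ.- q)) ℚ.+ (q ℚ.- p) ≡ r
    arith = Ring.solve-∀ ℚ-ring

  -- If `c` is at most `a`, the minima with `c` cancel; otherwise those with `a` do. Monotonicity of
  -- the minimum in one end point remains.
  meet-nonneg : a ℚ.≤ b → c ℚ.≤ d → 0ℚ ℚ.≤ meet a b c d
  meet-nonneg a≤b c≤d with ℚ.≤-total c a
  ... | inj₁ c≤a = ℚ.≤-trans (0≤- (⊓ʳ-monoˡ d a≤b)) (ℚ.≤-reflexive (trans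
    (arith (b ⊓ʳ d) (a ⊓ʳ d) c)
    (cong (λ z → ((b ⊓ʳ d) ℚ.- (a ⊓ʳ d)) ℚ.- z) (sym (cong₂ ℚ._-_ (⊓ʳ≡ʳ (ℚ.≤-trans c≤a a≤b)) (⊓ʳ≡ʳ c≤a))))))
    where
    arith : ∀ p q c → p ℚ.- q ≡ (p ℚ.- q) ℚ.- (c ℚ.- c)
    arith = Ring.solve-∀ ℚ-ring
  ... | inj₂ a≤c = ℚ.≤-trans (0≤- (⊓ʳ-monoʳ b c≤d)) (ℚ.≤-reflexive (trans
    (arith (b ⊓ʳ d) (b ⊓ʳ c) a)
    (sym (cong₂ (λ x y → ((b ⊓ʳ d) ℚ.- x) ℚ.- ((b ⊓ʳ c) ℚ.- y)) (⊓ʳ≡ˡ (ℚ.≤-trans a≤c c≤d)) (⊓ʳ≡ˡ a≤c)))))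
    where
    arith : ∀ p q a → p ℚ.- q ≡ (p ℚ.- a) ℚ.- (q ℚ.- a)
    arith = Ring.solve-∀ ℚ-ring

  meet-left : a ℚ.≤ b → b ℚ.≤ c → c ℚ.≤ d → meet a b c d ≡ 0ℚ
  meet-left a≤b b≤c c≤d = trans (cong₂ ℚ._-_
    (cong₂ ℚ._-_ (⊓ʳ≡ˡ (ℚ.≤-trans b≤c c≤d)) (⊓ʳ≡ˡ (ℚ.≤-trans a≤b (ℚ.≤-trans b≤c c≤d))))
    (cong₂ ℚ._-_ (⊓ʳ≡ˡ b≤c) (⊓ʳ≡ˡ (ℚ.≤-trans a≤b b≤c)))) (ℚ.+-inverseʳ (b ℚ.- a))

  meet-right : a ℚ.≤ b → c ℚ.≤ d → d ℚ.≤ a → meet a b c d ≡ 0ℚ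
  meet-right a≤b c≤d d≤a = trans (cong₂ ℚ._-_
    (cong₂ ℚ._-_ (⊓ʳ≡ʳ (ℚ.≤-trans d≤a a≤b)) (⊓ʳ≡ʳ d≤a))
    (cong₂ ℚ._-_ (⊓ʳ≡ʳ (ℚ.≤-trans c≤d (ℚ.≤-trans d≤a a≤b))) (⊓ʳ≡ʳ (ℚ.≤-trans c≤d d≤a)))) (arith d c)
    where
    arith : ∀ d c → (d ℚ.- d) ℚ.- (c ℚ.- c) ≡ 0ℚ
    arith = Ring.solve-∀ ℚ-ring

  cut-bounds : ∀ t → c ℚ.≤ d → 0ℚ ℚ.≤ cut c d t × cut c d t ℚ.≤ d ℚ.- c
  cut-bounds t c≤d with ℚ.≤-total t c
  ... | inj₁ t≤c = 0≤- (⊓ʳ-monoʳ t c≤d) , ℚ.≤-trans (ℚ.≤-reflexive (trans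
      (cong₂ ℚ._-_ (⊓ʳ≡ˡ (ℚ.≤-trans t≤c c≤d)) (⊓ʳ≡ˡ t≤c)) (ℚ.+-inverseʳ t))) (0≤- c≤d)
  ... | inj₂ c≤t = 0≤- (⊓ʳ-monoʳ t c≤d) , ℚ.≤-trans (ℚ.≤-reflexive (cong (λ z → (t ⊓ʳ d) ℚ.- z) (⊓ʳ≡ʳ c≤t)))
      (ℚ.+-monoˡ-≤ (ℚ.- c) (⊓ʳ≤ʳ t d))

meet-empty : ∀ a c d → meet a a c d ≡ 0ℚ
meet-empty a c d = trans (meet-cut a a c d) (ℚ.+-inverseʳ (cut c d a))

meet-empty′ : ∀ a b c → meet a b c c ≡ 0ℚ
meet-empty′ a b c = ℚ.+-inverseʳ ((b ⊓ʳ c) ℚ.- (a ⊓ʳ c))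

-- Clusters, phases and distances

gather : (ℕ → Bool) → List ℕ → List ℕ → List ℕ
gather keep l W = foldr (λ u l → if keep u then u ∷ l else l) l W

gather-total : ∀ (f : ℕ → ℚ) keep l W →
  total f (gather keep l W) ≡ total (λ u → f u when keep u) W ℚ.+ total f l
gather-total f keep l []      = sym (ℚ.+-identityˡ (total f l))
gather-total f keep l (u ∷ W) with keep u
... | true  = trans (cong (f u ℚ.+_) (gather-total f keep l W))
  (sym (ℚ.+-assoc (f u) (total (λ u → f u when keep u) W) (total f l)))
... | false = trans (gather-total f keep l W)
  (cong (ℚ._+ total f l) (sym (ℚ.+-identityˡ (total (λ u → f u when keep u) W))))

-- A feasible solution of LP1 on the vertices 0 , … , n - 1; the bounds hold
-- for all numbers, as entries outside the tables are 0.
record LPSolution (n : ℕ) (adj : ℕ → ℕ → Bool) (L : ℕ → ℕ) (X : ℕ → ℕ → ℚ) (Y : ℕ → ℚ) (k : ℕ) : Set where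
  V : List ℕ
  V = downFrom n
  open Algorithm V adj L X Y
  field
    adj-sym   : ∀ i j → adj i j ≡ adj j i
    root∈     : 0 ∈ V
    connected : ∀ {i} → i ∈ V → ∃[ d ] Geometry.Within V adj L X Y adj-sym d i 0
    0≤X       : ∀ u v → 0ℚ ℚ.≤ X u v
    X≤Y       : ∀ u v → X u v ℚ.≤ Y u
    Y-bounds  : ∀ u → 0ℚ ℚ.≤ Y u × Y u ℚ.≤ 1ℚ
    load≤     : ∀ u → load u ℚ.≤ fromℕ (L u) ℚ.* Y u
    covered₁  : ∀ {v} → v ∈ V → total (λ u → X u v) V ≡ 1ℚ
    local₁    : ∀ u v → near₁ u v ≡ false → X u v ≡ 0ℚ
    mass      : total Y V ≡ fromℕ k

module Clusters {n : ℕ} {adj : ℕ → ℕ → Bool} {L : ℕ → ℕ} {X : ℕ → ℕ → ℚ} {Y : ℕ → ℚ} {k : ℕ}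
  (S : LPSolution n adj L X Y k) where

  open LPSolution S public
  open Algorithm V adj L X Y public
  open Geometry V adj L X Y adj-sym public

  firsts : Line → List ℕ
  firsts = foldr (λ q l → proj₁ q ∷ l) []

  firsts-All : ∀ {P : ℕ → Set} {l} → All (P ∘ proj₁) l → All P (firsts l)
  firsts-All []       = []
  firsts-All (p ∷ ps) = p ∷ firsts-All ps

  firsts-∈ : ∀ {q l} → q ∈ l → proj₁ q ∈ firsts l
  firsts-∈ (here refl) = here refl
  firsts-∈ (there q∈)  = there (firsts-∈ q∈)

  firsts-AllPairs : ∀ {R : ℕ → ℕ → Set} {l} → AllPairs (λ q q′ → R (proj₁ q) (proj₁ q′)) l →
                    AllPairs R (firsts l)
  firsts-AllPairs []               = []
  firsts-AllPairs {R} (r ∷ rs) = firsts-All {P = R _} r ∷ firsts-AllPairs rs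

  Chain : List ℕ → Set
  Chain []           = ⊤
  Chain (_ ∷ [])     = ⊤
  Chain (m ∷ m′ ∷ l) = Within 9 m m′ × Chain (m′ ∷ l)

  gap≤9 : ∀ q q′ → gap q q′ ≤ 9
  gap≤9 (_ , true)  (_ , true)  = ≤-slack 3 refl
  gap≤9 (_ , true)  (_ , false) = ≤-slack 0 refl
  gap≤9 (_ , false) (_ , true)  = ≤-slack 6 refl
  gap≤9 (_ , false) (_ , false) = ≤-slack 3 refl

  firsts-Chain : ∀ l → All ((_∈ V) ∘ proj₁) l → Gaps l → Chain (firsts l)
  firsts-Chain []            _        _       = tt
  firsts-Chain (q ∷ [])      _        _       = tt
  firsts-Chain (q ∷ q′ ∷ l) (q∈ ∷ ps) (w , g) =
    within-pad q∈ (gap≤9 q q′) w , firsts-Chain (q′ ∷ l) ps g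

  separated-≡ : ∀ {ms m m′} → All (_∈ V) ms → AllPairs (λ m m′ → near₂ m m′ ≡ false) ms →
                m ∈ ms → m′ ∈ ms → near₂ m m′ ≡ true → m ≡ m′
  separated-≡ _ _ (here refl) (here refl) _ = refl
  separated-≡ _ (s ∷ _) (here refl) (there m′∈) near = contradiction (trans (sym near) (All.lookup s m′∈)) λ ()
  separated-≡ {m = m} _ (s ∷ _) (there m∈) (here refl) near =
    contradiction (trans (sym (near₂-sym {m} near)) (All.lookup s m∈)) λ ()
  separated-≡ (_ ∷ ps) (_ ∷ ss) (there m∈) (there m′∈) near = separated-≡ ps ss m∈ m′∈ near

  separated-distinct : ∀ {ms} → All (_∈ V) ms → AllPairs (λ m m′ → near₂ m m′ ≡ false) ms → Distinct ms
  separated-distinct []        []       = []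
  separated-distinct {m ∷ _} (m∈ ∷ ps) (s ∷ ss) = All.map
    (λ { far refl → contradiction (trans (sym (near₁⇒near₂ {m} m∈ (near₁-refl m))) far) λ () }) s
    ∷ separated-distinct ps ss


  valid-line : Valid line
  valid-line = line-valid root∈ connected

  ms : List ℕ
  ms = midpoints

  ms∈ : All (_∈ V) ms
  ms∈ = firsts-All {P = _∈ V} (vertexes valid-line)

  ms-separated : AllPairs (λ m m′ → near₂ m m′ ≡ false) ms
  ms-separated = firsts-AllPairs (separated valid-line)

  ms-distinct : Distinct ms
  ms-distinct = separated-distinct ms∈ ms-separated

  ms-chain : Chain ms
  ms-chain = firsts-Chain line (vertexes valid-line) (gaps valid-line)

  c : ℕ → ℕ
  c = centre ms

  c-near : ∀ {u} → u ∈ V → c u ∈ ms × near₂ u (c u) ≡ true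
  c-near {u} u∈ with some-sound (λ q → near₂ u (proj₁ q)) line (line-covers root∈ connected u∈)
  ... | q , q∈ , near with pick-found (near₂ u) 0 (firsts-∈ q∈) near
  ...   | p∈ , nearp with pick-either (near₁ u) (pick (near₂ u) 0 ms) ms
  ...     | inj₁ (c∈ , near₁c) = c∈ , near₁⇒near₂ {u} (All.lookup ms∈ c∈) near₁c
  ...     | inj₂ eq = subst (λ m → m ∈ ms × near₂ u m ≡ true) (sym eq) (p∈ , nearp)

  -- Two midpoints within 1 of `u` would be within 2 of each other, which separation forbids.
  c-unique : ∀ {u m} → u ∈ V → m ∈ ms → near₁ u m ≡ true → c u ≡ m
  c-unique {u} {m} u∈ m∈ near with pick-found (near₁ u) (pick (near₂ u) 0 ms) m∈ near
  ... | c∈ , near₁c = separated-≡ ms∈ ms-separated c∈ m∈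
    (near₂-complete u∈ (trans (near₁-sym (c u) u) near₁c) near)

  -- The order of the vertices, cluster by cluster

  ordered : List ℕ → List ℕ
  ordered = foldr (cluster ms) []

  ordered-total : ∀ (f : ℕ → ℚ) ms′ →
    total f (ordered ms′) ≡ total (λ u → total (λ m → f u when (c u ≐ m)) ms′) V
  ordered-total f []        = sym (total-zero V λ _ → refl)
  ordered-total f (m ∷ ms′) = trans (gather-total f (λ u → c u ≐ m) (ordered ms′) V)
    (trans (cong (total (λ u → f u when (c u ≐ m)) V ℚ.+_) (ordered-total f ms′))
      (sym (total-+ (λ u → f u when (c u ≐ m)) _ V)))

  -- Equality of all sums stands in for the fact that the order is a permutation of `V`. It holds
  -- because the midpoints are distinct and every vertex has exactly one centre among them.
  order-total : ∀ (f : ℕ → ℚ) → total f (order ms) ≡ total f V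
  order-total f = trans (ordered-total f ms)
    (total-cong V λ {u} u∈ → total-single (f u) ms-distinct (proj₁ (c-near u∈)))


  open Rounding V adj L X Y 0≤X Y-bounds load≤ public

  -- The unit of demand of the midpoint is served from its closed neighbourhood, which lies in the
  -- cluster, and a vertex serves it with no more than its own opening.
  cluster-mass : ∀ {m} → m ∈ ms → 1ℚ ℚ.≤ total (λ u → Y u when (c u ≐ m)) V
  cluster-mass {m} m∈ = ℚ.≤-trans (ℚ.≤-reflexive (sym (covered₁ (All.lookup ms∈ m∈)))) (total-mono V term)
    where
    term : ∀ {u} → u ∈ V → X u m ℚ.≤ (Y u when (c u ≐ m))
    term {u} u∈ with near₁ u m in near
    ... | true  = subst (λ b → X u m ℚ.≤ (Y u when b)) (sym (≐-complete (c-unique u∈ m∈ near))) (X≤Y u m)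
    ... | false = subst (ℚ._≤ (Y u when (c u ≐ m))) (sym (local₁ u m near)) (when-nonneg (c u ≐ m) (proj₁ (Y-bounds u)))

  phaseOf : List ℕ → ℕ
  phaseOf us = phase (scan us)

  phaseOf-gather : ∀ keep l W → phaseOf l ≤ phaseOf (gather keep l W)
  phaseOf-gather keep l []      = ≤-refl
  phaseOf-gather keep l (u ∷ W) with keep u
  ... | true  = ≤-trans (phaseOf-gather keep l W)
    (proj₁ (phase-step (scan-step u (scan (gather keep l W)))))
  ... | false = phaseOf-gather keep l W

  -- The phase plus the content of the bag grows by at least 1 over a cluster, while the bag holds
  -- less than 1 afterwards; so the integral part has to go up.
  phase-increases : ∀ {m} → m ∈ ms → ∀ l → phaseOf l < phaseOf (cluster ms m l)
  phase-increases {m} m∈ l = ≰⇒> λ q′≤q → ℚ.<-irrefl refl (ℚ.<-≤-trans (too-small q′≤q) large)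
    where
    q = phaseOf l
    q′ = phaseOf (cluster ms m l)
    mass-after : fromℕ q′ ℚ.+ rest (scan (cluster ms m l)) ≡ total (λ u → Y u when (c u ≐ m)) V ℚ.+ (fromℕ q ℚ.+ rest (scan l))
    mass-after = trans (phase+rest (scan-run (cluster ms m l)))
      (trans (gather-total Y (λ u → c u ≐ m) l V) (cong (total (λ u → Y u when (c u ≐ m)) V ℚ.+_) (sym (phase+rest (scan-run l)))))
    large : fromℕ q ℚ.+ 1ℚ ℚ.≤ fromℕ q′ ℚ.+ rest (scan (cluster ms m l))
    large = ℚ.≤-trans (≤-by _ (0≤- (cluster-mass m∈) 0+ proj₁ (rest-bounds (scan-run l)))
      (arith (total (λ u → Y u when (c u ≐ m)) V) (fromℕ q) (rest (scan l)))) (ℚ.≤-reflexive (sym mass-after))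
      where
      arith : ∀ t q r → ((t ℚ.- 1ℚ) ℚ.+ r) ℚ.+ (q ℚ.+ 1ℚ) ≡ t ℚ.+ (q ℚ.+ r)
      arith = Ring.solve-∀ ℚ-ring
    too-small : q′ ≤ q → fromℕ q′ ℚ.+ rest (scan (cluster ms m l)) ℚ.< fromℕ q ℚ.+ 1ℚ
    too-small le = ℚ.+-mono-≤-< (fromℕ-mono q′ q le) (proj₂ (rest-bounds (scan-run (cluster ms m l))))

  -- The phase of an item is the one reached when the scan has processed the suffix of the order
  -- that begins with it, irrespective of the decisions. This ties phases to the clusters of which
  -- the order is composed.
  data HasPhase (i p : ℕ) : List ℕ → Set where
    hereₚ  : ∀ {us} → p ≡ phaseOf (i ∷ us) → HasPhase i p (i ∷ us)
    thereₚ : ∀ {u us} → HasPhase i p us → HasPhase i p (u ∷ us)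

  item-phase : ∀ us β {i p d} → (i , p , d) ∈ items β (scan us) → HasPhase i p us
  item-phase []       true  ()
  item-phase []       false ()
  item-phase (u ∷ us) β {i} {p} {d} e∈ with step-extends (scan-step u (scan us)) β
  ... | extends d′ β′ eq with subst ((i , p , d) ∈_) eq e∈
  ...   | here refl = hereₚ refl
  ...   | there e∈′ = thereₚ (item-phase us β′ e∈′)

  phase≤ : ∀ {i p us} → HasPhase i p us → p ≤ phaseOf us
  phase≤ (hereₚ refl) = ≤-refl
  phase≤ (thereₚ {u} {us} h) = ≤-trans (phase≤ h) (proj₁ (phase-step (scan-step u (scan us))))

  gather-phase : ∀ {i p} keep l W → All (_∈ V) W → HasPhase i p (gather keep l W) →
    (i ∈ V × keep i ≡ true × phaseOf l ≤ p) ⊎ HasPhase i p l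
  gather-phase keep l []      _          h = inj₂ h
  gather-phase keep l (u ∷ W) (u∈ ∷ W∈) h with keep u in eq
  ... | false = gather-phase keep l W W∈ h
  gather-phase keep l (u ∷ W) (u∈ ∷ W∈) (hereₚ refl) | true = inj₁ (u∈ , eq ,
    ≤-trans (phaseOf-gather keep l W) (proj₁ (phase-step (scan-step u (scan (gather keep l W))))))
  gather-phase keep l (u ∷ W) (u∈ ∷ W∈) (thereₚ h)   | true = gather-phase keep l W W∈ h

  split-phase : ∀ {i p} m ms′ → HasPhase i p (ordered (m ∷ ms′)) →
    (i ∈ V × c i ≡ m × phaseOf (ordered ms′) ≤ p) ⊎ HasPhase i p (ordered ms′)
  split-phase {i} m ms′ h with gather-phase (λ u → c u ≐ m) (ordered ms′) V (All.tabulate λ u∈ → u∈) h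
  ... | inj₁ (i∈ , kept , q≤) = inj₁ (i∈ , ≐-sound (c i) m kept , q≤)
  ... | inj₂ h′               = inj₂ h′

  to-centre : ∀ {i} → i ∈ V → Within 2 i (c i)
  to-centre i∈ = near₂⇒within (All.lookup ms∈ (proj₁ (c-near i∈))) (proj₂ (c-near i∈))

  ordered-∈ : ∀ {i p} ms′ → HasPhase i p (ordered ms′) → i ∈ V
  ordered-∈ (m ∷ ms′) h with split-phase m ms′ h
  ... | inj₁ (i∈ , _) = i∈
  ... | inj₂ h′       = ordered-∈ ms′ h′

  -- Every cluster raises the phase, so a small difference of phases
  -- means few clusters in between.
  distance-to-head : ∀ {i p} m ms′ → (∀ {m′} → m′ ∈ m ∷ ms′ → m′ ∈ ms) → Chain (m ∷ ms′) →
    HasPhase i p (ordered (m ∷ ms′)) →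
    ∃[ t ] (p + t ≤ phaseOf (ordered (m ∷ ms′)) × Within (2 + t * 9) i m)
  distance-to-head {p = p} m ms′ sub chain h with split-phase m ms′ h
  ... | inj₁ (i∈ , refl , _) = 0 , ≤-trans (≤-reflexive (+-identityʳ p)) (phase≤ h) , to-centre i∈
  distance-to-head m [] sub chain h | inj₂ ()
  distance-to-head {i} {p} m (m′ ∷ ms′) sub (w , chain) h | inj₂ h′
    with distance-to-head m′ ms′ (sub ∘ there) chain h′
  ... | t , le , w′ = suc t ,
    ≤-trans (≤-reflexive (+-suc p t)) (≤-trans (s≤s le) (phase-increases (sub (here refl)) (ordered (m′ ∷ ms′)))) ,
    subst (λ d → Within (2 + d) i m) (+-comm (t * 9) 9)
      (within-trans w′ (within-sym (All.lookup ms∈ (sub (here refl))) w))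

  -- 22 = 2 + 9 + 9 + 2: two cluster radii and at most two gaps of the line.
  close-across : ∀ {i p j p′} m ms′ → (∀ {m′} → m′ ∈ m ∷ ms′ → m′ ∈ ms) → Chain (m ∷ ms′) →
    i ∈ V → c i ≡ m → phaseOf (ordered ms′) ≤ p → HasPhase j p′ (ordered ms′) → p ≤ suc p′ →
    Within 22 j i
  close-across m (m′ ∷ ms′) sub (w , chain) i∈ refl q≤p hj p≤
    with distance-to-head m′ ms′ (sub ∘ there) chain hj
  ... | t , le , w′ = within-trans
    (within-pad (ordered-∈ (m′ ∷ ms′) hj) (+-monoʳ-≤ 2 (*-monoˡ-≤ 9 t≤1)) w′)
    (within-trans (within-sym (All.lookup ms∈ (sub (here refl))) w) (within-sym i∈ (to-centre i∈)))
    where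
    t≤1 : t ≤ 1
    -- The cluster of `i` is scanned after everything in `ms′`, so `p′ + t` is at most the phase
    -- with which it starts, hence at most `p` and thus at most `p′ + 1`.
    t≤1 = +-cancelˡ-≤ _ t 1 (≤-trans le (≤-trans q≤p (≤-trans p≤ (≤-reflexive (+-comm 1 _)))))

  close : ∀ {i p j p′} ms′ → (∀ {m} → m ∈ ms′ → m ∈ ms) → Chain ms′ →
    HasPhase i p (ordered ms′) → HasPhase j p′ (ordered ms′) → p ≤ suc p′ → p′ ≤ suc p → Within 22 i j
  close (m ∷ ms′) sub chain hi hj p≤ p′≤ with split-phase m ms′ hi | split-phase m ms′ hj
  ... | inj₁ (i∈ , ci , _) | inj₁ (j∈ , cj , _) = within-pad i∈ (≤-slack 18 refl)
    (within-trans (to-centre i∈) (within-sym j∈ (subst (Within 2 _) (trans cj (sym ci)) (to-centre j∈))))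
  ... | inj₁ (i∈ , ci , q≤) | inj₂ hj′ =
    within-sym (ordered-∈ ms′ hj′) (close-across m ms′ sub chain i∈ ci q≤ hj′ p≤)
  ... | inj₂ hi′ | inj₁ (j∈ , cj , q≤) = close-across m ms′ sub chain j∈ cj q≤ hi′ p′≤
  ... | inj₂ hi′ | inj₂ hj′ = close ms′ (sub ∘ there) (chain-tail ms′ chain) hi′ hj′ p≤ p′≤
    where
    chain-tail : ∀ ms′ → Chain (m ∷ ms′) → Chain ms′
    chain-tail []       _       = tt
    chain-tail (_ ∷ _)  (_ , g) = g

  phases-close : ∀ {i p d j p′ d′} → (i , p , d) ∈ decisions → (j , p′ , d′) ∈ decisions →
    p ≤ suc p′ → p′ ≤ suc p → Within 22 i j
  phases-close e∈ e∈′ = close ms (λ m∈ → m∈) ms-chain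
    (item-phase (order ms) false e∈) (item-phase (order ms) false e∈′)

  decision-∈ : ∀ {e} → e ∈ decisions → proj₁ e ∈ V
  decision-∈ e∈ = ordered-∈ ms (item-phase (order ms) false e∈)

-- The rounded assignment satisfies the linear program

chain : ∀ a b c → (a ℚ.- b) ℚ.+ (b ℚ.- c) ≡ a ℚ.- c
chain = Ring.solve-∀ ℚ-ring

telescope : ∀ (g : ℕ → ℚ) m → total (λ v → g (suc v) ℚ.- g v) (downFrom m) ≡ g m ℚ.- g 0
telescope g zero    = sym (ℚ.+-inverseʳ (g 0))
telescope g (suc m) = trans (cong ((g (suc m) ℚ.- g m) ℚ.+_) (telescope g m)) (chain (g (suc m)) (g m) (g 0))

module _ (f : ℕ → ℚ) where

  initial-all : ∀ {v} n → n ≤ v →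
    foldr (λ w s → if suc w ≤ᵇ v then f w ℚ.+ s else s) 0ℚ (downFrom n) ≡ total f (downFrom n)
  initial-all zero    _  = refl
  initial-all {v} (suc n) le rewrite true-≤ᵇ {suc n} {v} le = cong (f n ℚ.+_) (initial-all n (<⇒≤ le))

  initial : ∀ {v} n → v ≤ n →
    foldr (λ w s → if suc w ≤ᵇ v then f w ℚ.+ s else s) 0ℚ (downFrom n) ≡ total f (downFrom v)
  initial {zero}  zero    z≤n = refl
  initial {v} (suc n) le with m≤n⇒m<n∨m≡n le
  ... | inj₂ refl = initial-all (suc n) ≤-refl
  ... | inj₁ (s≤s v≤n) rewrite false-≤ᵇ {suc n} {v} (s≤s v≤n) = initial n v≤n

  total-downFrom-mono : (∀ w → 0ℚ ℚ.≤ f w) → ∀ {v} n → v ≤ n → total f (downFrom v) ℚ.≤ total f (downFrom n)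
  total-downFrom-mono 0≤f {zero}  n       z≤n       = total-nonneg f 0≤f (downFrom n)
  total-downFrom-mono 0≤f {suc v} (suc n) le with m≤n⇒m<n∨m≡n le
  ... | inj₂ refl      = ℚ.≤-refl
  ... | inj₁ (s≤s v<n) = ℚ.≤-trans (total-downFrom-mono 0≤f n v<n) (≤-by (f n) (0≤f n) refl)

module Assignment {n : ℕ} {adj : ℕ → ℕ → Bool} {L : ℕ → ℕ} {X : ℕ → ℕ → ℚ} {Y : ℕ → ℚ} {k : ℕ}
  (S : LPSolution n adj L X Y k) where

  open Clusters S

  site : Interval → ℕ
  site e = proj₁ (proj₁ e)

  us : List ℕ
  us = order ms

  D : List Item
  D = decisions

  run-us : Run us (scan us)
  run-us = scan-run us

  B : ℕ → ℚ
  B = below D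

  B-mono : ∀ {p p′} → p ≤ p′ → B p ℚ.≤ B p′
  B-mono = below-mono D

  0≤B : ∀ p → 0ℚ ℚ.≤ B p
  0≤B = below-nonneg D

  whole : ℚ
  whole = total load us

  B≤whole : ∀ p → B p ℚ.≤ whole
  B≤whole p = ℚ.≤-trans (below-mono D (m≤m+n p (suc (phase (scan us)))))
    (ℚ.≤-reflexive (below-all run-us (m≤n+m (suc (phase (scan us))) p)))

  continues : Continues B B-mono 0≤B (scan us)
  continues = record { agrees = λ _ → refl ; exceeds = λ _ → ℚ.≤-refl }

  -- The total opening is the integer `k`, and the bag holds less than 1, so nothing can be left in
  -- it.
  phase≡k : phase (scan us) ≡ k × rest (scan us) ≡ 0ℚ
  phase≡k = q≡k , trans (arith (fromℕ k) r)
    (trans (cong (ℚ._- fromℕ k) (trans (cong (λ m → fromℕ m ℚ.+ r) (sym q≡k)) sum≡)) (ℚ.+-inverseʳ (fromℕ k)))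
    where
    q = phase (scan us)
    r = rest (scan us)
    sum≡ : fromℕ q ℚ.+ r ≡ fromℕ k
    sum≡ = trans (phase+rest run-us) (trans (order-total Y) mass)
    q≤k : q ≤ k
    q≤k = fromℕ-cancel-≤ q k (≤-by r (proj₁ (rest-bounds run-us)) (trans (ℚ.+-comm r (fromℕ q)) sum≡))
    k≤q : k ≤ q
    k≤q = ≮⇒≥ λ q<k → ℚ.<-irrefl refl (ℚ.≤-<-trans
      (ℚ.≤-trans (ℚ.≤-reflexive (trans (ℚ.+-comm (fromℕ q) 1ℚ) (sym (fromℕ-suc q)))) (fromℕ-mono (suc q) k q<k))
      (subst (ℚ._< fromℕ q ℚ.+ 1ℚ) sum≡ (ℚ.+-monoʳ-< (fromℕ q) (proj₂ (rest-bounds run-us)))))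
    q≡k : q ≡ k
    q≡k = ≤-antisym q≤k k≤q
    arith : ∀ k r → r ≡ (k ℚ.+ r) ℚ.- k
    arith = Ring.solve-∀ ℚ-ring

  fill-all : List Item → ℚ
  fill-all = N B B-mono 0≤B

  spans : List Item → List Interval
  spans = intervalsOf B B-mono 0≤B

  fill-all≡whole : fill-all D ≡ whole
  fill-all≡whole = N≡total B B-mono 0≤B run-us continues (proj₂ phase≡k) B≤whole

  out : List Interval
  out = intervals

  fills≡ : ∀ es → fills D es ≡ (total (load ∘ proj₁) es , fill-all es , spans es)
  fills≡ []                = refl
  fills≡ ((i , p , d) ∷ es) = cong (fill D (i , p , d)) (fills≡ es)

  out≡ : out ≡ spans D
  out≡ = cong (λ r → proj₂ (proj₂ r)) (fills≡ D)

  out-fits : ∀ {e} → e ∈ out → Fits B B-mono 0≤B e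
  out-fits e∈ = All.lookup (fits B B-mono 0≤B run-us continues false) (subst (_ ∈_) out≡ e∈)

  spans-item : ∀ {e} es → e ∈ spans es → proj₁ e ∈ es
  spans-item (_ ∷ es) (here refl) = here refl
  spans-item (_ ∷ es) (there e∈)  = there (spans-item es e∈)

  out-item : ∀ {e} → e ∈ out → proj₁ e ∈ D
  out-item e∈ = spans-item D (subst (_ ∈_) out≡ e∈)

  out-∈ : ∀ {e} → e ∈ out → site e ∈ V
  out-∈ e∈ = decision-∈ (out-item e∈)

  spans-total : ∀ (f : Item → ℚ) es → total (f ∘ proj₁) (spans es) ≡ total f es
  spans-total f []       = refl
  spans-total f (e ∷ es) = cong (f e ℚ.+_) (spans-total f es)

  out-total : ∀ (f : Item → ℚ) → total (f ∘ proj₁) out ≡ total f D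
  out-total f = trans (cong (total (f ∘ proj₁)) out≡) (spans-total f D)

  out-vertices : ∀ (f : ℕ → ℚ) → total (f ∘ site) out ≡ total f V
  out-vertices f = trans (out-total (f ∘ proj₁)) (trans (total-items f run-us false) (order-total f))

  distinct : Distinct V
  distinct = downFrom⁺ n

  -- Telescoping sums over the intervals

  loads-telescope : ∀ (g : ℚ → ℚ) es →
    total (λ e → g (proj₁ (proj₂ e) ℚ.+ load (site e)) ℚ.- g (proj₁ (proj₂ e))) (spans es)
    ≡ g (total (load ∘ proj₁) es) ℚ.- g 0ℚ
  loads-telescope g []       = sym (ℚ.+-inverseʳ (g 0ℚ))
  loads-telescope g ((i , p , d) ∷ es) = trans
    (cong₂ ℚ._+_ (cong (λ z → g z ℚ.- g M) (ℚ.+-comm M (load i))) (loads-telescope g es))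
    (chain (g (load i ℚ.+ M)) (g M) (g 0ℚ))
    where
    M = total (load ∘ proj₁) es

  fills-telescope : ∀ (g : ℚ → ℚ) es →
    total (λ e → g (proj₂ (proj₂ (proj₂ e))) ℚ.- g (proj₁ (proj₂ (proj₂ e)))) (spans es)
    ≡ g (fill-all es) ℚ.- g 0ℚ
  fills-telescope g []       = sym (ℚ.+-inverseʳ (g 0ℚ))
  fills-telescope g (e ∷ es) = trans
    (cong ((g (fill-all (e ∷ es)) ℚ.- g (fill-all es)) ℚ.+_) (fills-telescope g es))
    (chain (g (fill-all (e ∷ es))) (g (fill-all es)) (g 0ℚ))

  pre : ℕ → ℕ → ℚ
  pre i v = total (X i) (downFrom v)

  before≡pre : ∀ i {v} → v ∈ V → before i v ≡ pre i v
  before≡pre i v∈ = initial (X i) n (<⇒≤ (∈-downFrom⁻ v∈))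

  module _ (e : Interval) {v : ℕ} (v∈ : v ∈ V) where
    private
      j = site e
      M = proj₁ (proj₂ e)

    left right : ℚ
    left  = M ℚ.+ before j v
    right = left ℚ.+ X j v

    left≤right : left ℚ.≤ right
    left≤right = ≤-by (X j v) (0≤X j v) (ℚ.+-comm (X j v) left)

    M≤left : M ℚ.≤ left
    M≤left = ≤-by (before j v) (ℚ.≤-trans (total-nonneg (X j) (0≤X j) (downFrom v)) (ℚ.≤-reflexive (sym (before≡pre j v∈))))
      (ℚ.+-comm (before j v) M)

    right≡ : right ≡ M ℚ.+ pre j (suc v)
    right≡ = trans (cong (λ z → (M ℚ.+ z) ℚ.+ X j v) (before≡pre j v∈)) (arith M (pre j v) (X j v))
      where
      arith : ∀ m p x → (m ℚ.+ p) ℚ.+ x ≡ m ℚ.+ (x ℚ.+ p)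
      arith = Ring.solve-∀ ℚ-ring

    right≤ : right ℚ.≤ M ℚ.+ load j
    right≤ = ℚ.≤-trans (ℚ.≤-reflexive right≡)
      (ℚ.+-monoʳ-≤ M (total-downFrom-mono (X j) (0≤X j) n (∈-downFrom⁻ v∈)))

    right-left : right ℚ.- left ≡ X j v
    right-left = arith left (X j v)
      where
      arith : ∀ l x → (l ℚ.+ x) ℚ.- l ≡ x
      arith = Ring.solve-∀ ℚ-ring

  share-nonneg : ∀ {v e′ e} → v ∈ V → e′ ∈ out → 0ℚ ℚ.≤ share v e′ e
  share-nonneg {v} {e′} {e} v∈ e′∈ =
    meet-nonneg (left e v∈) (right e v∈) (proj₁ (proj₂ (proj₂ e′))) (proj₂ (proj₂ (proj₂ e′))) (left≤right e v∈) (Fits.lo≤hi (out-fits e′∈))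

  share≤ : ∀ {v e′ e} → v ∈ V → share v e′ e ℚ.≤ X (site e) v
  share≤ {v} {e′} {e} v∈ = ℚ.≤-trans (meet≤ (left e v∈) (right e v∈) (proj₁ (proj₂ (proj₂ e′))) (proj₂ (proj₂ (proj₂ e′))) (left≤right e v∈))
    (ℚ.≤-reflexive (right-left e v∈))

  -- A share is the increment of `stretch l r` over a capacity interval. These intervals follow each
  -- other from 0 to `whole` and so exhaust the segment from `l` to `r`; the sum telescopes to its
  -- length.
  shares-of-client : ∀ {v e} → v ∈ V → e ∈ out → total (λ e′ → share v e′ e) out ≡ X (site e) v
  shares-of-client {v} {e} v∈ e∈ = trans (cong (total (λ e′ → share v e′ e)) out≡)
    (trans (fills-telescope (stretch l r) D)
      (trans (cong (λ z → stretch l r z ℚ.- stretch l r 0ℚ) fill-all≡whole)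
        (trans (cong₂ ℚ._-_
            (cong₂ ℚ._-_ (⊓ʳ≡ˡ r≤) (⊓ʳ≡ˡ (ℚ.≤-trans (left≤right e v∈) r≤)))
            (cong₂ ℚ._-_ (⊓ʳ≡ʳ (ℚ.≤-trans 0≤l (left≤right e v∈))) (⊓ʳ≡ʳ 0≤l)))
          (trans (arith (r ℚ.- l)) (right-left e v∈)))))
    where
    l = left e v∈
    r = right e v∈
    F = out-fits e∈
    0≤l : 0ℚ ℚ.≤ l
    0≤l = ℚ.≤-trans (Fits.0≤M F) (M≤left e v∈)
    r≤ : r ℚ.≤ whole
    r≤ = ℚ.≤-trans (right≤ e v∈) (ℚ.≤-trans (Fits.M≤B F) (B≤whole (suc (proj₁ (proj₂ (proj₁ e))))))
    arith : ∀ x → x ℚ.- (0ℚ ℚ.- 0ℚ) ≡ x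
    arith = Ring.solve-∀ ℚ-ring

  shares-of-load : ∀ e′ e → total (λ v → share v e′ e) V ≡
    cut (proj₁ (proj₂ (proj₂ e′))) (proj₂ (proj₂ (proj₂ e′))) (proj₁ (proj₂ e) ℚ.+ load (site e))
    ℚ.- cut (proj₁ (proj₂ (proj₂ e′))) (proj₂ (proj₂ (proj₂ e′))) (proj₁ (proj₂ e))
  shares-of-load e′@(_ , _ , lo , hi) e@((j , _) , M , _) = trans
    (total-cong V λ {v} v∈ → trans (meet-cut (left e v∈) (right e v∈) lo hi)
      (cong₂ (λ x y → cut lo hi x ℚ.- cut lo hi y) (right≡ e v∈) (cong (M ℚ.+_) (before≡pre j v∈))))
    (trans (telescope (λ v → cut lo hi (M ℚ.+ pre j v)) n)
      (cong (λ z → cut lo hi (M ℚ.+ load j) ℚ.- cut lo hi z) (ℚ.+-identityʳ M)))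

  -- The segments of all vertices follow each other without overlap, so the sum telescopes to a
  -- difference of two values of `cut lo hi`. This is at most the length of the capacity interval,
  -- which is 0 for an unopened vertex.
  shares-of-interval : ∀ {e′} → e′ ∈ out → total (λ e → total (λ v → share v e′ e) V) out ℚ.≤
    fromℕ (L (site e′)) ℚ.* bit (decided (proj₁ e′))
  shares-of-interval {e′@((j , p , d) , M , lo , hi)} e′∈ = ℚ.≤-trans
    (ℚ.≤-reflexive (trans (total-cong out λ {e} _ → shares-of-load e′ e)
      (trans (cong (total λ e → cut lo hi (proj₁ (proj₂ e) ℚ.+ load (site e))
        ℚ.- cut lo hi (proj₁ (proj₂ e))) out≡) (loads-telescope (cut lo hi) D))))
    (ℚ.≤-trans (≤-by _ (proj₁ (cut-bounds 0ℚ 0ℚ lo hi 0ℚ lo≤hi) 0+ 0≤- (proj₂ (cut-bounds 0ℚ 0ℚ lo hi t lo≤hi)))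
        (arith (cut lo hi t) (cut lo hi 0ℚ) (hi ℚ.- lo)))
      (ℚ.≤-trans (ℚ.+-monoˡ-≤ (ℚ.- lo) (Fits.hi≤lo F)) (ℚ.≤-reflexive (arith′ d))))
    where
    F = out-fits e′∈
    lo≤hi = Fits.lo≤hi F
    t = total (load ∘ proj₁) D
    arith : ∀ a b h → (b ℚ.+ (h ℚ.- a)) ℚ.+ (a ℚ.- b) ≡ h
    arith = Ring.solve-∀ ℚ-ring
    arith₁ : ∀ l x → (l ℚ.+ x) ℚ.- l ≡ x ℚ.* 1ℚ
    arith₁ = Ring.solve-∀ ℚ-ring
    arith₀ : ∀ l x → (l ℚ.+ 0ℚ) ℚ.- l ≡ x ℚ.* 0ℚ
    arith₀ = Ring.solve-∀ ℚ-ring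
    arith′ : ∀ d → (lo ℚ.+ (if d then fromℕ (L j) else 0ℚ)) ℚ.- lo ≡ fromℕ (L j) ℚ.* bit d
    arith′ true  = arith₁ lo (fromℕ (L j))
    arith′ false = arith₀ lo (fromℕ (L j))

  -- The conditions of the linear program

  x′ : ℕ → ℕ → ℚ
  x′ = assigned out

  y′ : ℕ → ℚ
  y′ = open? out

  y′-sum : ∀ u → y′ u ≡ total (λ e → bit (decided (proj₁ e)) when (site e ≐ u)) out
  y′-sum u = go out
    where
    go : ∀ es → open? es u ≡ total (λ e → bit (decided (proj₁ e)) when (site e ≐ u)) es
    go []                      = refl
    go (((i , p , d) , _) ∷ es) with i ≐ u
    ... | false = trans (go es) (sym (ℚ.+-identityˡ _))
    go (((i , p , true)  , _) ∷ es) | true = cong (1ℚ ℚ.+_) (go es)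
    go (((i , p , false) , _) ∷ es) | true = trans (go es) (sym (ℚ.+-identityˡ _))

  x′-sum : ∀ u v → x′ u v ≡ total (λ e′ → total (share v e′) out when (site e′ ≐ u)) out
  x′-sum u v = conditional-sum (λ e′ → site e′ ≐ u) (λ e′ → total (share v e′) out) out

  y′-natural : ∀ u → ∃[ m ] y′ u ≡ fromℕ m
  y′-natural u = go out
    where
    go : ∀ es → ∃[ m ] open? es u ≡ fromℕ m
    go []                      = 0 , refl
    go (((i , p , d) , _) ∷ es) with i ≐ u
    ... | false = go es
    go (((i , p , true)  , _) ∷ es) | true =
      let (m , eq) = go es in suc m , trans (cong (1ℚ ℚ.+_) eq) (sym (fromℕ-suc m))
    go (((i , p , false) , _) ∷ es) | true = go es

  0≤bit : ∀ d → 0ℚ ℚ.≤ bit d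
  0≤bit true  = fromℕ-mono 0 1 z≤n
  0≤bit false = ℚ.≤-refl

  bit≤1 : ∀ d → bit d ℚ.≤ 1ℚ
  bit≤1 true  = ℚ.≤-refl
  bit≤1 false = fromℕ-mono 0 1 z≤n

  0≤y′ : ∀ u → 0ℚ ℚ.≤ y′ u
  0≤y′ u = ℚ.≤-trans (total-nonneg _ (λ e → when-nonneg (site e ≐ u) (0≤bit (decided (proj₁ e)))) out)
    (ℚ.≤-reflexive (sym (y′-sum u)))

  y′≤1 : ∀ {u} → u ∈ V → y′ u ℚ.≤ 1ℚ
  y′≤1 {u} u∈ = ℚ.≤-trans (ℚ.≤-reflexive (y′-sum u))
    (ℚ.≤-trans (total-mono out λ {e} _ → when-mono (site e ≐ u) λ _ → bit≤1 (decided (proj₁ e)))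
      (ℚ.≤-reflexive (trans (out-vertices (λ i → 1ℚ when (i ≐ u)))
        (trans (total-cong V λ {i} _ → cong (1ℚ when_) (≐-sym i u)) (total-single 1ℚ distinct u∈)))))

  y′-total : total y′ V ≡ fromℕ k
  y′-total = trans (total-cong V λ {u} _ → y′-sum u)
    (trans (total-swap (λ u e → bit (decided (proj₁ e)) when (site e ≐ u)) V out)
      (trans (total-cong out λ {e} e∈ → total-single (bit (decided (proj₁ e))) distinct (out-∈ e∈))
        (trans (out-total (bit ∘ decided)) (trans (proj₁ (opened-count run-us)) (cong fromℕ (proj₁ phase≡k))))))

  0≤x′ : ∀ u {v} → v ∈ V → 0ℚ ℚ.≤ x′ u v
  0≤x′ u {v} v∈ = ℚ.≤-trans (ℚ.≤-trans (ℚ.≤-reflexive (sym (total-zero {f = λ _ → 0ℚ} out λ _ → refl)))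
    (total-mono out λ {e′} e′∈ → when-nonneg (site e′ ≐ u)
      (ℚ.≤-trans (ℚ.≤-reflexive (sym (total-zero {f = λ _ → 0ℚ} out λ _ → refl)))
        (total-mono out λ {e} _ → share-nonneg {v} {e′} {e} v∈ e′∈))))
    (ℚ.≤-reflexive (sym (x′-sum u v)))

  -- At an opened vertex the shares of `v` are bounded by the original amounts, which sum to the
  -- unit demand of `v`. At an unopened one the capacity interval is a point.
  x′≤y′ : ∀ u {v} → v ∈ V → x′ u v ℚ.≤ y′ u
  x′≤y′ u {v} v∈ = ℚ.≤-trans (ℚ.≤-reflexive (x′-sum u v)) (ℚ.≤-trans
    (total-mono out λ {e′} e′∈ → when-mono (site e′ ≐ u) λ _ → by e′ e′∈)
    (ℚ.≤-reflexive (sym (y′-sum u))))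
    where
    by : ∀ e′ → e′ ∈ out → total (share v e′) out ℚ.≤ bit (decided (proj₁ e′))
    by e′@((_ , _ , true) , _) e′∈ = ℚ.≤-trans (total-mono out λ {e} _ → share≤ {v} {e′} {e} v∈)
      (ℚ.≤-reflexive (trans (out-vertices (λ i → X i v)) (covered₁ v∈)))
    by e′@((_ , _ , false) , _ , lo , hi) e′∈ = ℚ.≤-reflexive (total-zero out λ {e} _ →
      trans (cong (meet (left e v∈) (right e v∈) lo) (sym lo≡hi)) (meet-empty′ (left e v∈) (right e v∈) lo))
      where
      F = out-fits e′∈
      lo≡hi : lo ≡ hi
      lo≡hi = ℚ.≤-antisym (Fits.lo≤hi F) (ℚ.≤-trans (Fits.hi≤lo F) (ℚ.≤-reflexive (ℚ.+-identityʳ lo)))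

  x′-capacity : ∀ u → total (x′ u) V ℚ.≤ fromℕ (L u) ℚ.* y′ u
  x′-capacity u = ℚ.≤-trans (ℚ.≤-reflexive (trans (total-cong V λ {v} _ → x′-sum u v)
      (trans (total-swap (λ v e′ → total (share v e′) out when (site e′ ≐ u)) V out)
        (total-cong out λ {e′} _ → total-when (site e′ ≐ u) (λ v → total (share v e′) out) V))))
    (ℚ.≤-trans (total-mono out λ {e′} → by e′)
      (ℚ.≤-reflexive (trans (total-* (fromℕ (L u)) _ out) (cong (fromℕ (L u) ℚ.*_) (sym (y′-sum u))))))
    where
    by : ∀ e′ → e′ ∈ out → (total (λ v → total (share v e′) out) V when (site e′ ≐ u)) ℚ.≤
         fromℕ (L u) ℚ.* (bit (decided (proj₁ e′)) when (site e′ ≐ u))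
    by e′ e′∈ with site e′ ≐ u in eq
    ... | false = ℚ.≤-reflexive (sym (ℚ.*-zeroʳ (fromℕ (L u))))
    ... | true  = ℚ.≤-trans (ℚ.≤-reflexive (total-swap (λ v e → share v e′ e) V out))
      (ℚ.≤-trans (shares-of-interval e′∈)
        (ℚ.≤-reflexive (cong (λ i → fromℕ (L i) ℚ.* bit (decided (proj₁ e′))) (≐-sound (site e′) u eq))))

  x′-covered : ∀ {v} → v ∈ V → total (λ u → x′ u v) V ≡ 1ℚ
  x′-covered {v} v∈ = trans (total-cong V λ {u} _ → x′-sum u v)
    (trans (total-swap (λ u e′ → total (share v e′) out when (site e′ ≐ u)) V out)
      (trans (total-cong out λ {e′} e′∈ → total-single (total (share v e′) out) distinct (out-∈ e′∈))
        (trans (total-swap (λ e′ e → share v e′ e) out out)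
          (trans (total-cong out λ {e} e∈ → shares-of-client {v} {e} v∈ e∈)
            (trans (out-vertices (λ i → X i v)) (covered₁ v∈))))))

  -- Load moves from `j` to `u`. A nonzero share requires `v` to be in the closed neighbourhood of
  -- `j`, and the intervals of `u` and `j` to overlap, so that their phases are neighbouring; this
  -- gives 22 from `u` to `j` and one more step to `v`.
  x′-local : ∀ {u v} → v ∈ V → ¬ Within 23 u v → x′ u v ≡ 0ℚ
  x′-local {u} {v} v∈ far = trans (x′-sum u v) (total-zero out λ {e′} → by e′)
    where
    none : ∀ e′ e → e′ ∈ out → e ∈ out → site e′ ≡ u → share v e′ e ≡ 0ℚ
    none e′@((_ , p′ , _) , _ , lo , hi) e@((j , p , _) , M , _) e′∈ e∈ refl with near₁ j v in near
    ... | false = trans (cong (λ z → meet (left e v∈) z lo hi)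
        (trans (cong (left e v∈ ℚ.+_) (local₁ j v near)) (ℚ.+-identityʳ (left e v∈)))) (meet-empty (left e v∈) lo hi)
    ... | true with p′ ≤? suc p | p ≤? suc p′
    ...   | yes a | yes b′ = contradiction
      (within-trans (phases-close (out-item e′∈) (out-item e∈) a b′) (hop near v∈ done)) far
    ...   | no p+1<p′ | _ = meet-left (left e v∈) (right e v∈) lo hi (left≤right e v∈)
      (ℚ.≤-trans (right≤ e v∈) (ℚ.≤-trans (Fits.M≤B (out-fits e∈)) (Fits.B≤lo (out-fits e′∈) (≰⇒> p+1<p′))))
      (Fits.lo≤hi (out-fits e′∈))
    ...   | _ | no p′+1<p = meet-right (left e v∈) (right e v∈) lo hi (left≤right e v∈) (Fits.lo≤hi (out-fits e′∈))
      (ℚ.≤-trans (Fits.hi≤B (out-fits e′∈)) (ℚ.≤-trans (B-mono (≰⇒> p′+1<p))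
        (ℚ.≤-trans (Fits.B≤M (out-fits e∈)) (M≤left e v∈))))
    by : ∀ e′ → e′ ∈ out → (total (share v e′) out when (site e′ ≐ u)) ≡ 0ℚ
    by e′ e′∈ with site e′ ≐ u in eq
    ... | false = refl
    ... | true  = total-zero out λ {e} e∈ → none e′ e e′∈ e∈ (≐-sound (site e′) u eq)

-- Vertices as numbers

label : ∀ {n} → Fin n → ℕ
label {suc n} zero    = n
label {suc n} (suc u) = label u

label<n : ∀ {n} (u : Fin n) → label u < n
label<n zero    = ≤-refl
label<n (suc u) = m<n⇒m<1+n (label<n u)

label-injective : ∀ {n} (u v : Fin n) → label u ≡ label v → u ≡ v
label-injective zero    zero    eq = refl
label-injective zero    (suc v) eq = contradiction (subst (_< _) (sym eq) (label<n v)) (<-irrefl refl)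
label-injective (suc u) zero    eq = contradiction (subst (_< _) eq (label<n u)) (<-irrefl refl)
label-injective (suc u) (suc v) eq = cong suc (label-injective u v eq)

data Labelled (n : ℕ) : ℕ → Set where
  vertex  : (u : Fin n) → Labelled n (label u)
  outside : ∀ {i} → n ≤ i → Labelled n i

labelled : ∀ n i → Labelled n i
labelled zero    i = outside z≤n
labelled (suc n) i with labelled n i
... | vertex u    = vertex (suc u)
... | outside n≤i with m≤n⇒m<n∨m≡n n≤i
...   | inj₁ n<i  = outside n<i
...   | inj₂ refl = vertex zero

label∈ : ∀ {n} (u : Fin n) → label u ∈ downFrom n
label∈ u = ∈-downFrom⁺ (label<n u)

∈-labelled : ∀ {n i} → i ∈ downFrom n → ∃[ u ] label {n} u ≡ i
∈-labelled {n} {i} i∈ with labelled n i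
... | vertex u    = u , refl
... | outside n≤i = contradiction (∈-downFrom⁻ i∈) (≤⇒≯ n≤i)

module _ {A : Set} (d : A) where

  ix-∷ : ∀ x xs i → ix d (x ∷ xs) i ≡ (if length xs ≐ i then x else ix d xs i)
  ix-∷ x xs i = cong (λ l → if l ≐ i then x else ix d xs i) (count xs)
    where
    count : ∀ xs → proj₁ (foldr (λ a p → suc (proj₁ p) , (if proj₁ p ≐ i then a else proj₂ p)) (0 , d) xs) ≡ length xs
    count []       = refl
    count (x ∷ xs) = cong suc (count xs)

  -- `label` numbers `Fin n` backwards, with `zero` becoming `n - 1`. This matches the positions of
  -- `ix`, which are counted from the right end, and the decreasing list `downFrom n`.
  ix-label : ∀ {n} (f : Fin n → A) u → ix d (tabulate f) (label u) ≡ f u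
  ix-label {suc n} f zero = trans (ix-∷ (f zero) (tabulate (f ∘ suc)) n)
    (cong (λ b → if b then f zero else ix d (tabulate (f ∘ suc)) n) (≐-complete (length-tabulate (f ∘ suc))))
  ix-label {suc n} f (suc u) = trans (ix-∷ (f zero) (tabulate (f ∘ suc)) (label u))
    (trans (cong (λ b → if b then f zero else ix d (tabulate (f ∘ suc)) (label u)) (≐-false (length (tabulate (f ∘ suc))) (label u) λ eq →
        <-irrefl (trans (sym eq) (length-tabulate (f ∘ suc))) (label<n u)))
      (ix-label (f ∘ suc) u))

  ix-outside : ∀ {n i} (f : Fin n → A) → n ≤ i → ix d (tabulate f) i ≡ d
  ix-outside {zero}      f n≤i = refl
  ix-outside {suc n} {i} f n≤i = trans (ix-∷ (f zero) (tabulate (f ∘ suc)) i)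
    (trans (cong (λ b → if b then f zero else ix d (tabulate (f ∘ suc)) i) (≐-false (length (tabulate (f ∘ suc))) i λ eq →
        <-irrefl (trans (sym (length-tabulate (f ∘ suc))) eq) n≤i))
      (ix-outside (f ∘ suc) (<⇒≤ n≤i)))

sum-total : ∀ {n} (f : Fin n → ℚ) (g : ℕ → ℚ) → (∀ u → g (label u) ≡ f u) → sum f ≡ total g (downFrom n)
sum-total {zero}  f g eq = refl
sum-total {suc n} f g eq = cong₂ ℚ._+_ (sym (eq zero)) (sum-total (f ∘ suc) g (eq ∘ suc))

tabulate-downFrom : ∀ {A : Set} {n} (h : ℕ → A) →
  foldr (λ i l → h i ∷ l) [] (downFrom n) ≡ tabulate (λ (u : Fin n) → h (label u))
tabulate-downFrom {n = zero}  h = refl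
tabulate-downFrom {n = suc n} h = cong (h n ∷_) (tabulate-downFrom h)

vertices≡downFrom : ∀ l → vertices l ≡ downFrom (length l)
vertices≡downFrom []      = refl
vertices≡downFrom (_ ∷ l) = trans (cong (λ l → nextVertex l ∷ l) (vertices≡downFrom l))
  (cong (_∷ downFrom (length l)) (next (length l)))
  where
  next : ∀ m → nextVertex (downFrom m) ≡ m
  next zero    = refl
  next (suc m) = refl

-- Abstract, lest conversion checking evaluate the program.
abstract
  algorithm : Program InstanceTy AssignmentTy
  algorithm = rounding

  algorithm≡rounding : algorithm ≡ rounding
  algorithm≡rounding = refl

algorithm-polynomial : PolynomialTimeOn ValidInput algorithm
algorithm-polynomial = tame⇒polynomial algorithm (subst Tame (sym algorithm≡rounding) tame-rounding) ValidInput

algorithm-computes : ∀ {p I A Ls k Xs Ys V adj L X Y} → p ≡ rounding → I ≡ (A , Ls , k , Xs , Ys) →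
  vertices Ls ≡ V → (λ i j → ix false (ix [] A i) j) ≡ adj → ix 0 Ls ≡ L →
  (λ i j → ix 0ℚ (ix [] Xs i) j) ≡ X → ix 0ℚ Ys ≡ Y →
  run p I ≡ Algorithm.result V adj L X Y
algorithm-computes {A = A} {Ls} {k} {Xs} {Ys} refl refl refl refl refl refl refl =
  rounding-computes A Ls k Xs Ys

module _ (n : ℕ) (adj : ℕ → ℕ → Bool) (L : ℕ → ℕ) (X : ℕ → ℕ → ℚ) (Y : ℕ → ℚ) where
  open Algorithm (downFrom n) adj L X Y

  output-tabulate : ∀ out → output out ≡
    (tabulate (λ (u : Fin n) → tabulate (λ (v : Fin n) → assigned out (label u) (label v))) ,
     tabulate (λ (u : Fin n) → open? out (label u)))
  output-tabulate out = cong₂ _,_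
    (trans (tabulate-downFrom (λ i → foldr (λ j l → assigned out i j ∷ l) [] (downFrom n)))
      (tabulate-cong λ u → tabulate-downFrom (assigned out (label u))))
    (tabulate-downFrom (open? out))

-- The encoded instance and the final statement

module Encoded {n} (G : Graph n) (L : Fin n → ℕ) (k : ℕ) (x : Fin n → Fin n → ℚ) (y : Fin n → ℚ) where

  adjⁿ : ℕ → ℕ → Bool
  adjⁿ i j = ix false (ix [] (matrix (adj G)) i) j

  Lⁿ : ℕ → ℕ
  Lⁿ = ix 0 (tabulate L)

  xⁿ : ℕ → ℕ → ℚ
  xⁿ i j = ix 0ℚ (ix [] (matrix x) i) j

  yⁿ : ℕ → ℚ
  yⁿ = ix 0ℚ (tabulate y)

  entry : ∀ {A : Set} (d : A) (f : Fin n → Fin n → A) u v →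
          ix d (ix [] (matrix f) (label u)) (label v) ≡ f u v
  entry d f u v = trans (cong (λ r → ix d r (label v)) (ix-label [] (λ u → tabulate (f u)) u)) (ix-label d (f u) v)

  no-row : ∀ {A : Set} (d : A) (f : Fin n → Fin n → A) {i} j → n ≤ i → ix d (ix [] (matrix f) i) j ≡ d
  no-row d f j n≤i = cong (λ r → ix d r j) (ix-outside [] (λ u → tabulate (f u)) n≤i)

  no-column : ∀ {A : Set} (d : A) (f : Fin n → Fin n → A) u {j} → n ≤ j →
              ix d (ix [] (matrix f) (label u)) j ≡ d
  no-column d f u {j} n≤j =
    trans (cong (λ r → ix d r j) (ix-label [] (λ u → tabulate (f u)) u)) (ix-outside d (f u) n≤j)

  adjⁿ-sym : ∀ i j → adjⁿ i j ≡ adjⁿ j i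
  adjⁿ-sym i j with labelled n i | labelled n j
  ... | vertex u    | vertex v    =
    trans (entry false (adj G) u v) (trans (Graph.symmetric G u v) (sym (entry false (adj G) v u)))
  ... | vertex u    | outside n≤j = trans (no-column false (adj G) u n≤j) (sym (no-row false (adj G) (label u) n≤j))
  ... | outside n≤i | vertex v    = trans (no-row false (adj G) (label v) n≤i) (sym (no-column false (adj G) v n≤i))
  ... | outside n≤i | outside n≤j = trans (no-row false (adj G) j n≤i) (sym (no-row false (adj G) i n≤j))

  data Entry (i j : ℕ) : Set where
    inside : ∀ u v → label u ≡ i → label v ≡ j → xⁿ i j ≡ x u v → Entry i j
    zeroᵉ  : xⁿ i j ≡ 0ℚ → Entry i j

  x-entry : ∀ i j → Entry i j
  x-entry i j with labelled n i | labelled n j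
  ... | vertex u    | vertex v    = inside u v refl refl (entry 0ℚ x u v)
  ... | vertex u    | outside n≤j = zeroᵉ (no-column 0ℚ x u n≤j)
  ... | outside n≤i | _           = zeroᵉ (no-row 0ℚ x j n≤i)

  open Algorithm (downFrom n) adjⁿ Lⁿ xⁿ yⁿ using (near₁; load)
  open Geometry (downFrom n) adjⁿ Lⁿ xⁿ yⁿ adjⁿ-sym using (Within; done; hop; near₁-refl)

  near₁-edge : ∀ {u v} → adj G u v ≡ true → near₁ (label u) (label v) ≡ true
  near₁-edge {u} {v} e with label u ≐ label v
  ... | true  = refl
  ... | false = trans (entry false (adj G) u v) e

  walk⇒within : ∀ {u v ℓ} → Walk G u v ℓ → Within ℓ (label u) (label v)
  walk⇒within stop           = done
  walk⇒within (step {v = v} e w) = hop (near₁-edge e) (label∈ v) (walk⇒within w)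

  -- A hop may stay where it is, as `near₁` includes equality. Such hops are dropped, so the walk
  -- may be shorter than `d`.
  within⇒walk : ∀ {d i j} → Within d i j → ∀ u v → label u ≡ i → label v ≡ j → ∃[ ℓ ] (ℓ ≤ d × Walk G u v ℓ)
  within⇒walk done u v refl eq with label-injective v u eq
  ... | refl = 0 , z≤n , stop
  within⇒walk (hop {j = j} near j∈ w) u v refl eq with ∈-labelled j∈
  ... | t , refl with within⇒walk w t v refl eq
  ...   | ℓ , ℓ≤d , walk with label u ≐ label t in same
  ...     | false = suc ℓ , s≤s ℓ≤d , step (trans (sym (entry false (adj G) u t)) near) walk
  ...     | true with label-injective u t (≐-sound (label u) (label t) same)
  ...       | refl = ℓ , m≤n⇒m≤1+n ℓ≤d , walk

  module _ (conn : Connected G) (1≤k : 1 ≤ k) (lp : LP1 G L k x y) where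
    open Feasible lp

    massⁿ : total yⁿ (downFrom n) ≡ fromℕ k
    massⁿ = trans (sym (sum-total y yⁿ (ix-label 0ℚ y))) opened

    -- Without vertices the openings would sum to 0 instead of the positive `k`. A vertex numbered 0
    -- is needed as the root of the line.
    1≤n : 1 ≤ n
    1≤n = n≢0⇒n>0 λ { refl → contradiction (fromℕ-cancel-≤ k 0 (ℚ.≤-reflexive (sym massⁿ))) (<⇒≱ 1≤k) }

    yⁿ-bounds : ∀ i → 0ℚ ℚ.≤ yⁿ i × yⁿ i ℚ.≤ 1ℚ
    yⁿ-bounds i with labelled n i
    ... | vertex u    = subst (λ q → 0ℚ ℚ.≤ q × q ℚ.≤ 1ℚ) (sym (ix-label 0ℚ y u)) (y-bounds u)
    ... | outside n≤i = subst (λ q → 0ℚ ℚ.≤ q × q ℚ.≤ 1ℚ) (sym (ix-outside 0ℚ y n≤i)) (ℚ.≤-refl , fromℕ-mono 0 1 z≤n)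

    0≤xⁿ : ∀ i j → 0ℚ ℚ.≤ xⁿ i j
    0≤xⁿ i j with x-entry i j
    ... | inside u v _ _ eq = ℚ.≤-trans (x-nonneg u v) (ℚ.≤-reflexive (sym eq))
    ... | zeroᵉ eq          = ℚ.≤-reflexive (sym eq)

    xⁿ≤yⁿ : ∀ i j → xⁿ i j ℚ.≤ yⁿ i
    xⁿ≤yⁿ i j with x-entry i j
    ... | inside u v refl _ eq = ℚ.≤-trans (ℚ.≤-reflexive eq)
      (ℚ.≤-trans (served≤open u v) (ℚ.≤-reflexive (sym (ix-label 0ℚ y u))))
    ... | zeroᵉ eq             = ℚ.≤-trans (ℚ.≤-reflexive eq) (proj₁ (yⁿ-bounds i))

    loadⁿ≤ : ∀ i → load i ℚ.≤ fromℕ (Lⁿ i) ℚ.* yⁿ i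
    loadⁿ≤ i with labelled n i
    ... | vertex u    = ℚ.≤-trans (ℚ.≤-reflexive (sym (sum-total (x u) (xⁿ (label u)) (entry 0ℚ x u))))
      (ℚ.≤-trans (capacity u) (ℚ.≤-reflexive (sym (cong₂ (λ m q → fromℕ m ℚ.* q) (ix-label 0 L u) (ix-label 0ℚ y u)))))
    ... | outside n≤i = ℚ.≤-reflexive (trans (total-zero (downFrom n) λ {j} _ → no-row 0ℚ x j n≤i)
      (sym (trans (cong (fromℕ (Lⁿ i) ℚ.*_) (ix-outside 0ℚ y n≤i)) (ℚ.*-zeroʳ (fromℕ (Lⁿ i))))))

    localⁿ : ∀ i j → near₁ i j ≡ false → xⁿ i j ≡ 0ℚ
    localⁿ i j far with x-entry i j
    ... | zeroᵉ eq                = eq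
    ... | inside u v refl refl eq = trans eq (local u v λ
      { stop                → contradiction (trans (sym (near₁-refl (label u))) far) λ ()
      ; (step e stop)       → contradiction (trans (sym (near₁-edge e)) far) λ ()
      ; (step _ (step _ _)) → s≤s (s≤s z≤n) })

    connectedⁿ : ∀ {i} → i ∈ downFrom n → ∃[ d ] Within d i 0
    connectedⁿ i∈ with ∈-labelled i∈ | ∈-labelled (∈-downFrom⁺ 1≤n)
    ... | u , refl | r , eq = let (ℓ , w) = conn u r in ℓ , subst (Within ℓ (label u)) eq (walk⇒within w)

    coveredⁿ : ∀ {j} → j ∈ downFrom n → total (λ i → xⁿ i j) (downFrom n) ≡ 1ℚ
    coveredⁿ j∈ with ∈-labelled j∈
    ... | v , refl = trans (sym (sum-total (λ u → x u v) (λ i → xⁿ i (label v)) λ u → entry 0ℚ x u v)) (covered v)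

    solution : LPSolution n adjⁿ Lⁿ xⁿ yⁿ k
    solution = record
      { adj-sym   = adjⁿ-sym
      ; root∈     = ∈-downFrom⁺ 1≤n
      ; connected = connectedⁿ
      ; 0≤X       = 0≤xⁿ
      ; X≤Y       = xⁿ≤yⁿ
      ; Y-bounds  = yⁿ-bounds
      ; load≤     = loadⁿ≤
      ; covered₁  = coveredⁿ
      ; local₁    = localⁿ
      ; mass      = massⁿ
      }

    out : List Interval
    out = Algorithm.intervals (downFrom n) adjⁿ Lⁿ xⁿ yⁿ

    x′ : ℕ → ℕ → ℚ
    x′ = Algorithm.assigned (downFrom n) adjⁿ Lⁿ xⁿ yⁿ out

    y′ : ℕ → ℚ
    y′ = Algorithm.open? (downFrom n) adjⁿ Lⁿ xⁿ yⁿ out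

    rounded-x : Fin n → Fin n → ℚ
    rounded-x u v = x′ (label u) (label v)

    rounded-y : Fin n → ℚ
    rounded-y u = y′ (label u)

    rounded-feasible : Feasible 23 G L k rounded-x rounded-y
    rounded-feasible = record
      { opened      = trans (sum-total rounded-y y′ λ _ → refl) (Assignment.y′-total solution)
      ; served≤open = λ u v → Assignment.x′≤y′ solution (label u) (label∈ v)
      ; capacity    = λ u → ℚ.≤-trans (ℚ.≤-reflexive (sum-total (rounded-x u) (x′ (label u)) λ _ → refl))
          (ℚ.≤-trans (Assignment.x′-capacity solution (label u)) (ℚ.≤-reflexive (cong (λ m → fromℕ m ℚ.* y′ (label u)) (ix-label 0 L u))))
      ; covered     = λ v → trans (sum-total (λ u → rounded-x u v) (λ i → x′ i (label v)) λ _ → refl) (Assignment.x′-covered solution (label∈ v))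
      ; y-bounds    = λ u → Assignment.0≤y′ solution (label u) , Assignment.y′≤1 solution (label∈ u)
      ; local       = λ u v exceeds → Assignment.x′-local solution (label∈ v) λ w →
          let (ℓ , ℓ≤23 , walk) = within⇒walk w u v refl refl in <⇒≱ (exceeds walk) ℓ≤23
      ; x-nonneg    = λ u v → Assignment.0≤x′ solution (label u) (label∈ v)
      }

    rounded-integer : ∀ u → IsInteger (rounded-y u)
    rounded-integer u = let (m , eq) = Assignment.y′-natural solution (label u) in + m , eq

    algorithm-result : run algorithm (encodeInstance G L k x y) ≡ encodeAssignment rounded-x rounded-y
    algorithm-result = trans
      (algorithm-computes {algorithm} {encodeInstance G L k x y} {matrix (adj G)} {tabulate L} {k} {matrix x} {tabulate y}
        {adj = adjⁿ} {Lⁿ} {xⁿ} {yⁿ} algorithm≡rounding refl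
        (trans (vertices≡downFrom (tabulate L)) (cong downFrom (length-tabulate L))) refl refl refl refl)
      (output-tabulate n adjⁿ Lⁿ xⁿ yⁿ out)

mainTheorem18 : ∃[ c ] Σ[ p ∈ Program InstanceTy AssignmentTy ]
    PolynomialTimeOn ValidInput p ×
    (∀ {n : ℕ} (G : Graph n) (L : Fin n → ℕ) (k : ℕ) →
    Connected G → 1 ≤ k →
    ∀ (x : Fin n → Fin n → ℚ) (y : Fin n → ℚ) → LP1 G L k x y →
    ∃[ x′ ] ∃[ y′ ]
    (run p (encodeInstance G L k x y) ≡ encodeAssignment x′ y′ ×
    Feasible c G L k x′ y′ ×
    (∀ u → IsInteger (y′ u))))
mainTheorem18 = 23 , algorithm , algorithm-polynomial , λ G L k conn 1≤k x y lp →
  Encoded.rounded-x G L k x y conn 1≤k lp , Encoded.rounded-y G L k x y conn 1≤k lp ,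
  Encoded.algorithm-result G L k x y conn 1≤k lp ,
  Encoded.rounded-feasible G L k x y conn 1≤k lp ,
  Encoded.rounded-integer G L k x y conn 1≤k lp
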